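{- In the ring $\mathfrak P[[x]]$ of formal power series over the polytope ring, the series $$\alpha(x)=x+\sum_{n=1}^\infty \mathfrak a_n x^{n+1},\qquad \beta(x)=x-\sum_{n=1}^\infty \mathfrak a_n^\circ x^{n+1}$$ are compositionally inverse to each other: $\alpha(\beta(x))=x$ and $\beta(\alpha(x))=x$.
   Context: $\mathfrak P$ is the commutative ring freely generated as an abelian group by combinatorial equivalence classes of convex polytopes, with multiplication given by the Cartesian product; the point is the unit. For a polytope $P$, $\mathcal F(P)$ denotes the set of all its nonempty faces (including $P$ itself), each regarded as an element of $\mathfrak P$. The associahedron $\mathfrak a_n$ ($n\ge1$) is the $(n-1)$-dimensional graph-associahedron of the path graph with $n$ vertices, i.e. the polytope $\{x\in\mathbb R^n:\sum_{i=1}^n x_i=3^n,\ \sum_{i=a}^{b}x_i\ge 3^{b-a+1}\text{ for all }1\le a\le b\le n,\ (a,b)\ne(1,n)\}$; in particular $\mathfrak a_1$ is a point. The weighted motivic interior is $\mathfrak a_n^\circ=\sum_{f\in\mathcal F(\mathfrak a_n)}(-\mathfrak a_1)^{\operatorname{codim} f}\, f$.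
   Formalization: Polytopes are taken in rational rather than real coordinate space: the polytope ring is generated by rational inequality systems, and the associahedra and their faces are sets of rational points. -}

module Defs where

open import Data.Bool using (Bool; true; false; if_then_else_; _∧_; not)
open import Data.Nat as ℕ using (ℕ; zero; suc; _≤ᵇ_; _≡ᵇ_; _^_)
open import Data.Integer as ℤ using (ℤ)
open import Data.Rational as ℚ using (ℚ; 0ℚ; 1ℚ)
open import Data.Fin using (Fin; toℕ)
open import Data.Vec as Vec using (Vec; []; _∷_)
open import Data.List as List using (List; []; _∷_; _++_; concatMap; upTo)
open import Data.List.Relation.Unary.All using (All)
import Data.Vec.Relation.Unary.All as VAll
open import Data.List.Relation.Unary.Any using (Any)
open import Data.List.Relation.Unary.AllPairs using (AllPairs)
open import Data.Product using (Σ; ∃; _×_; _,_; proj₁; proj₂)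
open import Relation.Nullary using (¬_)
open import Relation.Binary.PropositionalEquality using (_≡_)
open import Relation.Binary.Construct.Closure.Equivalence using (EqClosure)

ℚ^ : ℕ → Set
ℚ^ d = Vec ℚ d

dot : ∀ {d} → ℚ^ d → ℚ^ d → ℚ
dot []       []       = 0ℚ
dot (a ∷ as) (x ∷ xs) = a ℚ.* x ℚ.+ dot as xs

zeros : ∀ d → ℚ^ d
zeros d = Vec.replicate d 0ℚ

_-ᵥ_ : ∀ {d} → ℚ^ d → ℚ^ d → ℚ^ d
u -ᵥ v = Vec.zipWith ℚ._-_ u v

_+ᵥ_ : ∀ {d} → ℚ^ d → ℚ^ d → ℚ^ d
u +ᵥ v = Vec.zipWith ℚ._+_ u v

linComb : ∀ {d k} → Vec ℚ k → Vec (ℚ^ d) k → ℚ^ d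
linComb {d} []       []       = zeros d
linComb     (c ∷ cs) (v ∷ vs) = Vec.map (c ℚ.*_) v +ᵥ linComb cs vs

LinIndep : ∀ {d k} → Vec (ℚ^ d) k → Set
LinIndep {d} {k} vs = (cs : Vec ℚ k) → linComb cs vs ≡ zeros d → cs ≡ zeros k

AffIndep : ∀ {d k} → Vec (ℚ^ d) (suc k) → Set
AffIndep (p ∷ ps) = LinIndep (Vec.map (λ q → q -ᵥ p) ps)

Ineq : ℕ → Set
Ineq d = ℚ^ d × ℚ

record Pres : Set where
  constructor pres
  field
    dim   : ℕ
    ineqs : List (Ineq dim)
open Pres public

Mem : (P : Pres) → ℚ^ (dim P) → Set
Mem P x = All (λ ab → proj₂ ab ℚ.≤ dot (proj₁ ab) x) (ineqs P)

NonEmpty : Pres → Set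
NonEmpty P = ∃ λ x → Mem P x

_⊆ₚ_ : ∀ {d} → List (Ineq d) → List (Ineq d) → Set
_⊆ₚ_ {d} I J = ∀ x → Mem (pres d I) x → Mem (pres d J) x

-- tightening: the inequalities flagged true are also imposed reversed,
-- i.e. they become equalities
negIneq : ∀ {d} → Ineq d → Ineq d
negIneq (a , b) = Vec.map ℚ.-_ a , ℚ.- b

tight : ∀ {d} → List (Ineq d) → List Bool → List (Ineq d)
tight []       _            = []
tight (_ ∷ is) []           = []
tight (i ∷ is) (true ∷ ts)  = negIneq i ∷ tight is ts
tight (i ∷ is) (false ∷ ts) = tight is ts

faceOf : (P : Pres) → List Bool → Pres
faceOf P T = pres (dim P) (ineqs P ++ tight (ineqs P) T)

-- nonempty faces of P (possibly listed with repetitions, as sets they are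
-- exactly the nonempty faces, P itself included via T = [])
record Face (P : Pres) : Set where
  constructor face
  field
    tightSet : List Bool
    nonempty : NonEmpty (faceOf P tightSet)
open Face public

faceP : ∀ {P} → Face P → Pres
faceP {P} F = faceOf P (tightSet F)

_⊑_ : ∀ {P} → Face P → Face P → Set
_⊑_ {P} F G = ineqs (faceOf P (tightSet F)) ⊆ₚ ineqs (faceOf P (tightSet G))

_≡ₛ_ : ∀ {P} → Face P → Face P → Set
F ≡ₛ G = (F ⊑ G) × (G ⊑ F)

record _≅_ (P Q : Pres) : Set where
  field
    to      : Face P → Face Q
    from    : Face Q → Face P
    to-mono : ∀ F G → F ⊑ G → to F ⊑ to G
    to-refl : ∀ F G → to F ⊑ to G → F ⊑ G
    from-to : ∀ F → from (to F) ≡ₛ F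
    to-from : ∀ G → to (from G) ≡ₛ G

_×ₚ_ : Pres → Pres → Pres
pres m I ×ₚ pres n J =
  pres (m ℕ.+ n)
       (List.map (λ ab → (proj₁ ab Vec.++ zeros n) , proj₂ ab) I
        ++ List.map (λ ab → (zeros m Vec.++ proj₁ ab) , proj₂ ab) J)

pointₚ : Pres
pointₚ = pres 0 []

HasAffDim : Pres → ℕ → Set
HasAffDim P k =
  (Σ (Vec (ℚ^ (dim P)) (suc k)) λ ps → VAll.All (Mem P) ps × AffIndep ps)
  × ((ps : Vec (ℚ^ (dim P)) (suc (suc k))) → VAll.All (Mem P) ps → ¬ AffIndep ps)

HasCodim : (P : Pres) → Face P → ℕ → Set
HasCodim P F c = ∃ λ dP → ∃ λ dF →
  HasAffDim P dP × HasAffDim (faceP F) dF × dP ≡ dF ℕ.+ c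

-- The polytope ring 𝔓: formal ℤ-combinations of presentations, modulo
-- the equivalence making it the free abelian group on combinatorial
-- equivalence classes.

𝔓 : Set
𝔓 = List (ℤ × Pres)

data Step : 𝔓 → 𝔓 → Set where
  swap    : ∀ x y l → Step (x ∷ y ∷ l) (y ∷ x ∷ l)
  merge   : ∀ a b P l → Step ((a , P) ∷ (b , P) ∷ l) ((a ℤ.+ b , P) ∷ l)
  drop0   : ∀ P l → Step ((ℤ.0ℤ , P) ∷ l) l
  relabel : ∀ a P Q l → P ≅ Q → Step ((a , P) ∷ l) ((a , Q) ∷ l)
  there   : ∀ x l l′ → Step l l′ → Step (x ∷ l) (x ∷ l′)

infix 4 _≈_
_≈_ : 𝔓 → 𝔓 → Set
_≈_ = EqClosure Step

0𝔓 : 𝔓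
0𝔓 = []

1𝔓 : 𝔓
1𝔓 = (ℤ.1ℤ , pointₚ) ∷ []

_+𝔓_ : 𝔓 → 𝔓 → 𝔓
_+𝔓_ = _++_

-𝔓_ : 𝔓 → 𝔓
-𝔓_ = List.map (λ cp → ℤ.- proj₁ cp , proj₂ cp)

_*𝔓_ : 𝔓 → 𝔓 → 𝔓
u *𝔓 v = concatMap (λ cp → List.map (λ dq → proj₁ cp ℤ.* proj₁ dq , proj₂ cp ×ₚ proj₂ dq) v) u

_^𝔓_ : 𝔓 → ℕ → 𝔓
u ^𝔓 zero  = 1𝔓
u ^𝔓 suc k = u *𝔓 (u ^𝔓 k)

[_] : Pres → 𝔓
[ P ] = (ℤ.1ℤ , P) ∷ []

Σ≤ : ℕ → (ℕ → 𝔓) → 𝔓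
Σ≤ m f = concatMap f (upTo (suc m))

qℕ : ℕ → ℚ
qℕ k = ℤ.+ k ℚ./ 1

interval : (n a b : ℕ) → ℚ^ n
interval n a b = Vec.tabulate (λ (i : Fin n) →
  if (a ≤ᵇ suc (toℕ i)) ∧ (suc (toℕ i) ≤ᵇ b) then 1ℚ else 0ℚ)

pairs : ℕ → List (ℕ × ℕ)
pairs n = concatMap (λ a′ → concatMap (λ b′ →
            let a = suc a′ ; b = suc b′ in
            if (a ≤ᵇ b) ∧ not ((a ≡ᵇ 1) ∧ (b ≡ᵇ n)) then (a , b) ∷ [] else [])
          (upTo n)) (upTo n)

assoc : ℕ → Pres
assoc n = pres n
  ( (interval n 1 n , qℕ (3 ^ n))
  ∷ negIneq (interval n 1 n , qℕ (3 ^ n))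
  ∷ List.map (λ ab → interval n (proj₁ ab) (proj₂ ab)
                   , qℕ (3 ^ (suc (proj₂ ab) ℕ.∸ proj₁ ab)))
             (pairs n))

-- The weighted motivic interior.  Since 𝓕(P) is a *set* of faces, the sum
-- is taken w.r.t. any exhaustive, repetition-free (up to equality of faces
-- as point sets) enumeration of the nonempty faces, with their codimensions.

record FaceEnum (P : Pres) : Set where
  field
    faces    : List (Face P × ℕ)
    codims   : All (λ Fc → HasCodim P (proj₁ Fc) (proj₂ Fc)) faces
    complete : ∀ (F : Face P) → Any (λ Gc → F ≡ₛ proj₁ Gc) faces
    distinct : AllPairs (λ Fc Gc → ¬ (proj₁ Fc ≡ₛ proj₁ Gc)) faces
open FaceEnum public

interior : (P : Pres) → FaceEnum P → 𝔓
interior P E = concatMap (λ Fc → ((-𝔓 [ assoc 1 ]) ^𝔓 proj₂ Fc) *𝔓 [ faceP (proj₁ Fc) ]) (faces E)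

Series : Set
Series = ℕ → 𝔓

_⋆_ : Series → Series → Series
(f ⋆ g) m = Σ≤ m (λ i → f i *𝔓 g (m ℕ.∸ i))

oneS : Series
oneS zero    = 1𝔓
oneS (suc _) = 0𝔓

xS : Series
xS 1 = 1𝔓
xS _ = 0𝔓

_^S_ : Series → ℕ → Series
f ^S zero  = oneS
f ^S suc k = f ⋆ (f ^S k)

-- f ∘ g for g with zero constant term: [x^m] Σ_k f_k g^k, only k ≤ m contribute
_∘S_ : Series → Series → Series
(f ∘S g) m = Σ≤ m (λ k → f k *𝔓 (g ^S k) m)

α : Series
α zero          = 0𝔓
α (suc zero)    = 1𝔓
α (suc (suc k)) = [ assoc (suc k) ]

β : ((n : ℕ) → FaceEnum (assoc (suc n))) → Series
β E zero          = 0𝔓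
β E (suc zero)    = 1𝔓
β E (suc (suc k)) = -𝔓 interior (assoc (suc k)) (E k)

-- Let X be the partial sums of the coordinates of a point of 𝔞ₙ. The inequality of an interval is a lower bound
-- for the rise of X between two of the n + 1 indices ("leaves") 0, …, n. Since 3ᵃ + 3ᵇ < 3ᶜ for a, b < c, two
-- intervals that overlap or are adjacent are never tight at the same point, so the tight intervals form a laminar
-- family of intervals of leaves, that is, a planar tree with n + 1 leaves. Conversely the midpoint of the vertices
-- given by refining every node of a tree to a left comb and to a right comb is tight exactly at the tubes of the
-- tree. Hence faces correspond to trees, inclusion of faces to refinement of trees, and the codimension of a face
-- is the number of nodes of its tree minus one. Refining a tree amounts to refining its nodes independently, so
-- the face of a tree is equivalent to the product of the associahedra of its nodes.
--
-- Therefore the coefficient of xᵐ in β is the sum over the trees with m leaves of (-1)^(number of nodes) times the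
-- product of the associahedra of the nodes, and splitting off the root gives β = x - Σ_{k ≥ 2} 𝔞ₖ₋₁ βᵏ, which is α
-- ∘ β = x. The other identity is formal: α ∘ (β ∘ α) = (α ∘ β) ∘ α = α ∘ x, and α can be cancelled on the left.

module Submission where

-- The generators of `𝔓` are identified along equivalences of their face preorders, so every
-- isomorphism below is such an equivalence and no affine map is ever constructed. Two things must
-- nevertheless come out of the inequalities. A face is a tight set together with a point, and an
-- inclusion of faces is an inclusion of point sets; nonemptiness and the passage from inclusions to
-- tubes are both settled by the one point that is tight exactly at the tubes of a tree. A
-- codimension is a statement about affinely independent points, so the dimension of a face has to
-- be bounded from both sides. For this the midpoint is doubled: its partial sums become integers,
-- strict inequalities become gaps of at least 1, and there is room to add any function with values
-- 0 and 1 that agrees at the two ends of every tube. In the other direction, differences of points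
-- of a face are determined by their values at the free leaves. Finally, the enumeration of faces is
-- arbitrary, so the sums over trees are read off from it, and splitting off the root compares two
-- duplicate-free lists of the same trees.

open import Level using (0ℓ)
open import Algebra.Bundles using (CommutativeRing)

-- Formal power series over a commutative ring and their composition.

module SeriesAlgebra (R : CommutativeRing 0ℓ 0ℓ) where

  open CommutativeRing R
  open import Algebra.Properties.CommutativeSemigroup +-commutativeSemigroup
    using () renaming (interchange to +-interchange)
  open import Algebra.Properties.CommutativeSemigroup *-commutativeSemigroup
    using () renaming (x∙yz≈y∙xz to *-swapˡ)
  open import Relation.Binary.Reasoning.Setoid setoid
  open import Data.Nat as ℕ using (ℕ; zero; suc; z≤n; s≤s)
  import Data.Nat.Properties as ℕₚ
  open import Data.List using (foldr; applyUpTo; upTo; map)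
  open import Data.List.Properties using (map-applyUpTo)
  open import Function using (_∘_; id)
  open import Relation.Binary.PropositionalEquality as ≡ using (_≡_)

  Ser : Set
  Ser = ℕ → Carrier

  -- Over `𝔓-ring` this reduces to the `concatMap` over `upTo` by which `_⋆_` and `_∘S_` are
  -- defined, so the sums on both sides agree by unfolding; `Σ<` is the form suited to induction.
  sumBelow : ℕ → Ser → Carrier
  sumBelow n f = foldr _+_ 0# (map f (upTo n))

  Σ< : ℕ → Ser → Carrier
  Σ< zero    f = 0#
  Σ< (suc n) f = f 0 + Σ< n (f ∘ suc)

  sumBelow≡Σ< : ∀ n f → sumBelow n f ≡ Σ< n f
  sumBelow≡Σ< n f = ≡.trans (≡.cong (foldr _+_ 0#) (map-applyUpTo id f n)) (go n f)
    where
    go : ∀ n f → foldr _+_ 0# (applyUpTo f n) ≡ Σ< n f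
    go zero    f = ≡.refl
    go (suc n) f = ≡.cong (f 0 +_) (go n (f ∘ suc))

  infixl 7 _⊛_
  opaque
    _⊛_ : Ser → Ser → Ser
    (f ⊛ g) m = sumBelow (suc m) (λ i → f i * g (m ℕ.∸ i))

  one x̂ : Ser
  one zero    = 1#
  one (suc _) = 0#
  x̂ 1 = 1#
  x̂ _ = 0#

  _^ˢ_ : Ser → ℕ → Ser
  f ^ˢ zero  = one
  f ^ˢ suc k = f ⊛ (f ^ˢ k)

  infixl 8 _∘ˢ_
  opaque
    _∘ˢ_ : Ser → Ser → Ser
    (f ∘ˢ g) m = sumBelow (suc m) (λ k → f k * (g ^ˢ k) m)

    ∘ˢ-unfold : ∀ f g m → (f ∘ˢ g) m ≡ sumBelow (suc m) (λ k → f k * (g ^ˢ k) m)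
    ∘ˢ-unfold f g m = ≡.refl

    ∘ˢ≡Σ< : ∀ f g m → (f ∘ˢ g) m ≡ Σ< (suc m) (λ k → f k * (g ^ˢ k) m)
    ∘ˢ≡Σ< f g m = sumBelow≡Σ< (suc m) _

  -- A record and not the bare equation, so that `g` can be inferred from the proof.
  record NoConstant (g : Ser) : Set where
    constructor noConstant
    field constant≈0 : g 0 ≈ 0#
  open NoConstant

  infix 4 _≋[_]_
  _≋[_]_ : Ser → ℕ → Ser → Set
  f ≋[ m ] g = ∀ j → j ℕ.≤ m → f j ≈ g j

  Σ<-cong : ∀ n {f g} → (∀ i → i ℕ.< n → f i ≈ g i) → Σ< n f ≈ Σ< n g
  Σ<-cong zero    h = refl
  Σ<-cong (suc n) h = +-cong (h 0 (s≤s z≤n)) (Σ<-cong n (λ i lt → h (suc i) (s≤s lt)))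

  Σ<-+ : ∀ n f g → Σ< n (λ i → f i + g i) ≈ Σ< n f + Σ< n g
  Σ<-+ zero    f g = sym (+-identityˡ 0#)
  Σ<-+ (suc n) f g = trans (+-congˡ (Σ<-+ n (f ∘ suc) (g ∘ suc))) (+-interchange _ _ _ _)

  Σ<-0 : ∀ n {f} → (∀ i → i ℕ.< n → f i ≈ 0#) → Σ< n f ≈ 0#
  Σ<-0 zero    h = refl
  Σ<-0 (suc n) h = trans (+-cong (h 0 (s≤s z≤n)) (Σ<-0 n (λ i lt → h (suc i) (s≤s lt)))) (+-identityˡ 0#)

  Σ<-*ˡ : ∀ n c f → Σ< n (λ i → c * f i) ≈ c * Σ< n f
  Σ<-*ˡ zero    c f = sym (zeroʳ c)
  Σ<-*ˡ (suc n) c f = trans (+-congˡ (Σ<-*ˡ n c (f ∘ suc))) (sym (distribˡ c _ _))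

  -- The recursion (f⊛g)₍m+1₎ = f₀ g₍m+1₎ + (f′⊛g)ₘ with f′ the tail of f drives every induction below.
  opaque
    unfolding _⊛_

    ⊛-unfold : ∀ f g m → (f ⊛ g) m ≡ sumBelow (suc m) (λ i → f i * g (m ℕ.∸ i))
    ⊛-unfold f g m = ≡.refl

    ⊛-zero : ∀ f g → (f ⊛ g) 0 ≈ f 0 * g 0
    ⊛-zero f g = +-identityʳ _

    ⊛-suc : ∀ f g m → (f ⊛ g) (suc m) ≈ f 0 * g (suc m) + ((f ∘ suc) ⊛ g) m
    ⊛-suc f g m = trans (reflexive (sumBelow≡Σ< (suc (suc m)) _))
                        (+-congˡ (sym (reflexive (sumBelow≡Σ< (suc m) _))))

  -- The coefficient of degree j of a product uses only coefficients of degree up to j. The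
  -- truncated form is needed because inductions on the degree know the factors to agree only up to
  -- a bound.
  ⊛-cong≤ : ∀ {m f f′ g g′} → f ≋[ m ] f′ → g ≋[ m ] g′ → (f ⊛ g) ≋[ m ] (f′ ⊛ g′)
  ⊛-cong≤ p q zero le = trans (⊛-zero _ _) (trans (*-cong (p 0 le) (q 0 le)) (sym (⊛-zero _ _)))
  ⊛-cong≤ {suc m} p q (suc j) (s≤s le) = begin
    _ ≈⟨ ⊛-suc _ _ j ⟩
    _ ≈⟨ +-cong (*-cong (p 0 z≤n) (q (suc j) (s≤s le)))
          (⊛-cong≤ {m} (λ i l → p (suc i) (s≤s l)) (λ i l → q i (ℕₚ.m≤n⇒m≤1+n l)) j le) ⟩
    _ ≈⟨ ⊛-suc _ _ j ⟨
    _ ∎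

  ⊛-cong : ∀ {f f′ g g′} → (∀ i → f i ≈ f′ i) → (∀ i → g i ≈ g′ i) → ∀ m → (f ⊛ g) m ≈ (f′ ⊛ g′) m
  ⊛-cong p q m = ⊛-cong≤ {m} (λ i _ → p i) (λ i _ → q i) m ℕₚ.≤-refl

  ⊛-zeroˡ : ∀ g m → ((λ _ → 0#) ⊛ g) m ≈ 0#
  ⊛-zeroˡ g zero    = trans (⊛-zero _ _) (zeroˡ _)
  ⊛-zeroˡ g (suc m) = trans (⊛-suc _ _ m) (trans (+-cong (zeroˡ _) (⊛-zeroˡ g m)) (+-identityˡ _))

  ⊛-scaleˡ : ∀ c f g m → ((λ i → c * f i) ⊛ g) m ≈ c * (f ⊛ g) m
  ⊛-scaleˡ c f g zero = trans (⊛-zero _ _) (trans (*-assoc _ _ _) (*-congˡ (sym (⊛-zero f g))))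
  ⊛-scaleˡ c f g (suc m) = begin
    _ ≈⟨ ⊛-suc _ _ m ⟩
    _ ≈⟨ +-cong (*-assoc _ _ _) (⊛-scaleˡ c (f ∘ suc) g m) ⟩
    _ ≈⟨ distribˡ c _ _ ⟨
    _ ≈⟨ *-congˡ (⊛-suc f g m) ⟨
    _ ∎

  ⊛-scaleʳ : ∀ c f g m → (f ⊛ (λ i → c * g i)) m ≈ c * (f ⊛ g) m
  ⊛-scaleʳ c f g zero = trans (⊛-zero _ _) (trans (*-swapˡ _ _ _) (*-congˡ (sym (⊛-zero f g))))
  ⊛-scaleʳ c f g (suc m) = begin
    _ ≈⟨ ⊛-suc _ _ m ⟩
    _ ≈⟨ +-cong (*-swapˡ _ _ _) (⊛-scaleʳ c (f ∘ suc) g m) ⟩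
    _ ≈⟨ distribˡ c _ _ ⟨
    _ ≈⟨ *-congˡ (⊛-suc f g m) ⟨
    _ ∎

  ⊛-distribʳ : ∀ f g h m → ((λ i → f i + g i) ⊛ h) m ≈ (f ⊛ h) m + (g ⊛ h) m
  ⊛-distribʳ f g h zero = trans (⊛-zero _ _) (trans (distribʳ _ _ _)
    (+-cong (sym (⊛-zero f h)) (sym (⊛-zero g h))))
  ⊛-distribʳ f g h (suc m) = begin
    _ ≈⟨ ⊛-suc _ _ m ⟩
    _ ≈⟨ +-cong (distribʳ _ _ _) (⊛-distribʳ (f ∘ suc) (g ∘ suc) h m) ⟩
    _ ≈⟨ +-interchange _ _ _ _ ⟩
    _ ≈⟨ +-cong (⊛-suc f h m) (⊛-suc g h m) ⟨
    _ ∎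

  ⊛-distribˡ : ∀ f g h m → (f ⊛ (λ i → g i + h i)) m ≈ (f ⊛ g) m + (f ⊛ h) m
  ⊛-distribˡ f g h zero = trans (⊛-zero _ _) (trans (distribˡ _ _ _)
    (+-cong (sym (⊛-zero f g)) (sym (⊛-zero f h))))
  ⊛-distribˡ f g h (suc m) = begin
    _ ≈⟨ ⊛-suc _ _ m ⟩
    _ ≈⟨ +-cong (distribˡ _ _ _) (⊛-distribˡ (f ∘ suc) g h m) ⟩
    _ ≈⟨ +-interchange _ _ _ _ ⟩
    _ ≈⟨ +-cong (⊛-suc f g m) (⊛-suc f h m) ⟨
    _ ∎

  ⊛-assoc : ∀ f g h m → ((f ⊛ g) ⊛ h) m ≈ (f ⊛ (g ⊛ h)) m
  ⊛-assoc f g h zero = begin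
    _ ≈⟨ ⊛-zero _ _ ⟩
    _ ≈⟨ *-congʳ (⊛-zero f g) ⟩
    _ ≈⟨ *-assoc _ _ _ ⟩
    _ ≈⟨ *-congˡ (⊛-zero g h) ⟨
    _ ≈⟨ ⊛-zero _ _ ⟨
    _ ∎
  ⊛-assoc f g h (suc m) = begin
    ((f ⊛ g) ⊛ h) (suc m)
      ≈⟨ ⊛-suc _ _ m ⟩
    (f ⊛ g) 0 * h (suc m) + (((f ⊛ g) ∘ suc) ⊛ h) m
      ≈⟨ +-cong (trans (*-congʳ (⊛-zero f g)) (*-assoc _ _ _)) (⊛-cong (⊛-suc f g) (λ _ → refl) m) ⟩
    f 0 * (g 0 * h (suc m)) + ((λ i → f 0 * g (suc i) + ((f ∘ suc) ⊛ g) i) ⊛ h) m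
      ≈⟨ +-congˡ (⊛-distribʳ _ _ h m) ⟩
    f 0 * (g 0 * h (suc m)) + (((λ i → f 0 * g (suc i)) ⊛ h) m + (((f ∘ suc) ⊛ g) ⊛ h) m)
      ≈⟨ +-congˡ (+-cong (⊛-scaleˡ (f 0) (g ∘ suc) h m) (⊛-assoc (f ∘ suc) g h m)) ⟩
    f 0 * (g 0 * h (suc m)) + (f 0 * ((g ∘ suc) ⊛ h) m + ((f ∘ suc) ⊛ (g ⊛ h)) m)
      ≈⟨ +-assoc _ _ _ ⟨
    f 0 * (g 0 * h (suc m)) + f 0 * ((g ∘ suc) ⊛ h) m + ((f ∘ suc) ⊛ (g ⊛ h)) m
      ≈⟨ +-congʳ (sym (trans (*-congˡ (⊛-suc g h m)) (distribˡ _ _ _))) ⟩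
    f 0 * (g ⊛ h) (suc m) + ((f ∘ suc) ⊛ (g ⊛ h)) m
      ≈⟨ ⊛-suc _ _ m ⟨
    (f ⊛ (g ⊛ h)) (suc m) ∎

  ⊛-sucʳ : ∀ f g m → (f ⊛ g) (suc m) ≈ f (suc m) * g 0 + (f ⊛ (g ∘ suc)) m
  ⊛-sucʳ f g zero = begin
    _ ≈⟨ ⊛-suc f g 0 ⟩
    _ ≈⟨ +-congˡ (⊛-zero _ _) ⟩
    _ ≈⟨ +-comm _ _ ⟩
    _ ≈⟨ +-congˡ (⊛-zero _ _) ⟨
    _ ∎
  ⊛-sucʳ f g (suc m) = begin
    (f ⊛ g) (suc (suc m))
      ≈⟨ ⊛-suc f g (suc m) ⟩
    f 0 * g (suc (suc m)) + ((f ∘ suc) ⊛ g) (suc m)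
      ≈⟨ +-congˡ (⊛-sucʳ (f ∘ suc) g m) ⟩
    f 0 * g (suc (suc m)) + (f (suc (suc m)) * g 0 + ((f ∘ suc) ⊛ (g ∘ suc)) m)
      ≈⟨ +-assoc _ _ _ ⟨
    f 0 * g (suc (suc m)) + f (suc (suc m)) * g 0 + ((f ∘ suc) ⊛ (g ∘ suc)) m
      ≈⟨ +-congʳ (+-comm _ _) ⟩
    f (suc (suc m)) * g 0 + f 0 * g (suc (suc m)) + ((f ∘ suc) ⊛ (g ∘ suc)) m
      ≈⟨ +-assoc _ _ _ ⟩
    f (suc (suc m)) * g 0 + (f 0 * g (suc (suc m)) + ((f ∘ suc) ⊛ (g ∘ suc)) m)
      ≈⟨ +-congˡ (⊛-suc f (g ∘ suc) m) ⟨
    _ ∎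

  ⊛-identityˡ : ∀ f m → (one ⊛ f) m ≈ f m
  ⊛-identityˡ f zero    = trans (⊛-zero _ _) (*-identityˡ _)
  ⊛-identityˡ f (suc m) = trans (⊛-suc _ _ m) (trans (+-cong (*-identityˡ _) (⊛-zeroˡ f m)) (+-identityʳ _))

  ⊛-identityʳ : ∀ f m → (f ⊛ one) m ≈ f m
  ⊛-identityʳ f zero    = trans (⊛-zero _ _) (*-identityʳ _)
  ⊛-identityʳ f (suc m) = begin
    _ ≈⟨ ⊛-suc f one m ⟩
    _ ≈⟨ +-cong (zeroʳ _) (⊛-identityʳ (f ∘ suc) m) ⟩
    _ ≈⟨ +-identityˡ _ ⟩
    _ ∎

  ⊛-no-constant : ∀ {f} g m → NoConstant f → (f ⊛ g) (suc m) ≈ ((f ∘ suc) ⊛ g) m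
  ⊛-no-constant g m f0 = trans (⊛-suc _ g m)
      (trans (+-congʳ (trans (*-congʳ (constant≈0 f0)) (zeroˡ _))) (+-identityˡ _))

  module _ {g : Ser} (g0 : NoConstant g) where

    ^ˢ-low : ∀ k m → m ℕ.< k → (g ^ˢ k) m ≈ 0#
    ^ˢ-low (suc k) zero    _        = trans (⊛-zero _ _) (trans (*-congʳ (constant≈0 g0)) (zeroˡ _))
    ^ˢ-low (suc k) (suc m) (s≤s lt) = trans (⊛-no-constant _ m g0)
      (trans (⊛-cong≤ {m} {f = g ∘ suc} (λ _ _ → refl) (λ j le → ^ˢ-low k j (ℕₚ.≤-trans (s≤s le) lt)) m ℕₚ.≤-refl)
             (lem m))
      where
      lem : ∀ m {f} → (f ⊛ (λ _ → 0#)) m ≈ 0#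
      lem zero    = trans (⊛-zero _ _) (zeroʳ _)
      lem (suc m) = trans (⊛-suc _ _ m) (trans (+-cong (zeroʳ _) (lem m)) (+-identityˡ _))

    private
      partial : ℕ → Ser → Ser
      partial n f m = Σ< n (λ k → f k * (g ^ˢ k) m)

      partial-tail : ∀ n d f m → m ℕ.< n → partial (d ℕ.+ n) f m ≈ partial n f m
      partial-tail zero    d f m ()
      partial-tail (suc n) d f m lt = go (suc n) f (λ k → g ^ˢ k) (λ k l → ^ˢ-low k m (ℕₚ.≤-trans lt l))
        where
        go : ∀ n (f : Ser) (p : ℕ → Ser) → (∀ k → n ℕ.≤ k → p k m ≈ 0#) →
             Σ< (d ℕ.+ n) (λ k → f k * p k m) ≈ Σ< n (λ k → f k * p k m)
        go zero    f p h = Σ<-0 (d ℕ.+ 0) (λ i _ → trans (*-congˡ (h i z≤n)) (zeroʳ _))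
        go (suc n) f p h = trans (reflexive (≡.cong (λ e → Σ< e (λ k → f k * p k m)) (ℕₚ.+-suc d n)))
          (+-congˡ (go n (f ∘ suc) (p ∘ suc) (λ k l → h (suc k) (s≤s l))))

      -- The terms with k > m vanish by `^ˢ-low`, so every larger cut-off gives the same sum.
      -- `horner` needs one cut-off that serves all coefficients of degree at most m.
      comp≈partial : ∀ n f m → m ℕ.< n → (f ∘ˢ g) m ≈ partial n f m
      comp≈partial n f m lt = trans (reflexive (∘ˢ≡Σ< f g m))
        (trans (sym (partial-tail (suc m) (n ℕ.∸ suc m) f m ℕₚ.≤-refl))
          (reflexive (≡.cong (λ e → partial e f m) (ℕₚ.m∸n+n≡m lt))))

      ⊛-Σ : ∀ n (f : Ser) (p : ℕ → Ser) h m → Σ< n (λ k → f k * (h ⊛ p k) m) ≈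
          (h ⊛ (λ j → Σ< n (λ k → f k * p k j))) m
      ⊛-Σ n f p h zero = begin
        _ ≈⟨ Σ<-cong n (λ i _ → trans (*-congˡ (⊛-zero h (p i))) (*-swapˡ _ _ _)) ⟩
        _ ≈⟨ Σ<-*ˡ n (h 0) _ ⟩
        _ ≈⟨ ⊛-zero h _ ⟨
        _ ∎
      ⊛-Σ n f p h (suc m) = begin
        _ ≈⟨ Σ<-cong n (λ i _ → trans (*-congˡ (⊛-suc h (p i) m))
               (trans (distribˡ _ _ _) (+-congʳ (*-swapˡ _ _ _)))) ⟩
        _ ≈⟨ Σ<-+ n _ _ ⟩
        _ ≈⟨ +-cong (Σ<-*ˡ n (h 0) _) (⊛-Σ n f p (h ∘ suc) m) ⟩
        _ ≈⟨ ⊛-suc h _ m ⟨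
        _ ∎

    -- Horner's rule f(g) = f₀ + g f′(g), with f′ the tail of f: one factor `g` is pulled out of all
    -- powers with positive exponent. The inductions on composition use it in place of the powers.
    horner : ∀ f m → (f ∘ˢ g) m ≈ f 0 * one m + (g ⊛ ((f ∘ suc) ∘ˢ g)) m
    horner f m = begin
      (f ∘ˢ g) m
        -- The cut-off is m + 2: after the term k = 0 is split off, m + 1 terms remain, enough for
        -- every j ≤ m.
        ≈⟨ comp≈partial (suc (suc m)) f m (ℕₚ.m<n⇒m<1+n ℕₚ.≤-refl) ⟩
      f 0 * one m + Σ< (suc m) (λ k → f (suc k) * (g ⊛ (g ^ˢ k)) m)
        ≈⟨ +-congˡ (⊛-Σ (suc m) (f ∘ suc) (g ^ˢ_) g m) ⟩
      f 0 * one m + (g ⊛ (λ j → partial (suc m) (f ∘ suc) j)) m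
        ≈⟨ +-congˡ (⊛-cong≤ {m} {f = g} (λ _ _ → refl)
             (λ j le → sym (comp≈partial (suc m) (f ∘ suc) j (s≤s le))) m ℕₚ.≤-refl) ⟩
      f 0 * one m + (g ⊛ ((f ∘ suc) ∘ˢ g)) m ∎

    horner-zero : ∀ f → (f ∘ˢ g) 0 ≈ f 0
    horner-zero f = begin
      _ ≈⟨ horner f 0 ⟩
      _ ≈⟨ +-cong (*-identityʳ _) (trans (⊛-zero _ _) (trans (*-congʳ (constant≈0 g0)) (zeroˡ _))) ⟩
      _ ≈⟨ +-identityʳ _ ⟩
      _ ∎

    horner-suc : ∀ f m → (f ∘ˢ g) (suc m) ≈ ((g ∘ suc) ⊛ ((f ∘ suc) ∘ˢ g)) m
    horner-suc f m = begin
      _ ≈⟨ horner f (suc m) ⟩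
      _ ≈⟨ +-cong (zeroʳ _) (⊛-no-constant _ m g0) ⟩
      _ ≈⟨ +-identityˡ _ ⟩
      _ ∎

  ∘ˢ-congˡ≤ : ∀ {g} → NoConstant g → ∀ {m f f′} → f ≋[ m ] f′ → (f ∘ˢ g) ≋[ m ] (f′ ∘ˢ g)
  ∘ˢ-congˡ≤ g0 p zero le = trans (horner-zero g0 _) (trans (p 0 z≤n) (sym (horner-zero g0 _)))
  ∘ˢ-congˡ≤ {g} g0 {suc m} p (suc j) (s≤s le) = begin
    _ ≈⟨ horner-suc g0 _ j ⟩
    _ ≈⟨ ⊛-cong≤ {m} {f = g ∘ suc} (λ _ _ → refl) (∘ˢ-congˡ≤ g0 {m} (λ i l → p (suc i) (s≤s l))) j le ⟩
    _ ≈⟨ horner-suc g0 _ j ⟨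
    _ ∎

  ∘ˢ-congʳ≤ : ∀ {m g h} → NoConstant g → NoConstant h → g ≋[ m ] h → ∀ f → (f ∘ˢ g) ≋[ m ] (f ∘ˢ h)
  ∘ˢ-congʳ≤ g0 h0 p f zero le = trans (horner-zero g0 f) (sym (horner-zero h0 f))
  ∘ˢ-congʳ≤ {suc m} g0 h0 p f (suc j) (s≤s le) = begin
    _ ≈⟨ horner-suc g0 f j ⟩
    _ ≈⟨ ⊛-cong≤ {m} (λ i l → p (suc i) (s≤s l))
          (∘ˢ-congʳ≤ {m} g0 h0 (λ i l → p i (ℕₚ.m≤n⇒m≤1+n l)) (f ∘ suc)) j le ⟩
    _ ≈⟨ horner-suc h0 f j ⟨
    _ ∎

  -- The product with the tail of `g` calls on all coefficients up to j, so the induction is on a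
  -- bound m for the degree and not on the degree itself.
  ∘ˢ-linear≤ : ∀ {g} → NoConstant g → ∀ c f h m j → j ℕ.≤ m →
               ((λ i → c * f i + h i) ∘ˢ g) j ≈ c * (f ∘ˢ g) j + (h ∘ˢ g) j
  ∘ˢ-linear≤ g0 c f h m zero _ = trans (horner-zero g0 _)
    (+-cong (*-congˡ (sym (horner-zero g0 f))) (sym (horner-zero g0 h)))
  ∘ˢ-linear≤ {g} g0 c f h (suc m) (suc j) (s≤s le) = begin
    _ ≈⟨ horner-suc g0 _ j ⟩
    _ ≈⟨ ⊛-cong≤ {m} {f = g ∘ suc} (λ _ _ → refl) (∘ˢ-linear≤ g0 c (f ∘ suc) (h ∘ suc) m) j le ⟩
    _ ≈⟨ ⊛-distribˡ _ _ _ j ⟩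
    _ ≈⟨ +-congʳ (⊛-scaleʳ c _ _ j) ⟩
    _ ≈⟨ +-cong (*-congˡ (horner-suc g0 f j)) (horner-suc g0 h j) ⟨
    _ ∎

  ∘ˢ-linear : ∀ {g} → NoConstant g → ∀ c f h m → ((λ i → c * f i + h i) ∘ˢ g) m ≈ c * (f ∘ˢ g) m + (h ∘ˢ g) m
  ∘ˢ-linear g0 c f h m = ∘ˢ-linear≤ g0 c f h m m ℕₚ.≤-refl

  -- The tail of a product is f₀ h′ + f′ h, where f′ and h′ are the tails of the factors, and
  -- linearity leaves f′ h for the induction. Substitution of `g` thus respects sums and products,
  -- which is the input for associativity.
  ∘ˢ-⊛ : ∀ {g} → NoConstant g → ∀ m f h j → j ℕ.≤ m → ((f ⊛ h) ∘ˢ g) j ≈ ((f ∘ˢ g) ⊛ (h ∘ˢ g)) j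
  ∘ˢ-⊛ g0 m f h zero le = begin
    _ ≈⟨ horner-zero g0 _ ⟩
    _ ≈⟨ ⊛-zero f h ⟩
    _ ≈⟨ *-cong (horner-zero g0 f) (horner-zero g0 h) ⟨
    _ ≈⟨ ⊛-zero _ _ ⟨
    _ ∎
  ∘ˢ-⊛ {g} g0 (suc m) f h (suc j) (s≤s le) = begin
    ((f ⊛ h) ∘ˢ g) (suc j)
      ≈⟨ horner-suc g0 _ j ⟩
    (g′ ⊛ (((f ⊛ h) ∘ suc) ∘ˢ g)) j
      ≈⟨ ⊛-cong {f = g′} (λ _ → refl) (λ i → ∘ˢ-congˡ≤ g0 {i} (λ k _ → ⊛-suc f h k) i ℕₚ.≤-refl) j ⟩
    (g′ ⊛ ((λ i → f 0 * h (suc i) + ((f ∘ suc) ⊛ h) i) ∘ˢ g)) j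
      ≈⟨ ⊛-cong {f = g′} (λ _ → refl) (∘ˢ-linear g0 (f 0) (h ∘ suc) ((f ∘ suc) ⊛ h)) j ⟩
    (g′ ⊛ (λ i → f 0 * ((h ∘ suc) ∘ˢ g) i + (((f ∘ suc) ⊛ h) ∘ˢ g) i)) j
      ≈⟨ ⊛-distribˡ _ _ _ j ⟩
    (g′ ⊛ (λ i → f 0 * ((h ∘ suc) ∘ˢ g) i)) j + (g′ ⊛ (((f ∘ suc) ⊛ h) ∘ˢ g)) j
      ≈⟨ +-cong (⊛-scaleʳ (f 0) _ _ j)
           (⊛-cong≤ {m} {f = g′} (λ _ _ → refl) (∘ˢ-⊛ g0 m (f ∘ suc) h) j le) ⟩
    f 0 * (g′ ⊛ ((h ∘ suc) ∘ˢ g)) j + (g′ ⊛ (((f ∘ suc) ∘ˢ g) ⊛ (h ∘ˢ g))) j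
      ≈⟨ +-cong (*-cong (sym (horner-zero g0 f)) (sym (horner-suc g0 h j)))
                (sym (⊛-assoc g′ _ _ j)) ⟩
    (f ∘ˢ g) 0 * (h ∘ˢ g) (suc j) + ((g′ ⊛ ((f ∘ suc) ∘ˢ g)) ⊛ (h ∘ˢ g)) j
      ≈⟨ +-congˡ (⊛-cong (horner-suc g0 f) (λ _ → refl) j) ⟨
    (f ∘ˢ g) 0 * (h ∘ˢ g) (suc j) + (((f ∘ˢ g) ∘ suc) ⊛ (h ∘ˢ g)) j
      ≈⟨ ⊛-suc _ _ j ⟨
    ((f ∘ˢ g) ⊛ (h ∘ˢ g)) (suc j) ∎
    where g′ = g ∘ suc

  -- Horner's rule for f turns both sides into f₀ plus `g ∘ˢ h` times the claim for the tail of f.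
  -- As `g ∘ˢ h` has no constant term, that claim is only needed one degree lower, which lets m
  -- decrease.
  ∘ˢ-assoc : ∀ {g h} → NoConstant g → NoConstant h → ∀ m f j → j ℕ.≤ m → ((f ∘ˢ g) ∘ˢ h) j ≈ (f ∘ˢ (g ∘ˢ h)) j
  ∘ˢ-assoc {g} {h} g0 h0 m f j le = begin
    ((f ∘ˢ g) ∘ˢ h) j
      ≈⟨ ∘ˢ-congˡ≤ h0 {j} (λ i _ → horner g0 f i) j ℕₚ.≤-refl ⟩
    ((λ i → f 0 * one i + (g ⊛ ((f ∘ suc) ∘ˢ g)) i) ∘ˢ h) j
      ≈⟨ ∘ˢ-linear h0 (f 0) one _ j ⟩
    f 0 * (one ∘ˢ h) j + ((g ⊛ ((f ∘ suc) ∘ˢ g)) ∘ˢ h) j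
      ≈⟨ +-cong (*-congˡ (one∘ j)) (∘ˢ-⊛ h0 j g _ j ℕₚ.≤-refl) ⟩
    f 0 * one j + ((g ∘ˢ h) ⊛ (((f ∘ suc) ∘ˢ g) ∘ˢ h)) j
      ≈⟨ +-congˡ (step m j le) ⟩
    f 0 * one j + ((g ∘ˢ h) ⊛ ((f ∘ suc) ∘ˢ (g ∘ˢ h))) j
      ≈⟨ horner gh0 f j ⟨
    (f ∘ˢ (g ∘ˢ h)) j ∎
    where
    gh0 : NoConstant (g ∘ˢ h)
    gh0 = noConstant (trans (horner-zero h0 g) (constant≈0 g0))
    zero∘ : ∀ j → ((λ _ → 0#) ∘ˢ h) j ≈ 0#
    zero∘ j = trans (reflexive (∘ˢ≡Σ< _ _ j)) (Σ<-0 (suc j) (λ k _ → zeroˡ ((h ^ˢ k) j)))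
    one∘ : ∀ j → (one ∘ˢ h) j ≈ one j
    one∘ zero    = horner-zero h0 one
    one∘ (suc j) = trans (horner-suc h0 one j) (trans (⊛-cong {f = h ∘ suc} (λ _ → refl) zero∘ j)
      (trans (sym (⊛-cong {f = h ∘ suc} (λ _ → refl) (λ _ → zeroˡ 0#) j))
        (trans (⊛-scaleʳ 0# (h ∘ suc) (λ _ → 0#) j) (zeroˡ _))))
    step : ∀ m j → j ℕ.≤ m → ((g ∘ˢ h) ⊛ (((f ∘ suc) ∘ˢ g) ∘ˢ h)) j ≈ ((g ∘ˢ h) ⊛ ((f ∘ suc) ∘ˢ (g ∘ˢ h))) j
    step m zero le = trans (trans (⊛-zero _ _) (trans (*-congʳ (constant≈0 gh0)) (zeroˡ _)))
      (sym (trans (⊛-zero _ _) (trans (*-congʳ (constant≈0 gh0)) (zeroˡ _))))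
    step (suc m) (suc j) (s≤s le) = trans (⊛-no-constant _ j gh0)
      (trans (⊛-cong≤ {m} {f = (g ∘ˢ h) ∘ suc} (λ _ _ → refl) (∘ˢ-assoc g0 h0 m (f ∘ suc)) j le)
        (sym (⊛-no-constant _ j gh0)))

  x̂0 : NoConstant x̂
  x̂0 = noConstant refl

  ∘ˢ-identityʳ : ∀ f m → (f ∘ˢ x̂) m ≈ f m
  ∘ˢ-identityʳ f zero    = horner-zero x̂0 f
  ∘ˢ-identityʳ f (suc m) = begin
    _ ≈⟨ horner-suc x̂0 f m ⟩
    _ ≈⟨ ⊛-cong {f = x̂ ∘ suc} {f′ = one} (λ where zero → refl ; (suc _) → refl) (λ _ → refl) m ⟩
    _ ≈⟨ ⊛-identityˡ _ m ⟩
    _ ≈⟨ ∘ˢ-identityʳ (f ∘ suc) m ⟩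
    _ ∎

  ∘ˢ-identityˡ : ∀ g → NoConstant g → ∀ m → (x̂ ∘ˢ g) m ≈ g m
  ∘ˢ-identityˡ g g0 zero = trans (horner-zero g0 x̂) (sym (constant≈0 g0))
  ∘ˢ-identityˡ g g0 (suc m) = begin
    (x̂ ∘ˢ g) (suc m)
      ≈⟨ horner-suc g0 x̂ m ⟩
    ((g ∘ suc) ⊛ ((x̂ ∘ suc) ∘ˢ g)) m
      ≈⟨ ⊛-cong {f = g ∘ suc} (λ _ → refl) tail m ⟩
    ((g ∘ suc) ⊛ one) m
      ≈⟨ ⊛-identityʳ _ m ⟩
    g (suc m) ∎
    where
    zero∘ : ∀ j → ((x̂ ∘ suc ∘ suc) ∘ˢ g) j ≈ 0#
    zero∘ j = trans (reflexive (∘ˢ≡Σ< _ _ j)) (Σ<-0 (suc j) (λ k _ → zeroˡ ((g ^ˢ k) j)))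
    tail : ∀ j → ((x̂ ∘ suc) ∘ˢ g) j ≈ one j
    tail zero    = horner-zero g0 _
    tail (suc j) = begin
      _ ≈⟨ horner-suc g0 _ j ⟩
      _ ≈⟨ ⊛-cong {f = g ∘ suc} (λ _ → refl) (λ i → trans (zero∘ i) (sym (zeroˡ 0#))) j ⟩
      _ ≈⟨ ⊛-scaleʳ 0# (g ∘ suc) (λ _ → 0#) j ⟩
      _ ≈⟨ zeroˡ _ ⟩
      _ ∎

  -- a ∘ u = u + u² · (a″ ∘ u), and the coefficient of xᵐ⁺¹ in u² · w only involves coefficients of u up to xᵐ.
  ∘ˢ-cancelˡ : ∀ {a u v} → NoConstant a → a 1 ≈ 1# → NoConstant u → NoConstant v →
               (∀ m → (a ∘ˢ u) m ≈ (a ∘ˢ v) m) → ∀ m → u m ≈ v m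
  ∘ˢ-cancelˡ {a} {u} {v} a0 a1 u0 v0 eq m = go m m ℕₚ.≤-refl
    where
    rest : Ser → Ser
    rest u = (u ∘ suc) ⊛ ((a ∘ suc ∘ suc) ∘ˢ u)

    expand : ∀ {u} → NoConstant u → ∀ m → (a ∘ˢ u) (suc (suc m)) ≈ u (suc (suc m)) + ((u ∘ suc) ⊛ rest u) m
    expand {u} u0 m = begin
      _ ≈⟨ horner-suc u0 a (suc m) ⟩
      _ ≈⟨ ⊛-sucʳ (u ∘ suc) _ m ⟩
      _ ≈⟨ +-cong (trans (*-congˡ (trans (horner-zero u0 _) a1)) (*-identityʳ _))
                  (⊛-cong {f = u ∘ suc} (λ _ → refl) (horner-suc u0 (a ∘ suc)) m) ⟩
      _ ∎

    linear : ∀ {u} → NoConstant u → (a ∘ˢ u) 1 ≈ u 1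
    linear u0 = trans (horner-suc u0 a 0) (trans (⊛-zero _ _)
      (trans (*-congˡ (trans (horner-zero u0 _) a1)) (*-identityʳ _)))

    go : ∀ m → u ≋[ m ] v
    go m       zero          le = trans (constant≈0 u0) (sym (constant≈0 v0))
    go (suc m) (suc zero)    le = trans (sym (linear u0)) (trans (eq 1) (linear v0))
    go (suc m) (suc (suc j)) (s≤s le) = +-cancelʳ _ _ _ (begin
      u (suc (suc j)) + ((v ∘ suc) ⊛ rest v) j
        ≈⟨ +-congˡ (⊛-cong≤ {j} tails rests j ℕₚ.≤-refl) ⟨
      u (suc (suc j)) + ((u ∘ suc) ⊛ rest u) j
        ≈⟨ expand u0 j ⟨
      (a ∘ˢ u) (suc (suc j))
        ≈⟨ eq (suc (suc j)) ⟩
      (a ∘ˢ v) (suc (suc j))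
        ≈⟨ expand v0 j ⟩
      v (suc (suc j)) + ((v ∘ suc) ⊛ rest v) j ∎)
      where
      open import Algebra.Properties.Group +-group using () renaming (∙-cancelʳ to +-cancelʳ)
      tails : (u ∘ suc) ≋[ j ] (v ∘ suc)
      tails i l = go m (suc i) (ℕₚ.≤-trans (s≤s l) le)
      rests : rest u ≋[ j ] rest v
      rests = ⊛-cong≤ {j} tails (∘ˢ-congʳ≤ {j} u0 v0
        (λ i l → go m i (ℕₚ.≤-trans (ℕₚ.m≤n⇒m≤1+n l) le)) _)

  right-inverse⇒left-inverse : ∀ {a b} → NoConstant a → a 1 ≈ 1# → NoConstant b →
    (∀ m → (a ∘ˢ b) m ≈ x̂ m) → ∀ m → (b ∘ˢ a) m ≈ x̂ m
  right-inverse⇒left-inverse {a} {b} a0 a1 b0 inv =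
    ∘ˢ-cancelˡ a0 a1 (noConstant (trans (horner-zero a0 b) (constant≈0 b0))) x̂0 λ m → begin
      (a ∘ˢ (b ∘ˢ a)) m ≈⟨ ∘ˢ-assoc b0 a0 m a m ℕₚ.≤-refl ⟨
      ((a ∘ˢ b) ∘ˢ a) m ≈⟨ ∘ˢ-congˡ≤ a0 {m} (λ j _ → inv j) m ℕₚ.≤-refl ⟩
      (x̂ ∘ˢ a) m        ≈⟨ ∘ˢ-identityˡ a a0 m ⟩
      a m               ≈⟨ ∘ˢ-identityʳ a m ⟨
      (a ∘ˢ x̂) m        ∎

open import Data.Nat using (ℕ; suc)
open import Data.Product using (Σ; ∃; _×_; _,_; proj₁; proj₂)
open import Data.Sum using (_⊎_; inj₁; inj₂)
open import Data.Empty using (⊥; ⊥-elim)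
open import Function using (_∘_; id; case_of_; _⇔_; mk⇔; Equivalence)
open import Relation.Nullary using (¬_; yes; no)
open import Relation.Binary.PropositionalEquality as ≡
  using (_≡_; _≢_; refl; sym; trans; cong; cong₂; subst; subst₂; module ≡-Reasoning)

-- Homogeneous linear systems over the rationals.

module LinearAlgebra where

  open import Data.Nat as ℕ using (ℕ; zero; suc; s≤s)
  open import Data.Fin using (Fin; zero; suc; punchIn; punchOut)
  import Data.Fin.Properties as Finₚ
  open import Data.Rational as ℚ using (ℚ; 0ℚ; 1ℚ)
  import Data.Rational.Properties as ℚₚ
  open import Data.Rational.Solver using (module +-*-Solver)
  open import Data.Product using (Σ; ∃; _×_; _,_)
  open import Relation.Nullary.Decidable using (¬?; decidable-stable)

  Σᶠ : ∀ {k} → (Fin k → ℚ) → ℚ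
  Σᶠ {zero}  f = 0ℚ
  Σᶠ {suc k} f = f zero ℚ.+ Σᶠ (f ∘ suc)

  Σᶠ-cong : ∀ {k} {f g : Fin k → ℚ} → (∀ i → f i ≡ g i) → Σᶠ f ≡ Σᶠ g
  Σᶠ-cong {zero}  e = refl
  Σᶠ-cong {suc k} e = cong₂ ℚ._+_ (e zero) (Σᶠ-cong (e ∘ suc))

  Σᶠ-zero : ∀ {k} {f : Fin k → ℚ} → (∀ i → f i ≡ 0ℚ) → Σᶠ f ≡ 0ℚ
  Σᶠ-zero {zero}  e = refl
  Σᶠ-zero {suc k} e = trans (cong₂ ℚ._+_ (e zero) (Σᶠ-zero (e ∘ suc))) (ℚₚ.+-identityˡ 0ℚ)

  Σᶠ-single : ∀ {k} {f : Fin k → ℚ} i → (∀ j → j ≢ i → f j ≡ 0ℚ) → Σᶠ f ≡ f i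
  Σᶠ-single {f = f} zero    e = trans (cong (f zero ℚ.+_) (Σᶠ-zero λ j → e (suc j) λ ())) (ℚₚ.+-identityʳ _)
  Σᶠ-single {f = f} (suc i) e = trans
      (cong₂ ℚ._+_ (e zero λ ()) (Σᶠ-single i λ j ne → e (suc j) (ne ∘ Finₚ.suc-injective)))
    (ℚₚ.+-identityˡ _)

  private
    Σᶠ-eliminate : ∀ {k} (c A B : Fin k → ℚ) g →
      Σᶠ (λ j → c j ℚ.* (A j ℚ.- g ℚ.* B j)) ≡ Σᶠ (λ j → c j ℚ.* A j) ℚ.- g ℚ.* Σᶠ (λ j → c j ℚ.* B j)
    Σᶠ-eliminate {zero}  c A B g = lem g
      where
      open +-*-Solver
      lem : ∀ g → 0ℚ ≡ 0ℚ ℚ.- g ℚ.* 0ℚ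
      lem = solve 1 (λ g → con 0ℚ := con 0ℚ :- g :* con 0ℚ) refl
    Σᶠ-eliminate {suc k} c A B g =
      trans (cong (c zero ℚ.* (A zero ℚ.- g ℚ.* B zero) ℚ.+_) (Σᶠ-eliminate (c ∘ suc) (A ∘ suc) (B ∘ suc) g))
        (lem (c zero) (A zero) (B zero) g _ _)
      where
      open +-*-Solver
      lem : ∀ c a b g x y → c ℚ.* (a ℚ.- g ℚ.* b) ℚ.+ (x ℚ.- g ℚ.* y) ≡ c ℚ.* a ℚ.+ x ℚ.- g ℚ.* (c ℚ.* b ℚ.+ y)
      lem = solve 6 (λ c a b g x y → c :* (a :- g :* b) :+ (x :- g :* y) := c :* a :+ x :- g :* (c :* b :+ y)) refl

  -- Gaussian elimination on the first column. If the column is zero, the first unit vector is a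
  -- solution. Otherwise the pivot row eliminates the first unknown from the other rows, and a
  -- solution of the smaller system is completed by the value that annihilates the pivot row.
  nullspace : ∀ {m d} → m ℕ.< d → (M : Fin m → Fin d → ℚ) →
              Σ (Fin d → ℚ) λ c → (∃ λ k → c k ≢ 0ℚ) × (∀ r → Σᶠ (λ k → c k ℚ.* M r k) ≡ 0ℚ)
  nullspace {zero} {suc d} _ M = (λ _ → 1ℚ) , (zero , λ ()) , λ ()
  nullspace {suc m} {suc d} (s≤s lt) M with Finₚ.any? (λ r → ¬? (M r zero ℚₚ.≟ 0ℚ))
  ... | no none = e₀ , (zero , λ ()) , λ r → trans (Σᶠ-single zero (vanish r))
          (trans (ℚₚ.*-identityˡ _) (decidable-stable (M r zero ℚₚ.≟ 0ℚ) (λ ne → none (r , ne))))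
    where
    e₀ : Fin (suc d) → ℚ
    e₀ zero    = 1ℚ
    e₀ (suc _) = 0ℚ
    vanish : ∀ r j → j ≢ zero → e₀ j ℚ.* M r j ≡ 0ℚ
    vanish r zero    ne = ⊥-elim (ne refl)
    vanish r (suc j) ne = ℚₚ.*-zeroˡ (M r (suc j))
  ... | yes (r₀ , pivot≢0) with nullspace lt (λ r k → M (punchIn r₀ r) (suc k) ℚ.-
          (M (punchIn r₀ r) zero ℚ.* ℚ.1/_ (M r₀ zero) {{ℚ.≢-nonZero pivot≢0}}) ℚ.* M r₀ (suc k))
  ...   | c′ , (k , c′k≢0) , null = c , (suc k , c′k≢0) , solution
    where
    π = M r₀ zero
    q = ℚ.1/_ π {{ℚ.≢-nonZero pivot≢0}}
    pivotSum = Σᶠ (λ k → c′ k ℚ.* M r₀ (suc k))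
    c : Fin (suc d) → ℚ
    c zero    = ℚ.- (pivotSum ℚ.* q)
    c (suc k) = c′ k
    open +-*-Solver
    lem₁ : ∀ s q p → ℚ.- (s ℚ.* q) ℚ.* p ℚ.+ s ≡ s ℚ.- s ℚ.* (q ℚ.* p)
    lem₁ = solve 3 (λ s q p → :- (s :* q) :* p :+ s := s :- s :* (q :* p)) refl
    lem₂ : ∀ s q a x → ℚ.- (s ℚ.* q) ℚ.* a ℚ.+ x ≡ x ℚ.- (a ℚ.* q) ℚ.* s
    lem₂ = solve 4 (λ s q a x → :- (s :* q) :* a :+ x := x :- (a :* q) :* s) refl
    solution : ∀ r → Σᶠ (λ k → c k ℚ.* M r k) ≡ 0ℚ
    solution r with r₀ Finₚ.≟ r
    ... | yes refl = trans (lem₁ pivotSum q π)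
          (trans (cong (λ z → pivotSum ℚ.- pivotSum ℚ.* z) (ℚₚ.*-inverseˡ π {{ℚ.≢-nonZero pivot≢0}}))
            (trans (cong (ℚ._-_ pivotSum) (ℚₚ.*-identityʳ pivotSum)) (ℚₚ.+-inverseʳ pivotSum)))
    ... | no ne = subst (λ r → Σᶠ (λ k → c k ℚ.* M r k) ≡ 0ℚ) (Finₚ.punchIn-punchOut ne)
          (trans (lem₂ pivotSum q _ _) (trans
              (sym (Σᶠ-eliminate c′ (λ k → M (punchIn r₀ (punchOut ne)) (suc k)) (M r₀ ∘ suc)
              (M (punchIn r₀ (punchOut ne)) zero ℚ.* q))) (null (punchOut ne))))

open import Defs

-- Face preorders: faces of faces and faces of products.

module FaceOrder where

  open import Data.Bool using (Bool; true; false; _∨_)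
  open import Data.Nat as ℕ using (ℕ; zero; suc)
  open import Data.Rational as ℚ using (ℚ; 0ℚ)
  import Data.Rational.Properties as ℚₚ
  open import Algebra.Properties.Group ℚₚ.+-0-group using () renaming (⁻¹-involutive to neg-involutive)
  open import Data.Vec as Vec using (Vec; []; _∷_)
  open import Data.List as List using (List; []; _∷_; _++_; length; take; drop)
  open import Data.List.Relation.Unary.All as All using (All; []; _∷_)
  import Data.List.Relation.Unary.All.Properties as Allₚ
  open import Data.Product as Prod using (∃; _×_; _,_; proj₁; proj₂)
  open import Data.Unit using (⊤; tt)

  -- Preorders and not posets, since several tight sets may describe the same face: `_≡ₛ_` is
  -- inequality in both directions, and `_≃_` is an isomorphism of the quotient posets.
  record Ord : Set₁ where
    field
      Car   : Set
      _≤_   : Car → Car → Set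
      refl≤ : ∀ {x} → x ≤ x
      trans≤ : ∀ {x y z} → x ≤ y → y ≤ z → x ≤ z
  open Ord public using (Car)

  record _≃_ (A B : Ord) : Set where
    private
      module A = Ord A
      module B = Ord B
    field
      to       : Car A → Car B
      from     : Car B → Car A
      mono     : ∀ {x y} → x A.≤ y → to x B.≤ to y
      reflects : ∀ {x y} → to x B.≤ to y → x A.≤ y
      to-from≤ : ∀ y → to (from y) B.≤ y
      to-from≥ : ∀ y → y B.≤ to (from y)

  module _ {A B : Ord} (e : A ≃ B) where
    private
      module A = Ord A
      module B = Ord B
    open _≃_ e

    from-to≤ : ∀ x → from (to x) A.≤ x
    from-to≤ x = reflects (to-from≤ (to x))

    from-to≥ : ∀ x → x A.≤ from (to x)
    from-to≥ x = reflects (to-from≥ (to x))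

    ≃-sym : B ≃ A
    ≃-sym = record
      { to = from ; from = to
      ; mono = λ {x} {y} le → reflects (B.trans≤ (to-from≤ x) (B.trans≤ le (to-from≥ y)))
      ; reflects = λ {x} {y} le → B.trans≤ (to-from≥ x) (B.trans≤ (mono le) (to-from≤ y))
      ; to-from≤ = from-to≤ ; to-from≥ = from-to≥ }

  ≃-refl : ∀ {A} → A ≃ A
  ≃-refl {A} = record { to = id ; from = id ; mono = id ; reflects = id
    ; to-from≤ = λ _ → Ord.refl≤ A ; to-from≥ = λ _ → Ord.refl≤ A }

  ≃-trans : ∀ {A B C} → A ≃ B → B ≃ C → A ≃ C
  ≃-trans {C = C} e f = record
    { to = F.to ∘ E.to ; from = E.from ∘ F.from
    ; mono = F.mono ∘ E.mono ; reflects = E.reflects ∘ F.reflects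
    ; to-from≤ = λ y → C.trans≤ (F.mono (E.to-from≤ _)) (F.to-from≤ y)
    ; to-from≥ = λ y → C.trans≤ (F.to-from≥ y) (F.mono (E.to-from≥ _)) }
    where
    module E = _≃_ e
    module F = _≃_ f
    module C = Ord C

  _×ₒ_ : Ord → Ord → Ord
  A ×ₒ B = record
    { Car = Car A × Car B
    ; _≤_ = λ x y → Ord._≤_ A (proj₁ x) (proj₁ y) × Ord._≤_ B (proj₂ x) (proj₂ y)
    ; refl≤ = Ord.refl≤ A , Ord.refl≤ B
    ; trans≤ = λ p q → Ord.trans≤ A (proj₁ p) (proj₁ q) , Ord.trans≤ B (proj₂ p) (proj₂ q) }

  ⊤ₒ : Ord
  ⊤ₒ = record { Car = ⊤ ; _≤_ = λ _ _ → ⊤ }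

  ×ₒ-cong : ∀ {A A′ B B′} → A ≃ A′ → B ≃ B′ → (A ×ₒ B) ≃ (A′ ×ₒ B′)
  ×ₒ-cong e f = record
    { to = λ (x , y) → E.to x , F.to y ; from = λ (x , y) → E.from x , F.from y
    ; mono = λ (p , q) → E.mono p , F.mono q ; reflects = λ (p , q) → E.reflects p , F.reflects q
    ; to-from≤ = λ (x , y) → E.to-from≤ x , F.to-from≤ y
    ; to-from≥ = λ (x , y) → E.to-from≥ x , F.to-from≥ y }
    where
    module E = _≃_ e
    module F = _≃_ f

  ×ₒ-comm : ∀ A B → (A ×ₒ B) ≃ (B ×ₒ A)
  ×ₒ-comm A B = record { to = Prod.swap ; from = Prod.swap ; mono = Prod.swap ; reflects = Prod.swap
    ; to-from≤ = λ _ → Ord.refl≤ (B ×ₒ A) ; to-from≥ = λ _ → Ord.refl≤ (B ×ₒ A) }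

  ×ₒ-assoc : ∀ A B C → ((A ×ₒ B) ×ₒ C) ≃ (A ×ₒ (B ×ₒ C))
  ×ₒ-assoc A B C = record
    { to = λ ((x , y) , z) → x , y , z ; from = λ (x , y , z) → (x , y) , z
    ; mono = λ ((x , y) , z) → x , y , z ; reflects = λ (x , y , z) → (x , y) , z
    ; to-from≤ = λ _ → Ord.refl≤ (A ×ₒ (B ×ₒ C)) ; to-from≥ = λ _ → Ord.refl≤ (A ×ₒ (B ×ₒ C)) }

  ×ₒ-identityˡ : ∀ A → (⊤ₒ ×ₒ A) ≃ A
  ×ₒ-identityˡ A = record { to = proj₂ ; from = tt ,_ ; mono = proj₂ ; reflects = tt ,_
    ; to-from≤ = λ _ → Ord.refl≤ A ; to-from≥ = λ _ → Ord.refl≤ A }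

  Faces : Pres → Ord
  Faces P = record { Car = Face P ; _≤_ = _⊑_ ; refl≤ = λ _ m → m ; trans≤ = λ p q x → q x ∘ p x }

  ≃⇒≅ : ∀ {P Q} → Faces P ≃ Faces Q → P ≅ Q
  ≃⇒≅ e = record
    { to = to ; from = from ; to-mono = λ _ _ → mono ; to-refl = λ _ _ → reflects
    ; from-to = λ F → from-to≤ e F , from-to≥ e F
    ; to-from = λ G → to-from≤ G , to-from≥ G }
    where open _≃_ e

  ≅⇒≃ : ∀ {P Q} → P ≅ Q → Faces P ≃ Faces Q
  ≅⇒≃ e = record
    { to = to ; from = from ; mono = to-mono _ _ ; reflects = to-refl _ _
    ; to-from≤ = proj₁ ∘ to-from ; to-from≥ = proj₂ ∘ to-from }
    where open _≅_ e

  Sat Rev : ∀ {d} → ℚ^ d → Ineq d → Set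
  Sat x (a , b) = b ℚ.≤ dot a x
  Rev x (a , b) = dot a x ℚ.≤ b

  dot-neg : ∀ {d} (a x : ℚ^ d) → dot (Vec.map ℚ.-_ a) x ≡ ℚ.- dot a x
  dot-neg []      []      = refl
  dot-neg (a ∷ u) (x ∷ v) =
    trans (cong₂ ℚ._+_ (sym (ℚₚ.neg-distribˡ-* a x)) (dot-neg u v)) (sym (ℚₚ.neg-distrib-+ (a ℚ.* x) _))

  neg-cancel-≤ : ∀ {p q} → ℚ.- p ℚ.≤ ℚ.- q → q ℚ.≤ p
  neg-cancel-≤ {p} {q} le = subst₂ ℚ._≤_ (neg-involutive q) (neg-involutive p) (ℚₚ.neg-antimono-≤ le)

  module _ {d : ℕ} (x : ℚ^ d) where

    Sat-neg⇒ : ∀ i → Sat x (negIneq i) → Rev x i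
    Sat-neg⇒ (a , b) h = neg-cancel-≤ (subst (ℚ.- b ℚ.≤_) (dot-neg a x) h)

    Sat-neg⇐ : ∀ i → Rev x i → Sat x (negIneq i)
    Sat-neg⇐ (a , b) h = subst (ℚ.- b ℚ.≤_) (sym (dot-neg a x)) (ℚₚ.neg-antimono-≤ h)

    Rev-neg⇐ : ∀ i → Sat x i → Rev x (negIneq i)
    Rev-neg⇐ (a , b) h = subst (ℚ._≤ ℚ.- b) (sym (dot-neg a x)) (ℚₚ.neg-antimono-≤ h)

  select : ∀ {A : Set} → List A → List Bool → List A
  select []       _            = []
  select (_ ∷ is) []           = []
  select (i ∷ is) (true ∷ ts)  = i ∷ select is ts
  select (i ∷ is) (false ∷ ts) = select is ts

  tight≡ : ∀ {d} (I : List (Ineq d)) T → tight I T ≡ List.map negIneq (select I T)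
  tight≡ []      T           = refl
  tight≡ (i ∷ I) []          = refl
  tight≡ (i ∷ I) (true ∷ T)  = cong (_ ∷_) (tight≡ I T)
  tight≡ (i ∷ I) (false ∷ T) = tight≡ I T

  select-map : ∀ {A B : Set} (f : A → B) I T → select (List.map f I) T ≡ List.map f (select I T)
  select-map f []      T           = refl
  select-map f (i ∷ I) []          = refl
  select-map f (i ∷ I) (true ∷ T)  = cong (f i ∷_) (select-map f I T)
  select-map f (i ∷ I) (false ∷ T) = select-map f I T

  select-[] : ∀ {A : Set} (I : List A) → select I [] ≡ []
  select-[] []      = refl
  select-[] (_ ∷ _) = refl

  select-++ : ∀ {A : Set} (I J : List A) T →
              select (I ++ J) T ≡ select I (take (length I) T) ++ select J (drop (length I) T)
  select-++ []      J T           = refl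
  select-++ (i ∷ I) J []          = sym (select-[] J)
  select-++ (i ∷ I) J (true ∷ T)  = cong (i ∷_) (select-++ I J T)
  select-++ (i ∷ I) J (false ∷ T) = select-++ I J T

  select⁺ : ∀ {A : Set} {Q : A → Set} {I} T → All Q I → All Q (select I T)
  select⁺ T           []       = []
  select⁺ []          (p ∷ ps) = []
  select⁺ (true ∷ T)  (p ∷ ps) = p ∷ select⁺ T ps
  select⁺ (false ∷ T) (p ∷ ps) = select⁺ T ps

  _∪_ : List Bool → List Bool → List Bool
  []      ∪ U       = U
  (t ∷ T) ∪ []      = t ∷ T
  (t ∷ T) ∪ (u ∷ U) = (t ∨ u) ∷ (T ∪ U)

  module _ {A : Set} {Q : A → Set} where

    ∪⁺ : ∀ I T U → All Q (select I T) → All Q (select I U) → All Q (select I (T ∪ U))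
    ∪⁺ []      T           U           p       q       = []
    ∪⁺ (i ∷ I) []          U           p       q       = q
    ∪⁺ (i ∷ I) (t ∷ T)     []          p       q       = p
    ∪⁺ (i ∷ I) (true ∷ T)  (true ∷ U)  (h ∷ p) (_ ∷ q) = h ∷ ∪⁺ I T U p q
    ∪⁺ (i ∷ I) (true ∷ T)  (false ∷ U) (h ∷ p) q       = h ∷ ∪⁺ I T U p q
    ∪⁺ (i ∷ I) (false ∷ T) (true ∷ U)  p       (h ∷ q) = h ∷ ∪⁺ I T U p q
    ∪⁺ (i ∷ I) (false ∷ T) (false ∷ U) p       q       = ∪⁺ I T U p q

    ∪⁻ : ∀ I T U → All Q (select I (T ∪ U)) → All Q (select I T) × All Q (select I U)
    ∪⁻ []      T           U           p = [] , []
    ∪⁻ (i ∷ I) []          U           p = [] , p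
    ∪⁻ (i ∷ I) (t ∷ T)     []          p = p , []
    ∪⁻ (i ∷ I) (true ∷ T)  (true ∷ U)  (h ∷ p) = let (a , b) = ∪⁻ I T U p in h ∷ a , h ∷ b
    ∪⁻ (i ∷ I) (true ∷ T)  (false ∷ U) (h ∷ p) = let (a , b) = ∪⁻ I T U p in h ∷ a , b
    ∪⁻ (i ∷ I) (false ∷ T) (true ∷ U)  (h ∷ p) = let (a , b) = ∪⁻ I T U p in a , h ∷ b
    ∪⁻ (i ∷ I) (false ∷ T) (false ∷ U) p       = ∪⁻ I T U p

  InFace : ∀ P → List Bool → ℚ^ (dim P) → Set
  InFace P T x = All (Sat x) (ineqs P) × All (Rev x) (select (ineqs P) T)

  Mem⇒InFace : ∀ P T x → Mem (faceOf P T) x → InFace P T x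
  Mem⇒InFace P T x m =
    Allₚ.++⁻ˡ (ineqs P) m ,
    All.map (λ {i} → Sat-neg⇒ x i) (Allₚ.map⁻ (subst (All (Sat x)) (tight≡ (ineqs P) T) (Allₚ.++⁻ʳ (ineqs P) m)))

  InFace⇒Mem : ∀ P T x → InFace P T x → Mem (faceOf P T) x
  InFace⇒Mem P T x (p , q) =
    Allₚ.++⁺ p (subst (All (Sat x)) (sym (tight≡ (ineqs P) T)) (Allₚ.map⁺ (All.map (λ {i} → Sat-neg⇐ x i) q)))

  module _ (P : Pres) (T : List Bool) where
    private
      I = ineqs P
      fst : List Bool → List Bool
      fst U = take (length I) U

    -- The inequalities of `faceOf P T` are I followed by the negations selected by T. A flag on the
    -- second part reverses a negation, which gives back an inequality of I, so only the first
    -- `length I` flags of U count.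
    face-of-face⇒ : ∀ U x → InFace (faceOf P T) U x → InFace P (T ∪ fst U) x
    face-of-face⇒ U x (p , q) =
      let (s , r) = Mem⇒InFace P T x p
      in s , ∪⁺ I T (fst U) r (Allₚ.++⁻ˡ (select I (fst U)) (subst (All (Rev x)) (select-++ I (tight I T) U) q))

    face-of-face⇐ : ∀ U x → InFace P (T ∪ fst U) x → InFace (faceOf P T) U x
    face-of-face⇐ U x (s , r) =
      let (a , b) = ∪⁻ I T (fst U) r
      in InFace⇒Mem P T x (s , a) ,
         subst (All (Rev x)) (sym (select-++ I (tight I T) U))
           (Allₚ.++⁺ b (select⁺ (drop (length I) U)
             (subst (All (Rev x)) (sym (tight≡ I T))
               (Allₚ.map⁺ (All.map (λ {i} → Rev-neg⇐ x i) (select⁺ T s))))))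

  Below : (A : Ord) → Car A → Ord
  Below A a = record
    { Car = ∃ λ x → x A.≤ a ; _≤_ = λ x y → proj₁ x A.≤ proj₁ y
    ; refl≤ = A.refl≤ ; trans≤ = A.trans≤ }
    where module A = Ord A

  take-select : ∀ {A : Set} (I : List A) U → select I (take (length I) U) ≡ select I U
  take-select []      U           = refl
  take-select (i ∷ I) []          = refl
  take-select (i ∷ I) (true ∷ U)  = cong (i ∷_) (take-select I U)
  take-select (i ∷ I) (false ∷ U) = take-select I U

  -- Flags U inside the face with flags T amount to the flags T and U together on `P`. Conversely, a
  -- face contained in F already satisfies the equations of T, so its own flags describe it inside
  -- F.
  faces-of-face : ∀ {P} (F : Face P) → Faces (faceP F) ≃ Below (Faces P) F
  faces-of-face {P} F = record
    { to = λ G → face (T ∪ fst (tightSet G)) (proj₁ (nonempty G) , to (tightSet G) _ (proj₂ (nonempty G)))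
               , λ x m → let (s , r) = Mem⇒InFace P _ x m
                         in InFace⇒Mem P T x (s , proj₁ (∪⁻ I T _ r))
    ; from = λ (G , le) → face (tightSet G) (proj₁ (nonempty G) , back G le _ (proj₂ (nonempty G)))
    ; mono = λ {G} {H} le x → to (tightSet H) x ∘ le x ∘ from (tightSet G) x
    ; reflects = λ {G} {H} le x → from (tightSet H) x ∘ le x ∘ to (tightSet G) x
    ; to-from≤ = λ (G , le) x m → let (s , r) = Mem⇒InFace P _ x m
         in InFace⇒Mem P _ x (s , subst (All (Rev x)) (take-select I (tightSet G)) (proj₂ (∪⁻ I T _ r)))
    ; to-from≥ = λ (G , le) x m → to (tightSet G) x (back G le x m)
    }
    where
    T = tightSet F
    I = ineqs P
    fst : List Bool → List Bool
    fst = take (length I)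
    to : ∀ U x → Mem (faceOf (faceOf P T) U) x → Mem (faceOf P (T ∪ fst U)) x
    to U x m = InFace⇒Mem P _ x (face-of-face⇒ P T U x (Mem⇒InFace (faceOf P T) U x m))
    from : ∀ U x → Mem (faceOf P (T ∪ fst U)) x → Mem (faceOf (faceOf P T) U) x
    from U x m = InFace⇒Mem (faceOf P T) U x (face-of-face⇐ P T U x (Mem⇒InFace P _ x m))
    back : ∀ G → G ⊑ F → ∀ x → Mem (faceP G) x → Mem (faceOf (faceOf P T) (tightSet G)) x
    back G le x m =
      let (s , r) = Mem⇒InFace P (tightSet G) x m
          (_ , t) = Mem⇒InFace P T x (le x m)
      in from (tightSet G) x (InFace⇒Mem P _ x
           (s , ∪⁺ I T _ t (subst (All (Rev x)) (sym (take-select I (tightSet G))) r)))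

  dot-zerosˡ : ∀ {n} (v : ℚ^ n) → dot (zeros n) v ≡ 0ℚ
  dot-zerosˡ []      = refl
  dot-zerosˡ (x ∷ v) = trans (cong₂ ℚ._+_ (ℚₚ.*-zeroˡ x) (dot-zerosˡ v)) (ℚₚ.+-identityˡ 0ℚ)

  dot-++ : ∀ {m n} (a u : ℚ^ m) (b v : ℚ^ n) → dot (a Vec.++ b) (u Vec.++ v) ≡ dot a u ℚ.+ dot b v
  dot-++ []      []      b v = sym (ℚₚ.+-identityˡ _)
  dot-++ (x ∷ a) (y ∷ u) b v = trans (cong (x ℚ.* y ℚ.+_) (dot-++ a u b v)) (sym (ℚₚ.+-assoc (x ℚ.* y) _ _))

  module _ {m n : ℕ} (u : ℚ^ m) (v : ℚ^ n) where

    dot-padʳ : ∀ a → dot (a Vec.++ zeros n) (u Vec.++ v) ≡ dot a u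
    dot-padʳ a = trans (dot-++ a u (zeros n) v) (trans (cong (dot a u ℚ.+_) (dot-zerosˡ v)) (ℚₚ.+-identityʳ _))

    dot-padˡ : ∀ b → dot (zeros m Vec.++ b) (u Vec.++ v) ≡ dot b v
    dot-padˡ b = trans (dot-++ (zeros m) u b v) (trans (cong (ℚ._+ dot b v) (dot-zerosˡ u)) (ℚₚ.+-identityˡ _))

  module _ {d e : ℕ} (f : Ineq d → Ineq e) (x : ℚ^ d) (y : ℚ^ e)
           (same : ∀ i → proj₂ (f i) ≡ proj₂ i × dot (proj₁ (f i)) y ≡ dot (proj₁ i) x) where

    private
      Transfers : (ℚ → ℚ → Set) → Set
      Transfers _~_ = ∀ I → All (λ i → proj₂ (f i) ~ dot (proj₁ (f i)) y) I ⇔ All (λ i → proj₂ i ~ dot (proj₁ i) x)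
          I

      transfer : ∀ _~_ → Transfers _~_
      transfer _~_ I = mk⇔ (All.map λ {i} → subst₂ _~_ (proj₁ (same i)) (proj₂ (same i)))
                           (All.map λ {i} → subst₂ _~_ (sym (proj₁ (same i))) (sym (proj₂ (same i))))

    Sat-map⁻ : ∀ {I} → All (Sat y) (List.map f I) → All (Sat x) I
    Sat-map⁻ h = Equivalence.to (transfer ℚ._≤_ _) (Allₚ.map⁻ h)

    Sat-map⁺ : ∀ {I} → All (Sat x) I → All (Sat y) (List.map f I)
    Sat-map⁺ h = Allₚ.map⁺ (Equivalence.from (transfer ℚ._≤_ _) h)

    Rev-map⁻ : ∀ I T → All (Rev y) (select (List.map f I) T) → All (Rev x) (select I T)
    Rev-map⁻ I T h = Equivalence.to (transfer ℚ._≥_ _) (Allₚ.map⁻ (subst (All (Rev y)) (select-map f I T) h))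

    Rev-map⁺ : ∀ I T → All (Rev x) (select I T) → All (Rev y) (select (List.map f I) T)
    Rev-map⁺ I T h = subst (All (Rev y)) (sym (select-map f I T))
        (Allₚ.map⁺ (Equivalence.from (transfer ℚ._≥_ _) h))

  module _ (P Q : Pres) where
    private
      m = dim P
      n = dim Q
      I = ineqs P
      J = ineqs Q
      padʳ : Ineq m → Ineq (m ℕ.+ n)
      padʳ ab = (proj₁ ab Vec.++ zeros n) , proj₂ ab
      padˡ : Ineq n → Ineq (m ℕ.+ n)
      padˡ ab = (zeros m Vec.++ proj₁ ab) , proj₂ ab
      I′ = List.map padʳ I
      J′ = List.map padˡ J

    leftT rightT : List Bool → List Bool
    leftT  = take (length I′)
    rightT = drop (length I′)

    module _ (T : List Bool) (u : ℚ^ m) (v : ℚ^ n) where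
      private
        w = u Vec.++ v
        sameʳ : ∀ i → proj₂ (padʳ i) ≡ proj₂ i × dot (proj₁ (padʳ i)) w ≡ dot (proj₁ i) u
        sameʳ i = refl , dot-padʳ u v (proj₁ i)
        sameˡ : ∀ i → proj₂ (padˡ i) ≡ proj₂ i × dot (proj₁ (padˡ i)) w ≡ dot (proj₁ i) v
        sameˡ i = refl , dot-padˡ u v (proj₁ i)

      product-face⇒ : Mem (faceOf (P ×ₚ Q) T) w → Mem (faceOf P (leftT T)) u × Mem (faceOf Q (rightT T)) v
      product-face⇒ mem =
        let (s , r) = Mem⇒InFace (P ×ₚ Q) T w mem
            r′      = subst (All (Rev w)) (select-++ I′ J′ T) r
        in InFace⇒Mem P _ u (Sat-map⁻ padʳ u w sameʳ (Allₚ.++⁻ˡ I′ s) ,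
                             Rev-map⁻ padʳ u w sameʳ I _ (Allₚ.++⁻ˡ (select I′ (leftT T)) r′)) ,
           InFace⇒Mem Q _ v (Sat-map⁻ padˡ v w sameˡ (Allₚ.++⁻ʳ I′ s) ,
                             Rev-map⁻ padˡ v w sameˡ J _ (Allₚ.++⁻ʳ (select I′ (leftT T)) r′))

      product-face⇐ : Mem (faceOf P (leftT T)) u → Mem (faceOf Q (rightT T)) v → Mem (faceOf (P ×ₚ Q) T) w
      product-face⇐ mu mv =
        let (s , r)   = Mem⇒InFace P _ u mu
            (s′ , r′) = Mem⇒InFace Q _ v mv
        in InFace⇒Mem (P ×ₚ Q) T w
             ( Allₚ.++⁺ (Sat-map⁺ padʳ u w sameʳ s) (Sat-map⁺ padˡ v w sameˡ s′)
             , subst (All (Rev w)) (sym (select-++ I′ J′ T))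
                 (Allₚ.++⁺ (Rev-map⁺ padʳ u w sameʳ I _ r) (Rev-map⁺ padˡ v w sameˡ J _ r′)))

  -- Exactly k flags. A short list of flags stands for `false` from its end on, so without padding
  -- the flags of the second factor of a product would land on the first.
  pad : ℕ → List Bool → List Bool
  pad zero    T       = []
  pad (suc k) []      = false ∷ pad k []
  pad (suc k) (t ∷ T) = t ∷ pad k T

  take-pad : ∀ k T U → take k (pad k T ++ U) ≡ pad k T
  take-pad zero    T       U = refl
  take-pad (suc k) []      U = cong (false ∷_) (take-pad k [] U)
  take-pad (suc k) (t ∷ T) U = cong (t ∷_) (take-pad k T U)

  drop-pad : ∀ k T U → drop k (pad k T ++ U) ≡ U
  drop-pad zero    T       U = refl
  drop-pad (suc k) []      U = drop-pad k [] U
  drop-pad (suc k) (t ∷ T) U = drop-pad k T U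

  select-pad : ∀ {A B : Set} (I : List A) (f : A → B) T → select I (pad (length (List.map f I)) T) ≡ select I T
  select-pad []      f T           = refl
  select-pad (i ∷ I) f []          = trans (select-pad I f []) (select-[] I)
  select-pad (i ∷ I) f (true ∷ T)  = cong (i ∷_) (select-pad I f T)
  select-pad (i ∷ I) f (false ∷ T) = select-pad I f T

  module _ {P : Pres} {T U : List Bool} (eq : select (ineqs P) T ≡ select (ineqs P) U) where

    Mem-select : ∀ x → Mem (faceOf P T) x → Mem (faceOf P U) x
    Mem-select x m = let (s , r) = Mem⇒InFace P T x m in InFace⇒Mem P U x (s , subst (All (Rev x)) eq r)

  -- An inclusion of products yields inclusions of the factors because faces are nonempty: the
  -- coordinates of the other factor are filled in from the witness point.
  product-faces : ∀ P Q → Faces (P ×ₚ Q) ≃ (Faces P ×ₒ Faces Q)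
  product-faces P Q = record
    { to = λ F → left F , right F
    ; from = λ (F , G) → face (joint F G) (proj₁ (nonempty F) Vec.++ proj₁ (nonempty G) ,
        join F G _ _ (proj₂ (nonempty F)) (proj₂ (nonempty G)))
    ; mono = λ {F} {G} le →
        (λ u mu → proj₁ (product-face⇒ P Q (tightSet G) u (v F)
           (le _ (product-face⇐ P Q (tightSet F) u (v F) mu (proj₂ (mem F)))))) ,
        (λ w mw → proj₂ (product-face⇒ P Q (tightSet G) (u F) w
           (le _ (product-face⇐ P Q (tightSet F) (u F) w (proj₁ (mem F)) mw))))
    ; reflects = λ {F} {G} (p , q) x mx →
        let (a , b , eq) = Vec.splitAt (dim P) x
            (ma , mb) = product-face⇒ P Q (tightSet F) a b (subst (Mem (faceP F)) eq mx)
        in subst (Mem (faceP G)) (sym eq) (product-face⇐ P Q (tightSet G) a b (p a ma) (q b mb))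
    ; to-from≤ = λ (F , G) →
        (λ a ma → proj₁ (split F G a (proj₁ (nonempty G)) (product-face⇐ P Q (joint F G) a (proj₁ (nonempty G)) ma
           (proj₂ (product-face⇒ P Q (joint F G) (proj₁ (nonempty F)) (proj₁ (nonempty G))
              (join F G _ _ (proj₂ (nonempty F)) (proj₂ (nonempty G)))))))) ,
        (λ b mb → proj₂ (split F G (proj₁ (nonempty F)) b (product-face⇐ P Q (joint F G) (proj₁ (nonempty F)) b
           (proj₁ (product-face⇒ P Q (joint F G) (proj₁ (nonempty F)) (proj₁ (nonempty G))
              (join F G _ _ (proj₂ (nonempty F)) (proj₂ (nonempty G))))) mb)))
    ; to-from≥ = λ (F , G) →
        (λ a ma → proj₁ (product-face⇒ P Q (joint F G) a (proj₁ (nonempty G))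
            (join F G a _ ma (proj₂ (nonempty G))))) ,
        (λ b mb → proj₂ (product-face⇒ P Q (joint F G) (proj₁ (nonempty F)) b
            (join F G _ b (proj₂ (nonempty F)) mb)))
    }
    where
    k = length (List.map (λ ab → (proj₁ ab Vec.++ zeros (dim Q)) , proj₂ ab) (ineqs P))
    u : Face (P ×ₚ Q) → ℚ^ (dim P)
    u F = proj₁ (Vec.splitAt (dim P) (proj₁ (nonempty F)))
    v : Face (P ×ₚ Q) → ℚ^ (dim Q)
    v F = proj₁ (proj₂ (Vec.splitAt (dim P) (proj₁ (nonempty F))))
    mem : ∀ F → Mem (faceOf P (leftT P Q (tightSet F))) (u F) × Mem (faceOf Q (rightT P Q (tightSet F))) (v F)
    mem F = product-face⇒ P Q (tightSet F) (u F) (v F)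
      (subst (Mem (faceP F)) (proj₂ (proj₂ (Vec.splitAt (dim P) (proj₁ (nonempty F))))) (proj₂ (nonempty F)))
    left : Face (P ×ₚ Q) → Face P
    left F = face (leftT P Q (tightSet F)) (u F , proj₁ (mem F))
    right : Face (P ×ₚ Q) → Face Q
    right F = face (rightT P Q (tightSet F)) (v F , proj₂ (mem F))
    joint : Face P → Face Q → List Bool
    joint F G = pad k (tightSet F) ++ tightSet G
    selˡ : ∀ F G → select (ineqs P) (leftT P Q (joint F G)) ≡ select (ineqs P) (tightSet F)
    selˡ F G = trans (cong (select (ineqs P)) (take-pad k (tightSet F) (tightSet G)))
                     (select-pad (ineqs P) _ (tightSet F))
    selʳ : ∀ F G → select (ineqs Q) (rightT P Q (joint F G)) ≡ select (ineqs Q) (tightSet G)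
    selʳ F G = cong (select (ineqs Q)) (drop-pad k (tightSet F) (tightSet G))
    join : ∀ F G a b → Mem (faceP F) a → Mem (faceP G) b → Mem (faceOf (P ×ₚ Q) (joint F G)) (a Vec.++ b)
    join F G a b ma mb = product-face⇐ P Q (joint F G) a b
      (Mem-select {P} (sym (selˡ F G)) a ma) (Mem-select {Q} (sym (selʳ F G)) b mb)
    split : ∀ F G a b → Mem (faceOf (P ×ₚ Q) (joint F G)) (a Vec.++ b) → Mem (faceP F) a × Mem (faceP G) b
    split F G a b m = let (ma , mb) = product-face⇒ P Q (joint F G) a b m
      in Mem-select {P} (selˡ F G) a ma , Mem-select {Q} (selʳ F G) b mb

  point-faces : Faces pointₚ ≃ ⊤ₒ
  point-faces = record { to = λ _ → tt ; from = λ _ → face [] ([] , []) ; mono = λ _ → tt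
    ; reflects = λ _ _ _ → [] ; to-from≤ = λ _ → tt ; to-from≥ = λ _ → tt }

  ×ₚ-cong : ∀ {P P′ Q Q′} → P ≅ P′ → Q ≅ Q′ → (P ×ₚ Q) ≅ (P′ ×ₚ Q′)
  ×ₚ-cong p q = ≃⇒≅ (≃-trans (product-faces _ _)
    (≃-trans (×ₒ-cong (≅⇒≃ p) (≅⇒≃ q)) (≃-sym (product-faces _ _))))

  ×ₚ-comm : ∀ P Q → (P ×ₚ Q) ≅ (Q ×ₚ P)
  ×ₚ-comm P Q = ≃⇒≅ (≃-trans (product-faces P Q) (≃-trans (×ₒ-comm _ _) (≃-sym (product-faces Q P))))

  ×ₚ-assoc : ∀ P Q R → ((P ×ₚ Q) ×ₚ R) ≅ (P ×ₚ (Q ×ₚ R))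
  ×ₚ-assoc P Q R = ≃⇒≅
    (≃-trans (product-faces (P ×ₚ Q) R)
    (≃-trans (×ₒ-cong (product-faces P Q) ≃-refl)
    (≃-trans (×ₒ-assoc (Faces P) (Faces Q) (Faces R))
    (≃-trans (×ₒ-cong ≃-refl (≃-sym (product-faces Q R)))
             (≃-sym (product-faces P (Q ×ₚ R)))))))

  ×ₚ-identityˡ : ∀ P → (pointₚ ×ₚ P) ≅ P
  ×ₚ-identityˡ P = ≃⇒≅ (≃-trans (product-faces pointₚ P)
    (≃-trans (×ₒ-cong point-faces ≃-refl) (×ₒ-identityˡ (Faces P))))

  ≅-refl : ∀ {P} → P ≅ P
  ≅-refl = ≃⇒≅ ≃-refl

-- The commutative ring structure on `𝔓`.

module PolytopeRing where

  open FaceOrder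
  open import Data.Integer as ℤ using (ℤ; 0ℤ; 1ℤ)
  import Data.Integer.Properties as ℤₚ
  open import Data.List as List using (List; []; _∷_; _++_)
  import Data.List.Properties as Listₚ
  open import Data.Product using (_×_; _,_; proj₁; proj₂)
  open import Relation.Binary.Bundles using (Setoid)
  open import Relation.Binary.Construct.Closure.Equivalence as EqC using (setoid; return; gmap)

  open Setoid (setoid Step) public using () renaming
      (refl to ≈-refl; sym to ≈-sym; trans to ≈-trans; reflexive to ≈-reflexive)
  open import Relation.Binary.Reasoning.Setoid (setoid Step)

  ++-congʳ : ∀ {u u′} v → u ≈ u′ → u ++ v ≈ u′ ++ v
  ++-congʳ v = gmap (_++ v) step
    where
    step : ∀ {u u′} → Step u u′ → Step (u ++ v) (u′ ++ v)
    step (swap x y l)        = swap x y (l ++ v)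
    step (merge a b P l)     = merge a b P (l ++ v)
    step (drop0 P l)         = drop0 P (l ++ v)
    step (relabel a P Q l e) = relabel a P Q (l ++ v) e
    step (there x l l′ s)    = there x (l ++ v) (l′ ++ v) (step s)

  ∷-cong : ∀ x {u v} → u ≈ v → x ∷ u ≈ x ∷ v
  ∷-cong x = gmap (x ∷_) (there x _ _)

  ++-congˡ : ∀ u {v v′} → v ≈ v′ → u ++ v ≈ u ++ v′
  ++-congˡ []      e = e
  ++-congˡ (x ∷ u) e = ∷-cong x (++-congˡ u e)

  ++-cong : ∀ {u u′ v v′} → u ≈ u′ → v ≈ v′ → u ++ v ≈ u′ ++ v′
  ++-cong {u′ = u′} {v} p q = ≈-trans (++-congʳ v p) (++-congˡ u′ q)

  ∷-shift : ∀ x u v → x ∷ u ++ v ≈ u ++ x ∷ v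
  ∷-shift x []      v = ≈-refl
  ∷-shift x (y ∷ u) v = ≈-trans (return (swap x y (u ++ v))) (∷-cong y (∷-shift x u v))

  ++-comm : ∀ u v → u ++ v ≈ v ++ u
  ++-comm []      v = ≈-reflexive (≡.sym (Listₚ.++-identityʳ v))
  ++-comm (x ∷ u) v = ≈-trans (∷-cong x (++-comm u v)) (∷-shift x v u)

  ++-assoc : ∀ u v w → (u ++ v) ++ w ≈ u ++ (v ++ w)
  ++-assoc u v w = ≈-reflexive (Listₚ.++-assoc u v w)

  ++-interchange : ∀ u v w z → (u ++ v) ++ (w ++ z) ≈ (u ++ w) ++ (v ++ z)
  ++-interchange u v w z = begin
    (u ++ v) ++ (w ++ z) ≈⟨ ++-assoc u v (w ++ z) ⟩
    u ++ (v ++ (w ++ z)) ≈⟨ ++-congˡ u (++-assoc v w z) ⟨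
    u ++ ((v ++ w) ++ z) ≈⟨ ++-congˡ u (++-congʳ z (++-comm v w)) ⟩
    u ++ ((w ++ v) ++ z) ≈⟨ ++-congˡ u (++-assoc w v z) ⟩
    u ++ (w ++ (v ++ z)) ≈⟨ ++-assoc u w (v ++ z) ⟨
    (u ++ w) ++ (v ++ z) ∎

  cancel : ∀ a b P l → a ℤ.+ b ≡ 0ℤ → (a , P) ∷ (b , P) ∷ l ≈ l
  cancel a b P l e = begin
    (a , P) ∷ (b , P) ∷ l ≈⟨ return (merge a b P l) ⟩
    (a ℤ.+ b , P) ∷ l     ≡⟨ ≡.cong (λ c → (c , P) ∷ l) e ⟩
    (0ℤ , P) ∷ l          ≈⟨ return (drop0 P l) ⟩
    l                     ∎

  -𝔓-cong : ∀ {u v} → u ≈ v → -𝔓 u ≈ -𝔓 v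
  -𝔓-cong = gmap -𝔓_ step
    where
    step : ∀ {u v} → Step u v → Step (-𝔓 u) (-𝔓 v)
    step (swap x y l)        = swap _ _ _
    step (merge a b P l)     = ≡.subst (λ c → Step ((ℤ.- a , P) ∷ (ℤ.- b , P) ∷ -𝔓 l) ((c , P) ∷ -𝔓 l))
      (≡.sym (ℤₚ.neg-distrib-+ a b)) (merge (ℤ.- a) (ℤ.- b) P (-𝔓 l))
    step (drop0 P l)         = drop0 P _
    step (relabel a P Q l e) = relabel _ P Q _ e
    step (there x l l′ s)    = there _ _ _ (step s)

  -𝔓-inverseʳ : ∀ u → u ++ -𝔓 u ≈ []
  -𝔓-inverseʳ []            = ≈-refl
  -𝔓-inverseʳ ((a , P) ∷ u) = begin
    (a , P) ∷ u ++ (ℤ.- a , P) ∷ -𝔓 u ≈⟨ ∷-cong _ (∷-shift _ u (-𝔓 u)) ⟨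
    (a , P) ∷ (ℤ.- a , P) ∷ u ++ -𝔓 u ≈⟨ cancel a _ P _ (ℤₚ.+-inverseʳ a) ⟩
    u ++ -𝔓 u                         ≈⟨ -𝔓-inverseʳ u ⟩
    []                                ∎

  scale : ℤ × Pres → 𝔓 → 𝔓
  scale cp = List.map (λ dq → proj₁ cp ℤ.* proj₁ dq , proj₂ cp ×ₚ proj₂ dq)

  scale-congʳ : ∀ x {u v} → u ≈ v → scale x u ≈ scale x v
  scale-congʳ x@(c , R) = gmap (scale x) step
    where
    step : ∀ {u v} → Step u v → Step (scale x u) (scale x v)
    step (swap x y l)        = swap _ _ _
    step (merge a b P l)     = ≡.subst
        (λ d → Step ((c ℤ.* a , R ×ₚ P) ∷ (c ℤ.* b , R ×ₚ P) ∷ scale x l) ((d , R ×ₚ P) ∷ scale x l))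
      (≡.sym (ℤₚ.*-distribˡ-+ c a b)) (merge (c ℤ.* a) (c ℤ.* b) (R ×ₚ P) (scale x l))
    step (drop0 P l)         = ≡.subst (λ d → Step ((d , R ×ₚ P) ∷ scale x l) (scale x l))
      (≡.sym (ℤₚ.*-zeroʳ c)) (drop0 (R ×ₚ P) (scale x l))
    step (relabel a P Q l e) = relabel _ _ _ _ (×ₚ-cong ≅-refl e)
    step (there y l l′ s)    = there _ _ _ (step s)

  scale-merge : ∀ a b P v → scale (a , P) v ++ scale (b , P) v ≈ scale (a ℤ.+ b , P) v
  scale-merge a b P []            = ≈-refl
  scale-merge a b P ((c , Q) ∷ v) = begin
    (a ℤ.* c , P ×ₚ Q) ∷ scale (a , P) v ++ (b ℤ.* c , P ×ₚ Q) ∷ scale (b , P) v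
      ≈⟨ ∷-cong _ (∷-shift _ (scale (a , P) v) _) ⟨
    (a ℤ.* c , P ×ₚ Q) ∷ (b ℤ.* c , P ×ₚ Q) ∷ scale (a , P) v ++ scale (b , P) v
      ≈⟨ return (merge _ _ _ _) ⟩
    (a ℤ.* c ℤ.+ b ℤ.* c , P ×ₚ Q) ∷ scale (a , P) v ++ scale (b , P) v
      ≡⟨ ≡.cong (λ d → (d , P ×ₚ Q) ∷ _) (≡.sym (ℤₚ.*-distribʳ-+ c a b)) ⟩
    ((a ℤ.+ b) ℤ.* c , P ×ₚ Q) ∷ scale (a , P) v ++ scale (b , P) v
      ≈⟨ ∷-cong _ (scale-merge a b P v) ⟩
    scale (a ℤ.+ b , P) ((c , Q) ∷ v) ∎

  scale-0 : ∀ P v → scale (0ℤ , P) v ≈ []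
  scale-0 P []            = ≈-refl
  scale-0 P ((c , Q) ∷ v) = ≈-trans (return (drop0 _ _)) (scale-0 P v)

  scale-relabel : ∀ a {P Q} v → P ≅ Q → scale (a , P) v ≈ scale (a , Q) v
  scale-relabel a []            e = ≈-refl
  scale-relabel a ((c , R) ∷ v) e = ≈-trans (return (relabel _ _ _ _ (×ₚ-cong e ≅-refl)))
      (∷-cong _ (scale-relabel a v e))

  -- A step on the left factor becomes a chain of steps on the product, since a whole block
  -- `scale x v` is moved, merged or relabelled. On the right factor a step acts inside each block,
  -- by `scale-congʳ`.
  *-congʳ : ∀ {u u′} v → u ≈ u′ → u *𝔓 v ≈ u′ *𝔓 v
  *-congʳ v = EqC.gfold (Setoid.isEquivalence (setoid Step)) (_*𝔓 v) step
    where
    step : ∀ {u u′} → Step u u′ → u *𝔓 v ≈ u′ *𝔓 v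
    step (swap x y l) = begin
      scale x v ++ (scale y v ++ l *𝔓 v) ≈⟨ ++-assoc (scale x v) (scale y v) _ ⟨
      (scale x v ++ scale y v) ++ l *𝔓 v ≈⟨ ++-congʳ _ (++-comm (scale x v) (scale y v)) ⟩
      (scale y v ++ scale x v) ++ l *𝔓 v ≈⟨ ++-assoc (scale y v) (scale x v) _ ⟩
      scale y v ++ (scale x v ++ l *𝔓 v) ∎
    step (merge a b P l) = begin
      scale (a , P) v ++ (scale (b , P) v ++ l *𝔓 v) ≈⟨ ++-assoc (scale (a , P) v) (scale (b , P) v) _ ⟨
      (scale (a , P) v ++ scale (b , P) v) ++ l *𝔓 v ≈⟨ ++-congʳ _ (scale-merge a b P v) ⟩
      scale (a ℤ.+ b , P) v ++ l *𝔓 v                ∎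
    step (drop0 P l)         = ++-congʳ _ (scale-0 P v)
    step (relabel a P Q l e) = ++-congʳ _ (scale-relabel a v e)
    step (there x l l′ s)    = ++-congˡ (scale x v) (step s)

  *-congˡ : ∀ u {v v′} → v ≈ v′ → u *𝔓 v ≈ u *𝔓 v′
  *-congˡ []      e = ≈-refl
  *-congˡ (x ∷ u) e = ++-cong (scale-congʳ x e) (*-congˡ u e)

  *-cong : ∀ {u u′ v v′} → u ≈ u′ → v ≈ v′ → u *𝔓 v ≈ u′ *𝔓 v′
  *-cong {u′ = u′} {v} p q = ≈-trans (*-congʳ v p) (*-congˡ u′ q)

  *-distribʳ : ∀ w u v → (u ++ v) *𝔓 w ≈ u *𝔓 w ++ v *𝔓 w
  *-distribʳ w u v = ≈-reflexive (Listₚ.concatMap-++ (λ x → scale x w) u v)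

  *-zeroʳ : ∀ u → u *𝔓 [] ≈ []
  *-zeroʳ []      = ≈-refl
  *-zeroʳ (x ∷ u) = *-zeroʳ u

  *-∷ʳ : ∀ u y v → u *𝔓 (y ∷ v) ≈ u *𝔓 (y ∷ []) ++ u *𝔓 v
  *-∷ʳ []      y v = ≈-refl
  *-∷ʳ (x ∷ u) y v = begin
    scale x (y ∷ v) ++ u *𝔓 (y ∷ v)
      ≈⟨ ++-congˡ (scale x (y ∷ v)) (*-∷ʳ u y v) ⟩
    (scale x (y ∷ []) ++ scale x v) ++ (u *𝔓 (y ∷ []) ++ u *𝔓 v)
      ≈⟨ ++-interchange (scale x (y ∷ [])) (scale x v) (u *𝔓 (y ∷ [])) (u *𝔓 v) ⟩
    (scale x (y ∷ []) ++ u *𝔓 (y ∷ [])) ++ (scale x v ++ u *𝔓 v) ∎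

  *-singletonʳ : ∀ u y → u *𝔓 (y ∷ []) ≈ scale y u
  *-singletonʳ []            y       = ≈-refl
  *-singletonʳ ((a , P) ∷ u) (b , Q) = begin
    (a ℤ.* b , P ×ₚ Q) ∷ u *𝔓 ((b , Q) ∷ []) ≈⟨ return (relabel _ _ _ _ (×ₚ-comm P Q)) ⟩
    (a ℤ.* b , Q ×ₚ P) ∷ u *𝔓 ((b , Q) ∷ []) ≡⟨ ≡.cong (λ c → (c , Q ×ₚ P) ∷ u *𝔓 ((b , Q) ∷ [])) (ℤₚ.*-comm a b) ⟩
    (b ℤ.* a , Q ×ₚ P) ∷ u *𝔓 ((b , Q) ∷ []) ≈⟨ ∷-cong _ (*-singletonʳ u (b , Q)) ⟩
    scale (b , Q) ((a , P) ∷ u)               ∎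

  *-comm : ∀ u v → u *𝔓 v ≈ v *𝔓 u
  *-comm u []      = *-zeroʳ u
  *-comm u (y ∷ v) = ≈-trans (*-∷ʳ u y v) (++-cong (*-singletonʳ u y) (*-comm u v))

  *-distribˡ : ∀ u v w → u *𝔓 (v ++ w) ≈ u *𝔓 v ++ u *𝔓 w
  *-distribˡ u v w = begin
    u *𝔓 (v ++ w)       ≈⟨ *-comm u (v ++ w) ⟩
    (v ++ w) *𝔓 u       ≈⟨ *-distribʳ u v w ⟩
    v *𝔓 u ++ w *𝔓 u    ≈⟨ ++-cong (*-comm v u) (*-comm w u) ⟩
    u *𝔓 v ++ u *𝔓 w    ∎

  scale-scale : ∀ x y w → scale (proj₁ x ℤ.* proj₁ y , proj₂ x ×ₚ proj₂ y) w ≈ scale x (scale y w)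
  scale-scale x y [] = ≈-refl
  scale-scale x@(a , P) y@(b , Q) ((c , R) ∷ w) = begin
    ((a ℤ.* b) ℤ.* c , (P ×ₚ Q) ×ₚ R) ∷ rest ≈⟨ return (relabel _ _ _ _ (×ₚ-assoc P Q R)) ⟩
    ((a ℤ.* b) ℤ.* c , P ×ₚ (Q ×ₚ R)) ∷ rest ≡⟨ ≡.cong (λ d → (d , P ×ₚ (Q ×ₚ R)) ∷ rest) (ℤₚ.*-assoc a b c) ⟩
    (a ℤ.* (b ℤ.* c) , P ×ₚ (Q ×ₚ R)) ∷ rest ≈⟨ ∷-cong _ (scale-scale x y w) ⟩
    scale x (scale y ((c , R) ∷ w))          ∎
    where rest = scale (a ℤ.* b , P ×ₚ Q) w

  scale-* : ∀ x v w → scale x v *𝔓 w ≈ scale x (v *𝔓 w)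
  scale-* x []      w = ≈-refl
  scale-* x (y ∷ v) w = begin
    scale (proj₁ x ℤ.* proj₁ y , proj₂ x ×ₚ proj₂ y) w ++ scale x v *𝔓 w ≈⟨ ++-cong (scale-scale x y w)
        (scale-* x v w) ⟩
    scale x (scale y w) ++ scale x (v *𝔓 w)           ≡⟨ Listₚ.map-++ _ (scale y w) (v *𝔓 w) ⟨
    scale x (scale y w ++ v *𝔓 w)                     ∎

  *-assoc : ∀ u v w → (u *𝔓 v) *𝔓 w ≈ u *𝔓 (v *𝔓 w)
  *-assoc []      v w = ≈-refl
  *-assoc (x ∷ u) v w = begin
    (scale x v ++ u *𝔓 v) *𝔓 w          ≈⟨ *-distribʳ w (scale x v) (u *𝔓 v) ⟩
    scale x v *𝔓 w ++ (u *𝔓 v) *𝔓 w     ≈⟨ ++-cong (scale-* x v w) (*-assoc u v w) ⟩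
    scale x (v *𝔓 w) ++ u *𝔓 (v *𝔓 w)   ∎

  *-identityˡ : ∀ u → 1𝔓 *𝔓 u ≈ u
  *-identityˡ u = ≈-trans (≈-reflexive (Listₚ.++-identityʳ _)) (go u)
    where
    go : ∀ u → scale (1ℤ , pointₚ) u ≈ u
    go []            = ≈-refl
    go ((a , P) ∷ u) = begin
      (1ℤ ℤ.* a , pointₚ ×ₚ P) ∷ scale (1ℤ , pointₚ) u ≈⟨ return (relabel _ _ _ _ (×ₚ-identityˡ P)) ⟩
      (1ℤ ℤ.* a , P) ∷ scale (1ℤ , pointₚ) u ≡⟨ ≡.cong (λ c → (c , P) ∷ _) (ℤₚ.*-identityˡ a) ⟩
      (a , P) ∷ scale (1ℤ , pointₚ) u        ≈⟨ ∷-cong _ (go u) ⟩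
      (a , P) ∷ u                            ∎

  𝔓-ring : CommutativeRing 0ℓ 0ℓ
  𝔓-ring = record
    { Carrier = 𝔓 ; _≈_ = _≈_ ; _+_ = _+𝔓_ ; _*_ = _*𝔓_ ; -_ = -𝔓_ ; 0# = 0𝔓 ; 1# = 1𝔓
    ; isCommutativeRing = record
      { isRing = record
        { +-isAbelianGroup = record
          { isGroup = record
            { isMonoid = record
              { isSemigroup = record
                { isMagma = record { isEquivalence = Setoid.isEquivalence (setoid Step) ; ∙-cong = ++-cong }
                ; assoc = ++-assoc }
              ; identity = (λ _ → ≈-refl) , (λ u → ++-comm u []) }
            ; inverse = (λ u → ≈-trans (++-comm (-𝔓 u) u) (-𝔓-inverseʳ u)) , -𝔓-inverseʳ
            ; ⁻¹-cong = -𝔓-cong }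
          ; comm = ++-comm }
        ; *-cong = *-cong
        ; *-assoc = *-assoc
        ; *-identity = *-identityˡ , (λ u → ≈-trans (*-comm u 1𝔓) (*-identityˡ u))
        ; distrib = *-distribˡ , *-distribʳ }
      ; *-comm = *-comm } }

-- Planar trees, tubings and refinements.

module Trees where

  open FaceOrder using (Ord; Car; _≃_; _×ₒ_; ⊤ₒ)
  open import Data.Bool using (Bool; true; false; if_then_else_; _∧_)
  open import Data.Nat
  open import Data.Nat.Properties
  open import Data.Product using (∃; _×_; _,_; proj₁; proj₂)
  open import Data.Unit using (⊤; tt)

  -- Every node has at least two children; with unary nodes, different trees would have the same
  -- tubes.
  data Tree : Set
  data Forest : ℕ → Set

  data Tree where
    leaf : Tree
    node : ∀ {k} → Forest (2 + k) → Tree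

  infixr 5 _∷_
  data Forest where
    []  : Forest 0
    _∷_ : ∀ {k} → Tree → Forest k → Forest (suc k)

  leaves : Tree → ℕ
  leavesF : ∀ {k} → Forest k → ℕ
  leaves leaf     = 1
  leaves (node f) = leavesF f
  leavesF []      = 0
  leavesF (t ∷ f) = leaves t + leavesF f

  leaves>0 : ∀ t → 0 < leaves t
  leavesF≥ : ∀ {k} (f : Forest k) → k ≤ leavesF f
  leaves>0 leaf     = s≤s z≤n
  leaves>0 (node f) = ≤-trans (s≤s z≤n) (leavesF≥ f)
  leavesF≥ []      = z≤n
  leavesF≥ (t ∷ f) = +-mono-≤ (leaves>0 t) (leavesF≥ f)

  -- A tube (i , j) of a tree records the first and last leaf below an internal vertex, leaves being numbered from 0.
  data Tube : Tree → ℕ → ℕ → Set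
  data TubeF : ∀ {k} → Forest k → ℕ → ℕ → Set

  data Tube where
    root  : ∀ {k} {f : Forest (2 + k)} {j} → suc j ≡ leavesF f → Tube (node f) 0 j
    inner : ∀ {k} {f : Forest (2 + k)} {i j} → TubeF f i j → Tube (node f) i j

  data TubeF where
    here  : ∀ {k t} {f : Forest k} {i j} → Tube t i j → TubeF (t ∷ f) i j
    there : ∀ {k t} {f : Forest k} {i j i′ j′} → TubeF f i j →
            i′ ≡ leaves t + i → j′ ≡ leaves t + j → TubeF (t ∷ f) i′ j′

  tube-bounds : ∀ {t i j} → Tube t i j → i < j × j < leaves t
  tubeF-bounds : ∀ {k} {f : Forest k} {i j} → TubeF f i j → i < j × j < leavesF f
  tube-bounds (root {f = f} e) =
    ≤-trans (s≤s z≤n) (s≤s⁻¹ (≤-trans (leavesF≥ f) (≤-reflexive (sym e)))) , ≤-reflexive e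
  tube-bounds (inner p) = tubeF-bounds p
  tubeF-bounds {f = t ∷ f} (here p) = let (a , b) = tube-bounds p in a , ≤-trans b (m≤m+n _ _)
  tubeF-bounds {f = t ∷ f} (there p refl refl) =
    let (a , b) = tubeF-bounds p in +-monoʳ-< (leaves t) a , +-monoʳ-< (leaves t) b

  root-tube : ∀ t → 1 < leaves t → ∀ {j} → suc j ≡ leaves t → Tube t 0 j
  root-tube leaf     (s≤s ()) e
  root-tube (node f) _        e = root e

  -- Only the values at i < j < L are meaningful; `Laminar` and `Refines` look at no others.
  Family : Set
  Family = ℕ → ℕ → Bool

  shift : ℕ → Family → Family
  shift m S i j = S (m + i) (m + j)

  -- In terms of leaves, k = j means that two tubes share just one leaf; the corresponding intervals
  -- of coordinates are then adjacent. Hence k ≤ j and not k < j.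
  record Laminar (L : ℕ) (S : Family) : Set where
    constructor lam
    field uncrossed : ∀ {i j k l} → i < k → k ≤ j → j < l → l < L → S i j ≡ true → S k l ≡ true → ⊥
  open Laminar

  Whole : ℕ → Family → Set
  Whole L S = ∀ {j} → 0 < j → suc j ≡ L → S 0 j ≡ true

  record Tubing (L : ℕ) : Set where
    constructor tubing
    field
      family  : Family
      laminar : Laminar L family
      whole   : Whole L family
  open Tubing public

  -- More tubes mean a smaller face, so the order is reverse inclusion of families.
  Refines : ℕ → Family → Family → Set
  Refines L S S′ = ∀ {i j} → i < j → j < L → S′ i j ≡ true → S i j ≡ true

  Tubings : ℕ → Ord
  Tubings L = record { Car = Tubing L ; _≤_ = λ S S′ → Refines L (family S) (family S′)
    ; refl≤ = λ _ _ e → e ; trans≤ = λ p q a b → p a b ∘ q a b }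

  Contains : Tree → Family → Set
  Contains t S = ∀ {i j} → Tube t i j → S i j ≡ true

  ContainsF : ∀ {k} → Forest k → Family → Set
  ContainsF f S = ∀ {i j} → TubeF f i j → S i j ≡ true

  -- The analogue of `whole` is part of `contains` as soon as t is a node, by its root tube.
  record Refinement (t : Tree) : Set where
    constructor refinement
    field
      fam      : Family
      lami     : Laminar (leaves t) fam
      contains : Contains t fam
  open Refinement public

  Refinements : Tree → Ord
  Refinements t = record { Car = Refinement t ; _≤_ = λ S S′ → Refines (leaves t) (fam S) (fam S′)
    ; refl≤ = λ _ _ e → e ; trans≤ = λ p q a b → p a b ∘ q a b }

  RefinementsF : ∀ {k} → Forest k → Ord
  RefinementsF []      = ⊤ₒ
  RefinementsF (t ∷ f) = Refinements t ×ₒ RefinementsF f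

  split : ∀ m p → p < m ⊎ ∃ λ q → p ≡ m + q
  split m p with p <? m
  ... | yes lt = inj₁ lt
  ... | no ¬lt = inj₂ (p ∸ m , sym (m+[n∸m]≡n (≮⇒≥ ¬lt)))

  <⇒<ᵇ≡true : ∀ {m n} → m < n → (m <ᵇ n) ≡ true
  <⇒<ᵇ≡true {zero}  (s≤s _)  = refl
  <⇒<ᵇ≡true {suc m} (s≤s lt) = <⇒<ᵇ≡true lt

  m+n<ᵇm : ∀ m n → (m + n <ᵇ m) ≡ false
  m+n<ᵇm zero    n = refl
  m+n<ᵇm (suc m) n = m+n<ᵇm m n

  ≡ᵇ-refl : ∀ n → (n ≡ᵇ n) ≡ true
  ≡ᵇ-refl zero    = refl
  ≡ᵇ-refl (suc n) = ≡ᵇ-refl n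

  ≡ᵇ-sound : ∀ m n → (m ≡ᵇ n) ≡ true → m ≡ n
  ≡ᵇ-sound zero    zero    e = refl
  ≡ᵇ-sound (suc m) (suc n) e = cong suc (≡ᵇ-sound m n e)

  ∧-true : ∀ {a b} → a ∧ b ≡ true → a ≡ true × b ≡ true
  ∧-true {true} e = refl , e

  firstLeaf lastLeaf : ∀ {k} → Forest k → ℕ → ℕ
  firstLeaf []      a       = 0
  firstLeaf (t ∷ f) zero    = 0
  firstLeaf (t ∷ f) (suc a) = leaves t + firstLeaf f a
  lastLeaf []      a       = 0
  lastLeaf (t ∷ f) zero    = pred (leaves t)
  lastLeaf (t ∷ f) (suc a) = leaves t + lastLeaf f a

  suc-pred-leaves : ∀ t → suc (pred (leaves t)) ≡ leaves t
  suc-pred-leaves t with leaves t | leaves>0 t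
  ... | suc _ | _ = refl

  firstLeaf-mono : ∀ {k} (f : Forest k) {a b} → a < b → b < k → firstLeaf f a < firstLeaf f b
  firstLeaf-mono (t ∷ f) {zero}  {suc b} lt       _         = ≤-trans (leaves>0 t) (m≤m+n _ _)
  firstLeaf-mono (t ∷ f) {suc a} {suc b} (s≤s lt) (s≤s lt′) = +-monoʳ-< (leaves t) (firstLeaf-mono f lt lt′)

  lastLeaf-mono : ∀ {k} (f : Forest k) {a b} → a < b → b < k → lastLeaf f a < lastLeaf f b
  lastLeaf-mono (t ∷ f) {zero}  {suc b} lt       _         =
    ≤-trans (≤-reflexive (suc-pred-leaves t)) (m≤m+n _ _)
  lastLeaf-mono (t ∷ f) {suc a} {suc b} (s≤s lt) (s≤s lt′) = +-monoʳ-< (leaves t) (lastLeaf-mono f lt lt′)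

  firstLeaf≤lastLeaf : ∀ {k} (f : Forest k) {a b} → a ≤ b → b < k → firstLeaf f a ≤ lastLeaf f b
  firstLeaf≤lastLeaf (t ∷ f) {zero}  {b}     lt       _         = z≤n
  firstLeaf≤lastLeaf (t ∷ f) {suc a} {suc b} (s≤s lt) (s≤s lt′) = +-monoʳ-≤ (leaves t) (firstLeaf≤lastLeaf f lt lt′)

  lastLeaf< : ∀ {k} (f : Forest k) {a} → a < k → lastLeaf f a < leavesF f
  lastLeaf< (t ∷ f) {zero}  _        = ≤-trans (≤-reflexive (suc-pred-leaves t)) (m≤m+n _ _)
  lastLeaf< (t ∷ f) {suc a} (s≤s lt) = +-monoʳ-< (leaves t) (lastLeaf< f lt)

  firstLeaf<lastLeaf : ∀ {k} (f : Forest k) {a b} → a < b → b < k → firstLeaf f a < lastLeaf f b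
  firstLeaf<lastLeaf f lt lt′ =
    ≤-trans (s≤s (firstLeaf≤lastLeaf f ≤-refl (≤-trans (m<n⇒m<1+n lt) lt′))) (lastLeaf-mono f lt lt′)

  lastLeaf-final : ∀ {k} (f : Forest (suc k)) → suc (lastLeaf f k) ≡ leavesF f
  lastLeaf-final {zero}  (t ∷ [])    = trans (suc-pred-leaves t) (sym (+-identityʳ _))
  lastLeaf-final {suc k} (t ∷ f)     = trans (sym (+-suc (leaves t) _)) (cong (leaves t +_) (lastLeaf-final f))

  laminar-shift : ∀ {L S} m → Laminar (m + L) S → Laminar L (shift m S)
  laminar-shift m h = lam λ a b c d →
    uncrossed h (+-monoʳ-< m a) (+-monoʳ-≤ m b) (+-monoʳ-< m c) (+-monoʳ-< m d)

  laminar-restrict : ∀ {L L′ S} → L ≤ L′ → Laminar L′ S → Laminar L S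
  laminar-restrict le h = lam λ a b c d → uncrossed h a b c (≤-trans d le)

  parts : ∀ {k} (f : Forest k) S → Laminar (leavesF f) S → ContainsF f S → Car (RefinementsF f)
  parts []      S h c = tt
  parts (t ∷ f) S h c =
    refinement S (laminar-restrict (m≤m+n _ _) h) (c ∘ here) ,
    parts f (shift (leaves t) S) (laminar-shift (leaves t) h) (λ p → c (there p refl refl))

  -- Contracts each tree of the forest to a leaf: what remains of S are the tubes that are unions of
  -- consecutive trees.
  quotientFamily : ∀ {k} → Forest k → Family → Family
  quotientFamily f S a b = S (firstLeaf f a) (lastLeaf f b)

  quotient : ∀ {k} {f : Forest (2 + k)} → Refinement (node f) → Tubing (2 + k)
  quotient {k} {f} (refinement S h c) = tubing (quotientFamily f S)
    (lam λ ac cb bd d → uncrossed h (firstLeaf-mono f ac (≤-<-trans cb (<-trans bd d)))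
       (firstLeaf≤lastLeaf f cb (<-trans bd d)) (lastLeaf-mono f bd d) (lastLeaf< f d))
    λ where _ refl → c (root′ f (lastLeaf-final f))
    where
    root′ : ∀ (f : Forest (2 + k)) {j} → suc j ≡ leavesF f → Tube (node f) (firstLeaf f 0) j
    root′ (t ∷ f) e = root e

  endsAt : ∀ {k} → Forest k → (ℕ → Bool) → ℕ → Bool
  endsAt []      Q p = false
  endsAt (t ∷ f) Q p = if p <ᵇ leaves t then (suc p ≡ᵇ leaves t) ∧ Q 0 else endsAt f (Q ∘ suc) (p ∸ leaves t)

  -- Inverse to `parts` and `quotientFamily`. A tube across several trees has to begin at the first
  -- leaf of a tree and end at the last leaf of another, here by i = 0 and `endsAt`; R decides which
  -- of these unions of trees occur.
  glue : ∀ {k} (f : Forest k) → Family → Car (RefinementsF f) → Family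
  glue []      R _        i j = false
  glue (t ∷ f) R (S , ps) i j =
    if j <ᵇ leaves t then fam S i j
    else if i <ᵇ leaves t then (i ≡ᵇ 0) ∧ endsAt f (R 0 ∘ suc) (j ∸ leaves t)
    else glue f (λ a b → R (suc a) (suc b)) ps (i ∸ leaves t) (j ∸ leaves t)

  module _ {k : ℕ} (t : Tree) (f : Forest k) (Q : ℕ → Bool) where

    endsAt-here : ∀ {p} → p < leaves t → endsAt (t ∷ f) Q p ≡ (suc p ≡ᵇ leaves t) ∧ Q 0
    endsAt-here lt rewrite <⇒<ᵇ≡true lt = refl

    endsAt-there : ∀ p → endsAt (t ∷ f) Q (leaves t + p) ≡ endsAt f (Q ∘ suc) p
    endsAt-there p rewrite m+n<ᵇm (leaves t) p | m+n∸m≡n (leaves t) p = refl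

  endsAt-lastLeaf : ∀ {k} (f : Forest k) Q {a} → a < k → endsAt f Q (lastLeaf f a) ≡ Q a
  endsAt-lastLeaf (t ∷ f) Q {zero} _ = trans (endsAt-here t f Q (≤-reflexive (suc-pred-leaves t)))
    (cong (_∧ Q 0) (trans (cong (_≡ᵇ leaves t) (suc-pred-leaves t)) (≡ᵇ-refl (leaves t))))
  endsAt-lastLeaf (t ∷ f) Q {suc a} (s≤s lt) = trans (endsAt-there t f Q _) (endsAt-lastLeaf f (Q ∘ suc) lt)

  endsAt⇒ : ∀ {k} (f : Forest k) Q p → endsAt f Q p ≡ true → ∃ λ a → a < k × p ≡ lastLeaf f a × Q a ≡ true
  endsAt⇒ (t ∷ f) Q p e with split (leaves t) p
  ... | inj₁ lt = let (x , y) = ∧-true (trans (sym (endsAt-here t f Q lt)) e)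
                  in 0 , s≤s z≤n , cong pred (≡ᵇ-sound (suc p) (leaves t) x) , y
  ... | inj₂ (p , refl) = let (a , lt , eq , q) = endsAt⇒ f (Q ∘ suc) p (trans (sym (endsAt-there t f Q p)) e)
                          in suc a , s≤s lt , cong (leaves t +_) eq , q

  module _ {k : ℕ} (t : Tree) (f : Forest k) (R : Family) (S : Refinement t) (ps : Car (RefinementsF f)) where

    glue-here : ∀ {i j} → j < leaves t → glue (t ∷ f) R (S , ps) i j ≡ fam S i j
    glue-here lt rewrite <⇒<ᵇ≡true lt = refl

    glue-cross : ∀ {i} j → i < leaves t →
                 glue (t ∷ f) R (S , ps) i (leaves t + j) ≡ (i ≡ᵇ 0) ∧ endsAt f (R 0 ∘ suc) j
    glue-cross j lt rewrite m+n<ᵇm (leaves t) j | <⇒<ᵇ≡true lt | m+n∸m≡n (leaves t) j = refl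

    glue-there : ∀ i j → glue (t ∷ f) R (S , ps) (leaves t + i) (leaves t + j) ≡
                         glue f (λ a b → R (suc a) (suc b)) ps i j
    glue-there i j rewrite m+n<ᵇm (leaves t) j | m+n<ᵇm (leaves t) i
                         | m+n∸m≡n (leaves t) j | m+n∸m≡n (leaves t) i = refl

    glue-cross⇒ : ∀ {i} j → i < leaves t → glue (t ∷ f) R (S , ps) i (leaves t + j) ≡ true →
                  i ≡ 0 × ∃ λ b → b < k × j ≡ lastLeaf f b × R 0 (suc b) ≡ true
    glue-cross⇒ {i} j lt e = let (x , y) = ∧-true (trans (sym (glue-cross j lt)) e)
                             in ≡ᵇ-sound i 0 x , endsAt⇒ f _ j y

  lastLeaf-cancel-< : ∀ {k} (f : Forest k) {a b} → a < k → lastLeaf f a < lastLeaf f b → a < b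
  lastLeaf-cancel-< f {a} {b} lt h with a <? b
  ... | yes p = p
  ... | no ¬p with m≤n⇒m<n∨m≡n (≮⇒≥ ¬p)
  ...   | inj₁ b<a  = ⊥-elim (<-asym h (lastLeaf-mono f b<a lt))
  ...   | inj₂ refl = ⊥-elim (<-irrefl refl h)

  -- A tube that contains the last leaf of the tree with number b and the leaf after it is not
  -- inside a single tree, so it comes from R.
  glue-over : ∀ {k} (f : Forest k) R ps {i j b} → b < k → i ≤ lastLeaf f b → lastLeaf f b < j → j < leavesF f →
              glue f R ps i j ≡ true → ∃ λ a → ∃ λ c → a ≤ b × b < c × c < k × R a c ≡ true
  glue-over (t ∷ f) R (S , ps) {i} {j} {b} bk ib bj jL e with split (leaves t) j
  glue-over (t ∷ f) R (S , ps) {i} {j} {zero} bk ib bj jL e | inj₁ lt =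
    ⊥-elim (<-irrefl refl (≤-trans (≤-trans (s≤s bj) lt) (≤-reflexive (sym (suc-pred-leaves t)))))
  glue-over (t ∷ f) R (S , ps) {i} {j} {suc b} bk ib bj jL e | inj₁ lt =
    ⊥-elim (<-irrefl refl (≤-<-trans (m≤m+n _ _) (<-trans bj lt)))
  ... | inj₂ (j′ , refl) with split (leaves t) i
  ...   | inj₁ lt = let (_ , c , ck , eq , r) = glue-cross⇒ t f R S ps j′ lt e in
                    0 , suc c , z≤n , lem b bk bj c eq , s≤s ck , r
    where
    lem : ∀ b → b < suc _ → lastLeaf (t ∷ f) b < leaves t + j′ → ∀ c → j′ ≡ lastLeaf f c → b < suc c
    lem zero    _        _ c _    = s≤s z≤n
    lem (suc b) (s≤s lt) h c refl = s≤s (lastLeaf-cancel-< f lt (+-cancelˡ-< (leaves t) _ _ h))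
  ...   | inj₂ (i′ , refl) = lem b bk ib bj
    where
    lem : ∀ b → b < suc _ → leaves t + i′ ≤ lastLeaf (t ∷ f) b → lastLeaf (t ∷ f) b < leaves t + j′ →
          ∃ λ a → ∃ λ c → a ≤ b × b < c × c < suc _ × R a c ≡ true
    lem zero _ h _ = ⊥-elim (<-irrefl refl (≤-<-trans (m≤m+n _ i′)
      (≤-trans (s≤s h) (≤-reflexive (suc-pred-leaves t)))))
    lem (suc b) (s≤s lt) h h′ =
      let (a , c , p , q , r , s) = glue-over f _ ps lt (+-cancelˡ-≤ (leaves t) _ _ h) (+-cancelˡ-< (leaves t) _ _ h′)
            (+-cancelˡ-< (leaves t) _ _ jL) (trans (sym (glue-there t f R S ps i′ j′)) e)
      in suc a , suc c , s≤s p , s≤s q , s≤s r , s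

  glue-laminar : ∀ {k} (f : Forest k) R → Laminar k R → ∀ ps → Laminar (leavesF f) (glue f R ps)
  glue-laminar [] R h ps = lam λ _ _ _ ()
  glue-laminar {suc k} (t ∷ f) R h (S , ps) = lam go
    where
    m = leaves t
    G = glue (t ∷ f) R (S , ps)
    R′ : Family
    R′ a b = R (suc a) (suc b)
    IH : Laminar (leavesF f) (glue f R′ ps)
    IH = glue-laminar f R′ (laminar-shift 1 h) ps
    go : ∀ {i j p l} → i < p → p ≤ j → j < l → l < m + leavesF f → G i j ≡ true → G p l ≡ true → ⊥
    go {i} {j} {p} {l} ip pj jl lL e e′ with split m l
    ... | inj₁ lt = uncrossed (lami S) ip pj jl lt
            (trans (sym (glue-here t f R S ps (<-trans jl lt))) e) (trans (sym (glue-here t f R S ps lt)) e′)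
    ... | inj₂ (l′ , refl) with split m p
    ...   | inj₁ lt = case proj₁ (glue-cross⇒ t f R S ps l′ lt e′) of λ { refl → n≮0 ip }
    ...   | inj₂ (p′ , refl) with split m j
    ...     | inj₁ lt = <-irrefl refl (≤-<-trans (m≤m+n m p′) (≤-<-trans pj lt))
    ...     | inj₂ (j′ , refl) with split m i
    ...       | inj₂ (i′ , refl) = uncrossed IH (+-cancelˡ-< m _ _ ip) (+-cancelˡ-≤ m _ _ pj) (+-cancelˡ-< m _ _ jl)
                  (+-cancelˡ-< m _ _ lL) (trans (sym (glue-there t f R S ps i′ j′)) e)
                  (trans (sym (glue-there t f R S ps p′ l′)) e′)
    -- The first tube joins the first tree to the tree b of the rest, so it ends at a last leaf. The
    -- second tube straddles that leaf, hence comes from R as well, and the crossing would already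
    -- occur in R.
    ...       | inj₁ lt with glue-cross⇒ t f R S ps j′ lt e
    ...         | _ , b , bk , refl , r =
                  let (a , c , ab , bc , ck , r′) = glue-over f R′ ps bk (+-cancelˡ-≤ m _ _ pj) (+-cancelˡ-< m _ _ jl)
                        (+-cancelˡ-< m _ _ lL) (trans (sym (glue-there t f R S ps p′ l′)) e′)
                  in uncrossed h (s≤s z≤n) (s≤s ab) (s≤s bc) (s≤s ck) r r′

  glue-contains : ∀ {k} (f : Forest k) R ps → ContainsF f (glue f R ps)
  glue-contains (t ∷ f) R (S , ps) (here p) =
    trans (glue-here t f R S ps (proj₂ (tube-bounds p))) (contains S p)
  glue-contains (t ∷ f) R (S , ps) (there {i = i} {j} p refl refl) =
    trans (glue-there t f R S ps i j) (glue-contains f _ ps p)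

  glue-quotient : ∀ {k} (f : Forest k) R ps {a b} → a < b → b < k → quotientFamily f (glue f R ps) a b ≡ R a b
  glue-quotient (t ∷ f) R (S , ps) {zero}  {suc b} lt       (s≤s lt′) =
    trans (glue-cross t f R S ps (lastLeaf f b) (leaves>0 t)) (endsAt-lastLeaf f (R 0 ∘ suc) lt′)
  glue-quotient (t ∷ f) R (S , ps) {suc a} {suc b} (s≤s lt) (s≤s lt′) =
    trans (glue-there t f R S ps _ _) (glue-quotient f (λ a b → R (suc a) (suc b)) ps lt lt′)

  Agree : ∀ {k} (f : Forest k) → Family → Car (RefinementsF f) → Set
  Agree []      S _        = ⊤
  Agree (t ∷ f) S (P , ps) = (∀ {i j} → j < leaves t → S i j ≡ fam P i j) × Agree f (shift (leaves t) S) ps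

  agree-glue : ∀ {k} (f : Forest k) R ps S → (∀ i j → S i j ≡ glue f R ps i j) → Agree f S ps
  agree-glue []      R ps       S e = tt
  agree-glue (t ∷ f) R (P , ps) S e =
    (λ lt → trans (e _ _) (glue-here t f R P ps lt)) ,
    agree-glue f _ ps _ (λ i j → trans (e _ _) (glue-there t f R P ps i j))

  parts-agree≤ : ∀ {k} (f : Forest k) S (h : Laminar (leavesF f) S) (c : ContainsF f S) ps → Agree f S ps → Ord._≤_
      (RefinementsF f) (parts f S h c) ps
  parts-agree≤ []      S h c ps       a       = tt
  parts-agree≤ (t ∷ f) S h c (P , ps) (a , b) =
    (λ _ lt e → trans (a lt) e) , parts-agree≤ f _ _ _ ps b

  parts-agree≥ : ∀ {k} (f : Forest k) S (h : Laminar (leavesF f) S) (c : ContainsF f S) ps → Agree f S ps → Ord._≤_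
      (RefinementsF f) ps (parts f S h c)
  parts-agree≥ []      S h c ps       a       = tt
  parts-agree≥ (t ∷ f) S h c (P , ps) (a , b) =
    (λ _ lt e → trans (sym (a lt)) e) , parts-agree≥ f _ _ _ ps b

  parts-mono : ∀ {k} (f : Forest k) {S} {h : Laminar (leavesF f) S} {c : ContainsF f S}
    {S′} {h′ : Laminar (leavesF f) S′} {c′ : ContainsF f S′} → Refines (leavesF f) S S′ →
               Ord._≤_ (RefinementsF f) (parts f S h c) (parts f S′ h′ c′)
  parts-mono []      r = tt
  parts-mono (t ∷ f) r =
    (λ ij jt → r ij (≤-trans jt (m≤m+n _ _))) ,
    parts-mono f (λ ij jt → r (+-monoʳ-< (leaves t) ij) (+-monoʳ-< (leaves t) jt))

  -- A leaf that is not the last one of its tree lies before the end of the root tube of that tree.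
  -- This excludes tubes that end in the middle of a tree they did not start in.
  last-or-inside : ∀ {k} (f : Forest k) p → p < leavesF f →
                   (∃ λ b → b < k × p ≡ lastLeaf f b) ⊎ (∃ λ x → ∃ λ y → TubeF f x y × x ≤ p × p < y)
  last-or-inside (t ∷ f) p lt with split (leaves t) p
  ... | inj₂ (p , refl) with last-or-inside f p (+-cancelˡ-< (leaves t) _ _ lt)
  ...   | inj₁ (b , bk , refl)          = inj₁ (suc b , s≤s bk , refl)
  ...   | inj₂ (x , y , tb , xp , py) =
          inj₂ (_ , _ , there tb refl refl , +-monoʳ-≤ (leaves t) xp , +-monoʳ-< (leaves t) py)
  last-or-inside (t ∷ f) p lt | inj₁ p<m with m≤n⇒m<n∨m≡n p<m
  ... | inj₂ e  = inj₁ (0 , s≤s z≤n , cong pred e)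
  ... | inj₁ p+1<m = inj₂ (0 , pred (leaves t) ,
          here (root-tube t (≤-trans (s≤s (s≤s z≤n)) p+1<m) (suc-pred-leaves t)) , z≤n ,
          s≤s⁻¹ (≤-trans p+1<m (≤-reflexive (sym (suc-pred-leaves t)))))

  -- The family S′ contains the root tubes of the trees of f. A tube of S′ that leaves a tree may
  -- not cross these, so it begins at a first leaf and ends at a last leaf, where `quotientFamily`
  -- sees it.
  refines-from-parts : ∀ {k} (f : Forest k) {S} {h : Laminar (leavesF f) S} {c : ContainsF f S}
      {S′} {h′ : Laminar (leavesF f) S′} {c′ : ContainsF f S′} →
    (∀ {a b} → a < b → b < k → quotientFamily f S′ a b ≡ true → quotientFamily f S a b ≡ true) →
    Ord._≤_ (RefinementsF f) (parts f S h c) (parts f S′ h′ c′) → Refines (leavesF f) S S′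
  refines-from-parts [] q r _ () _
  refines-from-parts (t ∷ f) {S} {h} {c} {S′} {h′} {c′} q (r , rs) {i} {j} ij jL e with split (leaves t) j
  ... | inj₁ lt = r ij lt e
  ... | inj₂ (j , refl) with split (leaves t) i
  ...   | inj₂ (i , refl) = refines-from-parts f {shift m S} {S′ = shift m S′} (λ ab bk → q (s≤s ab) (s≤s bk)) rs
                              (+-cancelˡ-< m _ _ ij) (+-cancelˡ-< m _ _ jL) e
    where m = leaves t
  ...   | inj₁ lt with last-or-inside f j (+-cancelˡ-< (leaves t) _ _ jL)
  ...     | inj₂ (x , y , tb , xj , jy) = ⊥-elim
      (uncrossed h′ (≤-trans lt (m≤m+n _ x)) (+-monoʳ-≤ m xj) (+-monoʳ-< m jy)
              (+-monoʳ-< m (proj₂ (tubeF-bounds tb))) e (c′ (there tb refl refl)))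
    where m = leaves t
  ...     | inj₁ (b , bk , refl) with i
  ...       | zero  = q (s≤s z≤n) (s≤s bk) e
  ...       | suc i = ⊥-elim (uncrossed h′ (s≤s z≤n) (s≤s⁻¹ (≤-trans lt (≤-reflexive (sym (suc-pred-leaves t)))))
               (≤-trans (≤-reflexive (suc-pred-leaves t)) (m≤m+n m _)) jL
               (c′ (here (root-tube t (≤-trans (s≤s (s≤s z≤n)) lt) (suc-pred-leaves t)))) e)
    where m = leaves t

  refinements-node : ∀ {k} (f : Forest (2 + k)) → Refinements (node f) ≃ (Tubings (2 + k) ×ₒ RefinementsF f)
  refinements-node {k} f = record
    { to = λ S → quotient S , parts f (fam S) (lami S) (contains S ∘ inner)
    ; from = λ (R , ps) → refinement (glue f (family R) ps) (glue-laminar f (family R) (laminar R) ps) λ where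
        (root e)  → rooted f R ps e
        (inner p) → glue-contains f (family R) ps p
    ; mono = λ {S} {S′} r → (λ ab bk → r (firstLeaf<lastLeaf f ab bk) (lastLeaf< f bk)) ,
        parts-mono f {fam S} {S′ = fam S′} r
    ; reflects = λ {S} {S′} (q , r) → refines-from-parts f {fam S} {S′ = fam S′} q r
    ; to-from≤ = λ (R , ps) → (λ ab bk e → trans (glue-quotient f (family R) ps ab bk) e) ,
        parts-agree≤ f _ _ _ ps (agree-glue f (family R) ps _ (λ _ _ → refl))
    ; to-from≥ = λ (R , ps) → (λ ab bk e → trans (sym (glue-quotient f (family R) ps ab bk)) e) ,
        parts-agree≥ f _ _ _ ps (agree-glue f (family R) ps _ (λ _ _ → refl)) }
    where
    rooted : ∀ (f : Forest (2 + k)) R ps {j} → suc j ≡ leavesF f → glue f (family R) ps 0 j ≡ true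
    rooted f@(t ∷ u ∷ f′) R ps {j} e =
      trans (cong (glue f (family R) ps 0) (suc-injective (trans e (sym (lastLeaf-final f)))))
        (trans (glue-quotient f (family R) ps (s≤s z≤n) ≤-refl) (whole R (s≤s z≤n) refl))

  refinements-leaf : Refinements leaf ≃ ⊤ₒ
  refinements-leaf = record
    { to = λ _ → tt
    ; from = λ _ → refinement (λ _ _ → false) (lam λ _ _ _ _ ()) (λ ())
    ; mono = λ _ → tt
    ; reflects = λ { _ () (s≤s z≤n) _ }
    ; to-from≤ = λ _ → tt ; to-from≥ = λ _ → tt }

-- The tree of a laminar family, and its uniqueness.

module TreeOfTubing where

  open Trees
  open import Data.Bool using (Bool; true; false; _∧_; not)
  open import Data.Nat
  open import Data.Nat.Properties
  open import Data.Product using (Σ; ∃; _×_; _,_; proj₁; proj₂)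

  record Tubes (t : Tree) (L : ℕ) (S : Family) : Set where
    constructor tubes
    field
      size     : leaves t ≡ L
      sound    : ∀ {i j} → Tube t i j → S i j ≡ true
      complete : ∀ {i j} → i < j → j < L → S i j ≡ true → Tube t i j
  open Tubes public

  record TubesF {k} (f : Forest k) (L : ℕ) (S : Family) : Set where
    constructor tubesF
    field
      sizeF     : leavesF f ≡ L
      soundF    : ∀ {i j} → TubeF f i j → S i j ≡ true
      completeF : ∀ {i j} → i < j → j < L → S i j ≡ true → TubeF f i j
  open TubesF

  properPart : ℕ → Family → Family
  properPart L S i j = S i j ∧ not ((i ≡ᵇ 0) ∧ (suc j ≡ᵇ L))

  properPart⇒ : ∀ L S {i j} → properPart L S i j ≡ true → S i j ≡ true
  properPart⇒ L S e = proj₁ (∧-true e)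

  properPart-root : ∀ L S j → suc j ≡ L → properPart L S 0 j ≡ true → ⊥
  properPart-root L S j refl e with ∧-true {S 0 j} e
  ... | _ , e′ rewrite ≡ᵇ-refl j = case e′ of λ ()

  properPart⇐ : ∀ L S {i j} → S i j ≡ true → (i ≡ 0 → suc j ≡ L → ⊥) → properPart L S i j ≡ true
  properPart⇐ L S {suc i} {j} e n = cong (_∧ true) e
  properPart⇐ L S {zero}  {j} e n with suc j ≡ᵇ L in eq
  ... | false = cong (_∧ true) e
  ... | true  = ⊥-elim (n refl (≡ᵇ-sound (suc j) L eq))

  -- The leaf 0 belongs to a largest proper tube (0 , p), or is a child of the root on its own (p = 0).
  FirstChild : ℕ → Family → ℕ → Set
  FirstChild M S p = p < M × (0 < p → S 0 p ≡ true) × (∀ {j} → p < j → j < M → S 0 j ≡ true → ⊥)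

  firstChild : ∀ M S → ∃ λ p → FirstChild (suc M) S p
  firstChild zero    S = 0 , s≤s z≤n , (λ ()) , λ { (s≤s _) (s≤s ()) _ }
  firstChild (suc M) S with S 0 (suc M) in eq
  ... | true  = suc M , ≤-refl , (λ _ → eq) , λ a b _ → <⇒≱ a (s≤s⁻¹ b)
  ... | false = let (p , lt , x , y) = firstChild M S in
        p , m<n⇒m<1+n lt , x , λ {j} a b e → case m≤n⇒m<n∨m≡n (s≤s⁻¹ b) of λ where
          (inj₁ j<)  → y a j< e
          (inj₂ refl) → case trans (sym eq) e of λ ()

  -- The number n bounds the depth of the recursion and m the length of a forest. A forest may have
  -- n + 2 leaves, but its first tree at most n + 1: this is the last premise of `forestOf`, and
  -- `treeOf` provides it by removing the tube of all leaves.
  treeOf : ∀ n L S → 0 < L → L ≤ suc n → Laminar L S → Whole L S → ∃ λ t → Tubes t L S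
  forestOf : ∀ n m M S → M ≤ m → M ≤ suc (suc n) → Laminar M S → (∀ {p} → p < M → (0 < p → S 0 p ≡ true) → p ≤ n) →
             ∃ λ k → Σ (Forest k) λ f → TubesF f M S

  treeOf n (suc zero) S _ _ h w = leaf , tubes refl (λ ()) λ { (s≤s _) (s≤s ()) }
  treeOf zero (suc (suc L)) S _ (s≤s ()) h w
  treeOf (suc n) L@(suc (suc L′)) S _ le h w
    with forestOf n L L (properPart L S) ≤-refl le (lam λ a b c d e e′ →
           Laminar.uncrossed h a b c d (properPart⇒ L S e) (properPart⇒ L S e′))
           (λ {p} lt q → s≤s⁻¹ (≤-trans (proper lt q) (s≤s⁻¹ le)))
    where
    proper : ∀ {p} → p < L → (0 < p → properPart L S 0 p ≡ true) → p < suc L′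
    proper {zero}  lt q = s≤s z≤n
    proper {suc p} lt q with m≤n⇒m<n∨m≡n (s≤s⁻¹ lt)
    ... | inj₁ lt′ = lt′
    ... | inj₂ e   = ⊥-elim (properPart-root L S (suc p) (cong suc e) (q (s≤s z≤n)))
  ... | zero , [] , F = case sizeF F of λ ()
  -- The root tube of an only child would be the tube of all leaves, which `properPart` lacks.
  ... | suc zero , t ∷ [] , F = ⊥-elim (properPart-root L S (suc L′) refl (soundF F (here
          (root-tube t (≤-trans (s≤s (s≤s z≤n)) (≤-reflexive (sym e))) (sym e)))))
    where e = trans (sym (+-identityʳ (leaves t))) (sizeF F)
  ... | suc (suc k) , f , F = node f , tubes (sizeF F)
    (λ where (root e)  → w (s≤s⁻¹ (≤-trans (s≤s (s≤s z≤n)) (≤-reflexive (sym (trans e (sizeF F)))))) (trans e (sizeF F))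
             (inner p) → properPart⇒ L S (soundF F p))
    complete′
    where
    complete′ : ∀ {i j} → i < j → j < L → S i j ≡ true → Tube (node f) i j
    complete′ {suc i} {j} a b e = inner (completeF F a b (properPart⇐ L S e λ ()))
    complete′ {zero}  {j} a b e with suc j ≟ L
    ... | yes eq = root (trans eq (sym (sizeF F)))
    ... | no ¬eq = inner (completeF F a b (properPart⇐ L S e λ _ → ¬eq))

  forestOf n m zero S _ _ h b = 0 , [] , tubesF refl (λ ()) (λ _ ())
  forestOf n (suc m) (suc M) S (s≤s le) len h b
    with firstChild M S
  ... | p , lt , head , maximal
    with treeOf n (suc p) S (s≤s z≤n) (s≤s (b lt head)) (laminar-restrict lt h) (λ { pos refl → head pos })
       | forestOf n m (M ∸ p) (shift (suc p) S) (≤-trans (m∸n≤m M p) le)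
           (≤-trans (m∸n≤m M p) (m≤n⇒m≤1+n (s≤s⁻¹ len)))
           (laminar-shift (suc p) (subst (λ L → Laminar L S) (cong suc (sym (m+[n∸m]≡n (s≤s⁻¹ lt)))) h))
           (λ {q} lt′ _ → s≤s⁻¹ (≤-trans lt′ (≤-trans (m∸n≤m M p) (s≤s⁻¹ len))))
  ... | t , T | k , f , F = suc k , t ∷ f , tubesF total sound′ complete′
    where
    total : leaves t + leavesF f ≡ suc M
    total = trans (cong₂ _+_ (size T) (sizeF F)) (cong suc (m+[n∸m]≡n (s≤s⁻¹ lt)))
    sound′ : ∀ {i j} → TubeF (t ∷ f) i j → S i j ≡ true
    sound′ (here x) = sound T x
    sound′ (there {i = i} {j} x refl refl) = subst (λ m → S (m + i) (m + j) ≡ true) (sym (size T)) (soundF F x)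
    complete′ : ∀ {i j} → i < j → j < suc M → S i j ≡ true → TubeF (t ∷ f) i j
    complete′ {i} {j} ij jM e with split (suc p) j
    ... | inj₁ jp = here (complete T ij jp e)
    ... | inj₂ (j′ , refl) with split (suc p) i
    ...   | inj₂ (i′ , refl) = there
              (completeF F (+-cancelˡ-< (suc p) _ _ ij)
                (+-cancelˡ-< (suc p) _ _ (subst (suc p + j′ <_) (cong suc (sym (m+[n∸m]≡n (s≤s⁻¹ lt)))) jM)) e)
              (cong (_+ i′) (sym (size T))) (cong (_+ j′) (sym (size T)))
    -- A tube from the first tree into the rest: from leaf 0 it contradicts the maximality of p, and
    -- from a later leaf it crosses the tube (0 , p).
    complete′ {zero}  {j} ij jM e | inj₂ (j′ , refl) | inj₁ ip = ⊥-elim (maximal (s≤s (m≤m+n p j′)) jM e)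
    complete′ {suc i} {j} ij jM e | inj₂ (j′ , refl) | inj₁ ip = ⊥-elim
      (Laminar.uncrossed h (s≤s z≤n) (s≤s⁻¹ ip) (s≤s (m≤m+n p j′)) jM (head (≤-trans (s≤s z≤n) (s≤s⁻¹ ip))) e)

  abstract
    treeOfTubing : ∀ {L} → 0 < L → (S : Tubing L) → ∃ λ t → Tubes t L (family S)
    treeOfTubing {L} pos S = treeOf L L (family S) pos (n≤1+n L) (laminar S) (whole S)

  there⁻¹ : ∀ {k t} {f : Forest k} {i j} → TubeF (t ∷ f) (leaves t + i) (leaves t + j) → TubeF f i j
  there⁻¹ {t = t} {i = i} {j} (here p) = ⊥-elim (<⇒≱ (proj₂ (tube-bounds p)) (m≤m+n (leaves t) j))
  there⁻¹ {t = t} {f} (there p e e′) = subst₂ (TubeF f) (sym (+-cancelˡ-≡ (leaves t) _ _ e))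
      (sym (+-cancelˡ-≡ (leaves t) _ _ e′)) p

  here⁻¹ : ∀ {k t} {f : Forest k} {i j} → TubeF (t ∷ f) i j → i < leaves t → Tube t i j
  here⁻¹ (here p)                lt = p
  here⁻¹ {t = t} (there p refl _) lt = ⊥-elim (<⇒≱ lt (m≤m+n (leaves t) _))

  inner⁻¹ : ∀ {k} {f : Forest (2 + k)} {i j} → Tube (node f) i j → (i ≡ 0 → suc j ≡ leavesF f → ⊥) → TubeF f i j
  inner⁻¹ (root e)  n = ⊥-elim (n refl e)
  inner⁻¹ (inner p) n = p

  -- A tube starting at leaf 0 lies in the first tree and misses the leaves of the second.
  no-root : ∀ {k} {f : Forest (2 + k)} {j} → suc j ≡ leavesF f → TubeF f 0 j → ⊥
  no-root {f = t ∷ u ∷ f} e p = <-irrefl e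
    (≤-<-trans (proj₂ (tube-bounds (here⁻¹ p (leaves>0 t))))
      (≤-trans (≤-reflexive (+-comm 1 (leaves t))) (+-monoʳ-≤ (leaves t) (≤-trans (leaves>0 u) (m≤m+n _ _)))))

  -- The lengths k and l are not assumed equal but recovered along with the trees, hence the
  -- equality of pairs.
  forest-unique : ∀ {k l} (f : Forest k) (g : Forest l) → leavesF f ≡ leavesF g →
    (∀ {i j} → TubeF f i j → TubeF g i j) → (∀ {i j} → TubeF g i j → TubeF f i j) →
    _≡_ {A = ∃ Forest} (k , f) (l , g)

  tree-unique : ∀ s t → leaves s ≡ leaves t →
    (∀ {i j} → Tube s i j → Tube t i j) → (∀ {i j} → Tube t i j → Tube s i j) → s ≡ t
  tree-unique leaf leaf _ _ _ = refl
  tree-unique leaf (node g) e _ _ = ⊥-elim (<⇒≱ (s≤s (s≤s z≤n)) (≤-trans (leavesF≥ g) (≤-reflexive (sym e))))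
  tree-unique (node f) leaf e _ _ = ⊥-elim (<⇒≱ (s≤s (s≤s z≤n)) (≤-trans (leavesF≥ f) (≤-reflexive e)))
  tree-unique (node {k} f) (node {l} g) e p q = lem (forest-unique f g e
    (λ x → inner⁻¹ (p (inner x)) λ { refl e′ → no-root (trans e′ (sym e)) x })
    (λ x → inner⁻¹ (q (inner x)) λ { refl e′ → no-root (trans e′ e) x }))
    where
    lem : _≡_ {A = ∃ Forest} (2 + k , f) (2 + l , g) → node f ≡ node g
    lem refl = refl

  -- If the first trees had different sizes, the root tube of the larger one would not fit into the other forest.
  first-≤ : ∀ {k l} s (f : Forest k) t (g : Forest l) → (∀ {i j} → TubeF (t ∷ g) i j → TubeF (s ∷ f) i j) →
            leaves t ≤ leaves s
  first-≤ s f t g q with leaves s <? leaves t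
  ... | no ¬lt = ≮⇒≥ ¬lt
  ... | yes lt = ⊥-elim (<⇒≱ lt (≤-trans (≤-reflexive (sym (suc-pred-leaves t)))
    (proj₂ (tube-bounds (here⁻¹ (q (here (root-tube t (≤-<-trans (leaves>0 s) lt) (suc-pred-leaves t))))
        (leaves>0 s))))))

  forest-unique []      []      e p q = refl
  forest-unique []      (t ∷ g) e p q = ⊥-elim (<⇒≱ (≤-trans (leaves>0 t) (m≤m+n _ _)) (≤-reflexive (sym e)))
  forest-unique (s ∷ f) []      e p q = ⊥-elim (<⇒≱ (≤-trans (leaves>0 s) (m≤m+n _ _)) (≤-reflexive e))
  forest-unique (s ∷ f) (t ∷ g) e p q = lem
    (tree-unique s t size-eq
      (λ x → here⁻¹ (p (here x)) (<-≤-trans (<-trans (proj₁ (tube-bounds x)) (proj₂ (tube-bounds x)))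
          (≤-reflexive size-eq)))
      (λ x → here⁻¹ (q (here x)) (<-≤-trans (<-trans (proj₁ (tube-bounds x)) (proj₂ (tube-bounds x)))
          (≤-reflexive (sym size-eq)))))
    (forest-unique f g (+-cancelˡ-≡ (leaves s) _ _ (trans e (cong (_+ leavesF g) (sym size-eq))))
      (λ {i} {j} x → there⁻¹ {t = t} (subst (λ m → TubeF (t ∷ g) (m + i) (m + j)) size-eq (p (there x refl refl))))
      (λ {i} {j} x → there⁻¹ {t = s} (subst (λ m → TubeF (s ∷ f) (m + i) (m + j)) (sym size-eq)
          (q (there x refl refl)))))
    where
    size-eq : leaves s ≡ leaves t
    size-eq = ≤-antisym (first-≤ t g s f p) (first-≤ s f t g q)
    lem : ∀ {k l s t} {f : Forest k} {g : Forest l} → s ≡ t → _≡_ {A = ∃ Forest} (k , f) (l , g) →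
          _≡_ {A = ∃ Forest} (suc k , s ∷ f) (suc l , t ∷ g)
    lem refl refl = refl

-- A point that is tight exactly at the tubes of a tree.

module InteriorPoint where

  open Trees
  open import Data.Bool using (if_then_else_)
  open import Data.Nat as ℕ using (ℕ; zero; suc; _<_; _≤_; _∸_; _^_; _<ᵇ_; z≤n; s≤s; pred)
  import Data.Nat.Properties as ℕₚ
  open import Data.Integer as ℤ using (ℤ; +_; 0ℤ)
  import Data.Integer.Properties as ℤₚ
  open import Data.Integer.Tactic.RingSolver using (solve-∀)
  open import Data.Product using (_×_; _,_; proj₁; proj₂)

  -- The sum of the coordinates over a tube with m leaves, i.e. 3 ^ (m - 1), except that
  -- a single leaf spans no coordinates.
  span : ℕ → ℕ
  span (suc (suc m)) = 3 ^ suc m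
  span _             = 0

  -- As `span c` is 3 · 3^(c-2), two of the three summands cover 2 · 3^d, and the third covers
  -- `span a` plus `span b`.
  span-superadditive : ∀ d a b c → 0 < a → 0 < b → a ℕ.+ b ≤ c → 2 ℕ.+ d ≤ c →
                       2 ℕ.* 3 ^ d ℕ.+ (span a ℕ.+ span b) ≤ span c
  span-superadditive d a b (suc (suc c)) a>0 b>0 abc (s≤s (s≤s dc)) =
    ℕₚ.≤-trans (ℕₚ.+-mono-≤ (ℕₚ.*-monoʳ-≤ 2 (ℕₚ.^-monoʳ-≤ 3 dc)) (two a b a>0 b>0 abc))
      (ℕₚ.≤-reflexive (trans (ℕₚ.+-comm (2 ℕ.* 3 ^ c) (3 ^ c)) refl))
    where
    one : ∀ b → b ≤ suc c → span b ≤ 3 ^ c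
    one zero          h       = z≤n
    one (suc zero)    h       = z≤n
    one (suc (suc b)) (s≤s h) = ℕₚ.^-monoʳ-≤ 3 h
    two : ∀ a b → 0 < a → 0 < b → a ℕ.+ b ≤ suc (suc c) → span a ℕ.+ span b ≤ 3 ^ c
    two (suc zero) b _ _ (s≤s h) = one b h
    two (suc (suc a)) (suc zero) _ _ h =
      ℕₚ.≤-trans (ℕₚ.≤-reflexive (ℕₚ.+-identityʳ _))
          (one (suc (suc a)) (ℕₚ.≤-pred (ℕₚ.≤-trans (ℕₚ.≤-reflexive (ℕₚ.+-comm 1 _)) h)))
    two (suc (suc a)) (suc (suc b)) _ _ (s≤s (s≤s h)) = lem c h
      where
      lem : ∀ c → a ℕ.+ suc (suc b) ≤ c → 3 ^ suc a ℕ.+ 3 ^ suc b ≤ 3 ^ c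
      lem zero    h = ⊥-elim (ℕₚ.<⇒≱ (ℕₚ.≤-trans (s≤s z≤n) (ℕₚ.m≤n+m (suc (suc b)) a)) h)
      lem (suc c) h = ℕₚ.+-mono-≤ (ℕₚ.^-monoʳ-≤ 3 a<c) (ℕₚ.≤-trans (ℕₚ.^-monoʳ-≤ 3 b<c) (ℕₚ.m≤m+n (3 ^ c) _))
        where
        h′ : suc (suc (a ℕ.+ b)) ≤ suc c
        h′ = ℕₚ.≤-trans (ℕₚ.≤-reflexive (sym (trans (ℕₚ.+-suc a _) (cong suc (ℕₚ.+-suc a b))))) h
        a<c : suc a ≤ c
        a<c = ℕₚ.≤-pred (ℕₚ.≤-trans (s≤s (s≤s (ℕₚ.m≤m+n a b))) h′)
        b<c : suc b ≤ c
        b<c = ℕₚ.≤-pred (ℕₚ.≤-trans (s≤s (s≤s (ℕₚ.m≤n+m b a))) h′)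

  -- Twice the partial coordinate sums of a point in the relative interior of the face of a tree: the sum of
  -- the vertices obtained by refining every vertex of the tree to a left comb and to a right comb.
  -- A tube is common to both refinements only if it is a tube of the tree.
  baseHeight : (L s m q : ℕ) → ℤ
  baseHeight L s m q = + span (s ℕ.+ m) ℤ.- + span m ℤ.+ (+ span L ℤ.- + span q)

  height : Tree → ℕ → ℤ
  heightF : ∀ {k} → ℕ → ℕ → Forest k → ℕ → ℤ
  height leaf     p = 0ℤ
  height (node f) p = heightF (leavesF f) 0 f p
  heightF L s []      p = 0ℤ
  -- Here s leaves of the node precede t, which has m leaves, and q leaves remain from t on. In the
  -- left comb the tube of the first s + m leaves ends at `span (s + m)`, so t begins at
  -- `span (s + m)` minus `span m`. In the right comb the tube of the last q leaves ends at
  -- `span L`, so t begins at `span L` minus `span q`. `baseHeight` is the sum of these two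
  -- positions.
  heightF L s (t ∷ f) p = if p <ᵇ leaves t
    then baseHeight L s (leaves t) (leavesF (t ∷ f)) ℤ.+ height t p
    else heightF L (s ℕ.+ leaves t) f (p ∸ leaves t)

  module _ {k : ℕ} (L s : ℕ) (t : Tree) (f : Forest k) where

    heightF-here : ∀ {p} → p < leaves t → heightF L s (t ∷ f) p ≡
      baseHeight L s (leaves t) (leavesF (t ∷ f)) ℤ.+ height t p
    heightF-here lt rewrite <⇒<ᵇ≡true lt = refl

    heightF-there : ∀ p → heightF L s (t ∷ f) (leaves t ℕ.+ p) ≡ heightF L (s ℕ.+ leaves t) f p
    heightF-there p rewrite m+n<ᵇm (leaves t) p | ℕₚ.m+n∸m≡n (leaves t) p = refl

  Rise : (ℕ → ℤ) → ℕ → ℕ → ℤ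
  Rise Z i j = Z j ℤ.- Z i

  -- Strict inequality for doubled, integral partial sums. The gap of 1 is also the room for the
  -- perturbations by 0 or 1 that bound the dimension from below.
  Slack : (ℕ → ℤ) → ℕ → ℕ → Set
  Slack Z i j = + (2 ℕ.* 3 ^ (j ∸ i) ℕ.+ 1) ℤ.≤ Rise Z i j

  height-first : ∀ t → height t 0 ≡ 0ℤ
  height-first leaf = refl
  height-first (node (t ∷ f)) = trans (heightF-here _ 0 t f (leaves>0 t))
    (trans (cong (ℤ._+_ (baseHeight (leavesF (t ∷ f)) 0 (leaves t) (leavesF (t ∷ f)))) (height-first t))
        (lem (+ span (leaves t)) (+ span (leavesF (t ∷ f)))))
    where
    lem : ∀ a b → a ℤ.- a ℤ.+ (b ℤ.- b) ℤ.+ 0ℤ ≡ 0ℤ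
    lem = solve-∀

  height-last : ∀ t j → suc j ≡ leaves t → height t j ≡ + (2 ℕ.* span (leaves t))
  heightF-last : ∀ {k} L s (f : Forest (suc k)) j → suc j ≡ leavesF f → L ≡ s ℕ.+ leavesF f →
                 heightF L s f j ≡ + (2 ℕ.* span L)
  height-last leaf     j e = refl
  height-last (node f) j e = heightF-last (leavesF f) 0 f j e refl
  heightF-last {zero} L s (t ∷ []) j e refl = trans (heightF-here L s t [] (ℕₚ.≤-reflexive e′))
    (trans (cong (ℤ._+_ (baseHeight (s ℕ.+ leavesF (t ∷ [])) s (leaves t) (leavesF (t ∷ [])))) (height-last t j e′))
      (final _ s (leaves t) _ (cong (s ℕ.+_) (ℕₚ.+-identityʳ _)) (ℕₚ.+-identityʳ _)))
    where
    e′ : suc j ≡ leaves t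
    e′ = trans e (ℕₚ.+-identityʳ _)
    lem : ∀ a b → a ℤ.- b ℤ.+ (a ℤ.- b) ℤ.+ + 2 ℤ.* b ≡ + 2 ℤ.* a
    lem = solve-∀
    final : ∀ L s m q → L ≡ s ℕ.+ m → q ≡ m → baseHeight L s m q ℤ.+ + (2 ℕ.* span m) ≡ + (2 ℕ.* span L)
    final L s m q refl refl = trans (cong (ℤ._+_ (baseHeight L s m q)) (ℤₚ.pos-* 2 (span m)))
      (trans (lem (+ span L) (+ span m)) (sym (ℤₚ.pos-* 2 (span L))))
  heightF-last {suc k} L s (t ∷ f) j e e′ with split (leaves t) j
  ... | inj₁ lt = ⊥-elim (ℕₚ.<-irrefl e (ℕₚ.≤-<-trans lt
        (ℕₚ.m<m+n (leaves t) (ℕₚ.≤-trans (s≤s z≤n) (leavesF≥ f)))))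
  ... | inj₂ (j , refl) = trans (heightF-there L s t f j) (heightF-last L (s ℕ.+ leaves t) f j
        (ℕₚ.+-cancelˡ-≡ (leaves t) _ _ (trans (ℕₚ.+-suc (leaves t) j) e)) (trans e′ (sym (ℕₚ.+-assoc s _ _))))

  nonneg-+ : ∀ {a b} → 0ℤ ℤ.≤ a → 0ℤ ℤ.≤ b → 0ℤ ℤ.≤ a ℤ.+ b
  nonneg-+ = ℤₚ.+-mono-≤

  ≤-by-difference : ∀ {a b c} → 0ℤ ℤ.≤ c → c ≡ b ℤ.- a → a ℤ.≤ b
  ≤-by-difference h e = ℤₚ.0≤i-j⇒j≤i (subst (0ℤ ℤ.≤_) e h)

  -- The tree of a forest containing a given leaf: it starts at s′ and has m′ leaves, q′ leaves remain from s′ on,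
  -- and z is the height inside it.
  record Block (L s : ℕ) (Z : ℤ) (p : ℕ) : Set where
    constructor block
    field
      s′ m′ q′ : ℕ
      z        : ℤ
      s≤s′     : s ≤ s′
      m′>0     : 0 < m′
      q′>0     : 0 < q′
      total    : s′ ℕ.+ q′ ≡ L
      inside   : s ℕ.+ suc p ≤ s′ ℕ.+ m′
      z≥0      : 0ℤ ℤ.≤ z
      value    : Z ≡ baseHeight L s′ m′ q′ ℤ.+ z

  classify : ∀ t {i j} → i < j → j < leaves t → Tube t i j ⊎ Slack (height t) i j
  -- In the third outcome the leaves from i to j are all L leaves of the parent node. Its root tube
  -- is not a tube of the forest; `classify` supplies it.
  classifyF : ∀ {k} L s (f : Forest k) {i j} → L ≡ s ℕ.+ leavesF f → i < j → j < leavesF f →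
              TubeF f i j ⊎ Slack (heightF L s f) i j ⊎ (s ℕ.+ i ≡ 0 × s ℕ.+ suc j ≡ L)

  height-tube : ∀ {t i j} → Tube t i j → Rise (height t) i j ≡ + (2 ℕ.* 3 ^ (j ∸ i))
  heightF-tube : ∀ {k} L s {f : Forest k} {i j} → TubeF f i j → Rise (heightF L s f) i j ≡ + (2 ℕ.* 3 ^ (j ∸ i))

  height-rise : ∀ t {i j} → i < j → j < leaves t → + (2 ℕ.* 3 ^ (j ∸ i)) ℤ.≤ Rise (height t) i j
  height-rise t ij jt with classify t ij jt
  ... | inj₁ tb = ℤₚ.≤-reflexive (sym (height-tube tb))
  ... | inj₂ sl = ℤₚ.≤-trans (ℤ.+≤+ (ℕₚ.m≤m+n _ 1)) sl

  height-nonneg : ∀ t p → p < leaves t → 0ℤ ℤ.≤ height t p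
  height-nonneg t zero    lt = ℤₚ.≤-reflexive (sym (height-first t))
  height-nonneg t (suc p) lt = ℤₚ.0≤i-j⇒j≤i
    (ℤₚ.≤-trans (ℤ.+≤+ z≤n) (subst (λ x → _ ℤ.≤ height t (suc p) ℤ.- x) (height-first t)
        (height-rise t (s≤s z≤n) lt)))

  height-bounded : ∀ t p → p < leaves t → height t p ℤ.≤ + (2 ℕ.* span (leaves t))
  height-bounded t p lt with ℕₚ.m≤n⇒m<n∨m≡n lt
  ... | inj₂ e  = ℤₚ.≤-reflexive (height-last t p e)
  ... | inj₁ lt′ = subst (height t p ℤ.≤_) (height-last t _ (suc-pred-leaves t)) (ℤₚ.0≤i-j⇒j≤i
        (ℤₚ.≤-trans (ℤ.+≤+ z≤n) (height-rise t {j = pred (leaves t)}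
          (ℕₚ.≤-pred (ℕₚ.≤-trans lt′ (ℕₚ.≤-reflexive (sym (suc-pred-leaves t)))))
              (ℕₚ.≤-reflexive (suc-pred-leaves t)))))

  findBlock : ∀ {k} L s (f : Forest k) p → p < leavesF f → L ≡ s ℕ.+ leavesF f → Block L s (heightF L s f p) p
  findBlock L s (t ∷ f) p lt e with split (leaves t) p
  ... | inj₁ lt′ = block s (leaves t) (leavesF (t ∷ f)) (height t p) ℕₚ.≤-refl (leaves>0 t)
        (ℕₚ.≤-trans (leaves>0 t) (ℕₚ.m≤m+n _ _)) (sym e) (ℕₚ.+-monoʳ-≤ s lt′) (height-nonneg t p lt′)
            (heightF-here L s t f lt′)
  ... | inj₂ (p , refl) with findBlock L (s ℕ.+ leaves t) f p (ℕₚ.+-cancelˡ-< (leaves t) _ _ lt) (trans e (sym (ℕₚ.+-assoc s _ _)))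
  ...   | block s′ m′ q′ z a b c d i n v = block s′ m′ q′ z (ℕₚ.≤-trans (ℕₚ.m≤m+n s _) a) b c d
          (ℕₚ.≤-trans (ℕₚ.≤-reflexive (trans (cong (s ℕ.+_) (sym (ℕₚ.+-suc (leaves t) p)))
              (sym (ℕₚ.+-assoc s (leaves t) (suc p))))) i)
          n (trans (heightF-there L s t f p) v)

  -- The variables stand for values of `span`. Leaf i has height at most sm in the left comb plus L
  -- - q + m in the right comb, since zᵢ ≤ 2 m; leaf j has at least sm′ - m′ plus L - q′. The two
  -- hypotheses on D₁ and D₂ bound the differences comb by comb.
  cross-rise : ∀ D₁ D₂ {sm′ m′ sm m q q′ L : ℕ} {z zᵢ Zⱼ Zᵢ : ℤ} →
    D₁ ℕ.+ (m′ ℕ.+ sm) ≤ sm′ → D₂ ℕ.+ (m ℕ.+ q′) ≤ q → 0ℤ ℤ.≤ z → zᵢ ℤ.≤ + (2 ℕ.* m) →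
    Zⱼ ≡ + sm′ ℤ.- + m′ ℤ.+ (+ L ℤ.- + q′) ℤ.+ z → Zᵢ ≡ + sm ℤ.- + m ℤ.+ (+ L ℤ.- + q) ℤ.+ zᵢ →
    + (D₁ ℕ.+ D₂) ℤ.≤ Zⱼ ℤ.- Zᵢ
  cross-rise D₁ D₂ {sm′} {m′} {sm} {m} {q} {q′} {L} {z} {zᵢ} h₁ h₂ hz hzᵢ refl refl =
    ≤-by-difference (nonneg-+ (nonneg-+ (ℤₚ.i≤j⇒0≤j-i (ℤ.+≤+ h₁)) (ℤₚ.i≤j⇒0≤j-i (ℤ.+≤+ h₂)))
        (nonneg-+ hz (ℤₚ.i≤j⇒0≤j-i hzᵢ)))
      (trans (cong (λ x → (+ sm′ ℤ.- + (D₁ ℕ.+ (m′ ℕ.+ sm))) ℤ.+ (+ q ℤ.- + (D₂ ℕ.+ (m ℕ.+ q′))) ℤ.+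
          (z ℤ.+ (x ℤ.- zᵢ))) (ℤₚ.pos-* 2 m))
             (lem (+ D₁) (+ D₂) (+ sm′) (+ m′) (+ sm) (+ m) (+ q) (+ q′) (+ L) z zᵢ))
    where
    lem : ∀ D₁ D₂ sm′ m′ sm m q q′ L z zᵢ →
      (sm′ ℤ.- (D₁ ℤ.+ (m′ ℤ.+ sm))) ℤ.+ (q ℤ.- (D₂ ℤ.+ (m ℤ.+ q′))) ℤ.+ (z ℤ.+ (+ 2 ℤ.* m ℤ.- zᵢ)) ≡
      ((sm′ ℤ.- m′ ℤ.+ (L ℤ.- q′) ℤ.+ z) ℤ.- (sm ℤ.- m ℤ.+ (L ℤ.- q) ℤ.+ zᵢ)) ℤ.- (D₁ ℤ.+ D₂)
    lem = solve-∀

  height-tube (root {f = f} e) = trans (cong₂ ℤ._-_ (height-last (node f) _ e) (height-first (node f)))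
    (trans (ℤₚ.+-identityʳ _) (cong (λ m → + (2 ℕ.* m)) (lem (leavesF f) (leavesF≥ f) e)))
    where
    lem : ∀ L {k j} → suc (suc k) ≤ L → suc j ≡ L → span L ≡ 3 ^ j
    lem (suc (suc L)) _ refl = refl
    lem (suc zero) (s≤s ()) e
  height-tube (inner p) = heightF-tube _ 0 p
  heightF-tube L s {t ∷ f} {i} {j} (here p) =
    trans (cong₂ ℤ._-_ (heightF-here L s t f (proj₂ (tube-bounds p)))
                       (heightF-here L s t f (ℕₚ.<-trans (proj₁ (tube-bounds p)) (proj₂ (tube-bounds p)))))
      (trans (cancel (baseHeight L s (leaves t) (leavesF (t ∷ f))) (height t j) (height t i)) (height-tube p))
    where
    cancel : ∀ c a b → (c ℤ.+ a) ℤ.- (c ℤ.+ b) ≡ a ℤ.- b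
    cancel = solve-∀
  heightF-tube L s {t ∷ f} (there {i = i} {j} p refl refl) =
    trans (cong₂ ℤ._-_ (heightF-there L s t f j) (heightF-there L s t f i))
      (trans (heightF-tube L _ p) (cong (λ d → + (2 ℕ.* 3 ^ d)) (sym (ℕₚ.[m+n]∸[m+o]≡n∸o (leaves t) j i))))

  classify leaf (s≤s _) (s≤s ())
  classify (node f) ij jt with classifyF (leavesF f) 0 f refl ij jt
  ... | inj₁ tb                  = inj₁ (inner tb)
  ... | inj₂ (inj₁ sl)           = inj₂ sl
  ... | inj₂ (inj₂ (refl , e))   = inj₁ (root e)

  classifyF L s [] e ij ()
  classifyF L s (t ∷ f) {i} {j} e ij jL with split (leaves t) j
  ... | inj₁ jt with classify t ij jt
  ...   | inj₁ tb = inj₁ (here tb)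
  ...   | inj₂ sl = inj₂ (inj₁ (subst (_ ℤ.≤_) (sym (trans
          (cong₂ ℤ._-_ (heightF-here L s t f jt) (heightF-here L s t f (ℕₚ.<-trans ij jt)))
          (cancel (baseHeight L s (leaves t) (leavesF (t ∷ f))) (height t j) (height t i)))) sl))
    where
    cancel : ∀ c a b → (c ℤ.+ a) ℤ.- (c ℤ.+ b) ≡ a ℤ.- b
    cancel = solve-∀
  classifyF L s (t ∷ f) {i} {.(leaves t ℕ.+ j)} e ij jL | inj₂ (j , refl) with split (leaves t) i
  ... | inj₂ (i , refl) with classifyF L (s ℕ.+ leaves t) f (trans e (sym (ℕₚ.+-assoc s _ _)))
                               (ℕₚ.+-cancelˡ-< (leaves t) _ _ ij) (ℕₚ.+-cancelˡ-< (leaves t) _ _ jL)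
  ...   | inj₁ tb = inj₁ (there tb refl refl)
  ...   | inj₂ (inj₁ sl) = inj₂ (inj₁ (subst₂ ℤ._≤_
            (cong (λ d → + (2 ℕ.* 3 ^ d ℕ.+ 1)) (sym (ℕₚ.[m+n]∸[m+o]≡n∸o (leaves t) j i)))
            (sym (cong₂ ℤ._-_ (heightF-there L s t f j) (heightF-there L s t f i))) sl))
  ...   | inj₂ (inj₂ (z , _)) = ⊥-elim (ℕₚ.<⇒≱ (leaves>0 t)
            (ℕₚ.≤-trans (ℕₚ.m≤n+m _ s) (ℕₚ.≤-trans (ℕₚ.m≤m+n _ i) (ℕₚ.≤-reflexive z))))
  classifyF L s (t ∷ f) {i} {.(leaves t ℕ.+ j)} e ij jL | inj₂ (j , refl) | inj₁ it
    with findBlock L (s ℕ.+ leaves t) f j (ℕₚ.+-cancelˡ-< (leaves t) _ _ jL) (trans e (sym (ℕₚ.+-assoc s _ _)))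
  ... | block s′ m′ q′ z a b c d′ ins n v = finish
    where
    m = leaves t
    q = leavesF (t ∷ f)
    d = (m ℕ.+ j) ∸ i
    J = m ℕ.+ j
    s+J<s′+m′ : s ℕ.+ suc J ≤ s′ ℕ.+ m′
    s+J<s′+m′ = ℕₚ.≤-trans (ℕₚ.≤-reflexive
        (trans (cong (s ℕ.+_) (sym (ℕₚ.+-suc m j))) (sym (ℕₚ.+-assoc s m (suc j))))) ins
    s′>0 : 0 < s′
    s′>0 = ℕₚ.≤-trans (leaves>0 t) (ℕₚ.≤-trans (ℕₚ.m≤n+m m s) a)
    ineq₁ : m′ ℕ.+ (s ℕ.+ m) ≤ s′ ℕ.+ m′
    ineq₁ = ℕₚ.≤-trans (ℕₚ.+-monoʳ-≤ m′ a) (ℕₚ.≤-reflexive (ℕₚ.+-comm m′ s′))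
    ineq₂ : m ℕ.+ q′ ≤ q
    ineq₂ = ℕₚ.+-cancelˡ-≤ s _ _ (ℕₚ.≤-trans (ℕₚ.≤-reflexive (sym (ℕₚ.+-assoc s m q′)))
              (ℕₚ.≤-trans (ℕₚ.+-monoˡ-≤ q′ a) (ℕₚ.≤-reflexive (trans d′ e))))
    two₁ : 2 ≤ s′ ℕ.+ m′
    two₁ = ℕₚ.+-mono-≤ s′>0 b
    two₂ : 2 ≤ q
    two₂ = ℕₚ.≤-trans (ℕₚ.+-mono-≤ (leaves>0 t) c) ineq₂
    sm>0 : 0 < s ℕ.+ m
    sm>0 = ℕₚ.≤-trans (leaves>0 t) (ℕₚ.m≤n+m m s)
    rise : ∀ d₁ d₂ → 2 ℕ.+ d₁ ≤ s′ ℕ.+ m′ → 2 ℕ.+ d₂ ≤ q →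
           + (2 ℕ.* 3 ^ d₁ ℕ.+ 2 ℕ.* 3 ^ d₂) ℤ.≤ Rise (heightF L s (t ∷ f)) i J
    rise d₁ d₂ h₁ h₂ = cross-rise (2 ℕ.* 3 ^ d₁) (2 ℕ.* 3 ^ d₂) {span (s′ ℕ.+ m′)} {span m′} {span (s ℕ.+ m)}
        {span m} {span q} {span q′} {span L} {z} {height t i}
      (span-superadditive d₁ m′ (s ℕ.+ m) (s′ ℕ.+ m′) b sm>0 ineq₁ h₁)
      (span-superadditive d₂ m q′ q (leaves>0 t) c ineq₂ h₂) n (height-bounded t i it)
      (trans (heightF-there L s t f j) v) (heightF-here L s t f it)
    finish : TubeF (t ∷ f) i J ⊎ Slack (heightF L s (t ∷ f)) i J ⊎ (s ℕ.+ i ≡ 0 × s ℕ.+ suc J ≡ L)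
    -- A comb alone contributes 2 · 3^d as soon as its tube has more leaves than the interval, and
    -- the other comb then adds at least 2 · 3^0, more than the required 1. If neither tube is
    -- larger than the interval, the interval is the whole node.
    finish with 2 ℕ.+ d ℕ.≤? s′ ℕ.+ m′ | 2 ℕ.+ d ℕ.≤? q
    ... | yes h | _ = inj₂ (inj₁ (ℤₚ.≤-trans (ℤ.+≤+ (ℕₚ.+-monoʳ-≤ (2 ℕ.* 3 ^ d) (s≤s z≤n))) (rise d 0 h two₂)))
    ... | no _ | yes h = inj₂ (inj₁ (ℤₚ.≤-trans (ℤ.+≤+ (ℕₚ.≤-trans (ℕₚ.+-monoʳ-≤ (2 ℕ.* 3 ^ d) (s≤s (z≤n {1})))
                           (ℕₚ.≤-reflexive (ℕₚ.+-comm (2 ℕ.* 3 ^ d) 2)))) (rise 0 d two₁ h)))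
    ... | no ¬h | no ¬h′ = inj₂ (inj₂ (s+i≡0 , ℕₚ.≤-antisym upper lower))
      where
      d+i : d ℕ.+ i ≡ J
      d+i = ℕₚ.m∸n+n≡m (ℕₚ.<⇒≤ ij)
      s+i≡0 : s ℕ.+ i ≡ 0
      s+i≡0 = ℕₚ.n≤0⇒n≡0 (ℕₚ.+-cancelˡ-≤ (suc d) _ _ (ℕₚ.≤-trans (ℕₚ.≤-reflexive
        (trans (cong suc (trans (sym (ℕₚ.+-assoc d s i))
            (trans (cong (ℕ._+ i) (ℕₚ.+-comm d s)) (trans (ℕₚ.+-assoc s d i) (cong (s ℕ.+_) d+i)))))
               (sym (ℕₚ.+-suc s J))))
        (ℕₚ.≤-trans s+J<s′+m′ (ℕₚ.≤-trans (ℕₚ.≤-pred (ℕₚ.≰⇒> ¬h))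
            (ℕₚ.≤-reflexive (sym (ℕₚ.+-identityʳ (suc d))))))))
      upper : s ℕ.+ suc J ≤ L
      upper = ℕₚ.≤-trans (ℕₚ.+-monoʳ-≤ s jL) (ℕₚ.≤-reflexive (sym e))
      lower : L ≤ s ℕ.+ suc J
      lower = ℕₚ.≤-trans (ℕₚ.≤-reflexive e) (ℕₚ.+-monoʳ-≤ s (ℕₚ.≤-trans (ℕₚ.≤-pred (ℕₚ.≰⇒> ¬h′))
                (s≤s (ℕₚ.m∸n≤m J i))))

-- Faces of the associahedron correspond to tubings.

module AssocGeometry where

  open FaceOrder
  open Trees
  open TreeOfTubing
  open InteriorPoint
  open import Data.Bool using (Bool; true; false; if_then_else_; _∧_; _∨_; not)
  open import Data.Nat as ℕ using (ℕ; zero; suc; _<_; _≤_; _∸_; _^_; _≤ᵇ_; _≡ᵇ_; z≤n; s≤s; pred)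
  import Data.Nat.Properties as ℕₚ
  open import Data.Nat.Coprimality using (1-coprimeTo) renaming (sym to coprime-sym)
  open import Data.Integer as ℤ using (ℤ; +_; 0ℤ)
  import Data.Integer.Properties as ℤₚ
  open import Data.Rational as ℚ using (ℚ; 0ℚ; ½; mkℚ)
  import Data.Rational.Properties as ℚₚ
  open import Data.Rational.Solver using (module +-*-Solver)
  open import Data.Vec using (Vec; []; _∷_; tabulate)
  open import Data.List as List using (List; []; _∷_; drop; upTo)
  open import Data.List.Membership.Propositional using (_∈_; lose; find)
  open import Data.List.Membership.Propositional.Properties using (∈-concatMap⁺; ∈-concatMap⁻; ∈-upTo⁺; ∈-upTo⁻)
  open import Data.List.Relation.Unary.Any using (here; there)
  open import Data.List.Relation.Unary.All as All using (All; []; _∷_)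
  import Data.List.Relation.Unary.All.Properties as Allₚ
  open import Data.Product using (∃; _×_; _,_; proj₁; proj₂)

  ι : ℤ → ℚ
  ι z = z ℚ./ 1

  private
    whole-number : ∀ z → ι z ≡ mkℚ z 0 (coprime-sym (1-coprimeTo ℤ.∣ z ∣))
    whole-number z = ℚₚ.fromℚᵘ-toℚᵘ (mkℚ z 0 _)

  ι-+ : ∀ a b → ι (a ℤ.+ b) ≡ ι a ℚ.+ ι b
  ι-+ a b rewrite whole-number a | whole-number b = cong ι (sym (cong₂ ℤ._+_ (ℤₚ.*-identityʳ a) (ℤₚ.*-identityʳ b)))

  ι-mono-≤ : ∀ {a b} → a ℤ.≤ b → ι a ℚ.≤ ι b
  ι-mono-≤ {a} {b} h rewrite whole-number a | whole-number b = ℚ.*≤* (ℤₚ.*-monoʳ-≤-nonNeg (+ 1) h)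

  ι-cancel-≤ : ∀ {a b} → ι a ℚ.≤ ι b → a ℤ.≤ b
  ι-cancel-≤ {a} {b} h rewrite whole-number a | whole-number b with h
  ... | ℚ.*≤* h′ = subst₂ ℤ._≤_ (ℤₚ.*-identityʳ a) (ℤₚ.*-identityʳ b) h′

  ι-mono-< : ∀ {a b} → a ℤ.< b → ι a ℚ.< ι b
  ι-mono-< {a} {b} h rewrite whole-number a | whole-number b = ℚ.*<* (ℤₚ.*-monoʳ-<-pos (+ 1) h)

  ι-neg : ∀ a → ι (ℤ.- a) ≡ ℚ.- ι a
  ι-neg a = lem (ι a) (ι (ℤ.- a)) (trans (sym (ι-+ a (ℤ.- a))) (cong ι (ℤₚ.+-inverseʳ a)))
    where
    open +-*-Solver
    lem : ∀ p q → p ℚ.+ q ≡ 0ℚ → q ≡ ℚ.- p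
    lem p q e = trans (solve 2 (λ p q → q := p :+ q :- p) refl p q) (trans (cong (ℚ._- p) e) (ℚₚ.+-identityˡ _))

  Riseℚ : (ℕ → ℚ) → ℕ → ℕ → ℚ
  Riseℚ X i j = X j ℚ.- X i

  halved : (ℕ → ℤ) → ℕ → ℚ
  halved Z p = ½ ℚ.* ι (Z p)

  private
    open +-*-Solver

    halved-Rise : ∀ Z i j → Riseℚ (halved Z) i j ≡ ½ ℚ.* ι (Rise Z i j)
    halved-Rise Z i j = trans (lem ½ (ι (Z j)) (ι (Z i)))
      (cong (½ ℚ.*_) (sym (trans (ι-+ (Z j) _) (cong (ι (Z j) ℚ.+_) (ι-neg (Z i))))))
      where
      lem : ∀ h a b → h ℚ.* a ℚ.- h ℚ.* b ≡ h ℚ.* (a ℚ.+ ℚ.- b)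
      lem = solve 3 (λ h a b → h :* a :- h :* b := h :* (a :- b)) refl

    ½-double : ∀ k → ½ ℚ.* ι (+ (2 ℕ.* k)) ≡ ι (+ k)
    ½-double k = trans (cong (½ ℚ.*_) (trans (cong (ι ∘ +_) (cong (k ℕ.+_) (ℕₚ.+-identityʳ k))) (ι-+ (+ k) (+ k))))
        (lem (ι (+ k)))
      where
      lem : ∀ a → ½ ℚ.* (a ℚ.+ a) ≡ a
      lem a = trans (ℚₚ.*-distribˡ-+ ½ a a) (trans (sym (ℚₚ.*-distribʳ-+ a ½ ½)) (ℚₚ.*-identityˡ a))

  module _ (Z : ℕ → ℤ) (i j k : ℕ) where

    halved-lower : + (2 ℕ.* k) ℤ.≤ Rise Z i j → qℕ k ℚ.≤ Riseℚ (halved Z) i j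
    halved-lower h = subst₂ ℚ._≤_ (½-double k) (sym (halved-Rise Z i j)) (ℚₚ.*-monoˡ-≤-nonNeg ½ (ι-mono-≤ h))

    halved-upper : Rise Z i j ℤ.≤ + (2 ℕ.* k) → Riseℚ (halved Z) i j ℚ.≤ qℕ k
    halved-upper h = subst₂ ℚ._≤_ (sym (halved-Rise Z i j)) (½-double k) (ℚₚ.*-monoˡ-≤-nonNeg ½ (ι-mono-≤ h))

    halved-upper⁻ : Riseℚ (halved Z) i j ℚ.≤ qℕ k → Rise Z i j ℤ.≤ + (2 ℕ.* k)
    halved-upper⁻ h = ι-cancel-≤ (ℚₚ.*-cancelˡ-≤-pos ½ (subst₂ ℚ._≤_ (halved-Rise Z i j) (sym (½-double k)) h))

  prefix : ∀ {n} → ℚ^ n → ℕ → ℚ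
  prefix []      p       = 0ℚ
  prefix (a ∷ x) zero    = 0ℚ
  prefix (a ∷ x) (suc p) = a ℚ.+ prefix x p

  prefix-0 : ∀ {n} (x : ℚ^ n) → prefix x 0 ≡ 0ℚ
  prefix-0 []      = refl
  prefix-0 (_ ∷ _) = refl

  dot-interval : ∀ {n} a b (x : ℚ^ n) → a ≤ b → dot (interval n (suc a) b) x ≡ Riseℚ (prefix x) a b
  dot-interval a       b       []      ab = refl
  dot-interval zero    zero    (y ∷ x) ab = trans (cong₂ ℚ._+_ (ℚₚ.*-zeroˡ y) (dot-interval zero zero x z≤n))
    (trans (ℚₚ.+-identityˡ _) (trans (ℚₚ.+-inverseʳ (prefix x 0)) (sym (ℚₚ.+-inverseʳ 0ℚ))))
  dot-interval zero    (suc b) (y ∷ x) ab = trans (cong₂ ℚ._+_ (ℚₚ.*-identityˡ y) (dot-interval zero b x z≤n))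
    (trans (cong (λ z → y ℚ.+ (prefix x b ℚ.- z)) (prefix-0 x)) (lem y (prefix x b) 0ℚ))
    where
    lem : ∀ y p z → y ℚ.+ (p ℚ.- z) ≡ y ℚ.+ p ℚ.- z
    lem = solve 3 (λ y p z → y :+ (p :- z) := y :+ p :- z) refl
  dot-interval (suc a) (suc b) (y ∷ x) (s≤s ab) = trans (cong₂ ℚ._+_ (ℚₚ.*-zeroˡ y) (dot-interval a b x ab))
    (trans (ℚₚ.+-identityˡ _) (lem y (prefix x b) (prefix x a)))
    where
    lem : ∀ y p q → p ℚ.- q ≡ y ℚ.+ p ℚ.- (y ℚ.+ q)
    lem = solve 3 (λ y p q → p :- q := y :+ p :- (y :+ q)) refl

  differences : ∀ n → (ℕ → ℚ) → ℚ^ n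
  differences zero    X = []
  differences (suc n) X = (X 1 ℚ.- X 0) ∷ differences n (X ∘ suc)

  prefix-differences : ∀ n X p → p ≤ n → prefix (differences n X) p ≡ X p ℚ.- X 0
  prefix-differences zero    X zero    z≤n      = sym (ℚₚ.+-inverseʳ (X 0))
  prefix-differences (suc n) X zero    le       = sym (ℚₚ.+-inverseʳ (X 0))
  prefix-differences (suc n) X (suc p) (s≤s le) =
    trans (cong (X 1 ℚ.- X 0 ℚ.+_) (prefix-differences n (X ∘ suc) p le)) (lem (X 0) (X 1) (X (suc p)))
    where
    lem : ∀ a b c → b ℚ.- a ℚ.+ (c ℚ.- b) ≡ c ℚ.- a
    lem = solve 3 (λ a b c → b :- a :+ (c :- b) := c :- a) refl

  Rise-differences : ∀ n X {i j} → i ≤ n → j ≤ n → Riseℚ (prefix (differences n X)) i j ≡ Riseℚ X i j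
  Rise-differences n X {i} {j} ii jj =
    trans (cong₂ ℚ._-_ (prefix-differences n X j jj) (prefix-differences n X i ii)) (lem (X 0) (X i) (X j))
    where
    lem : ∀ a b c → c ℚ.- a ℚ.- (b ℚ.- a) ≡ c ℚ.- b
    lem = solve 3 (λ a b c → c :- a :- (b :- a) := c :- b) refl

  -- In terms of the partial sums X of the coordinates, the inequality of the interval [i + 1 , j]
  -- bounds the rise of X from i to j.
  record Realizes (n : ℕ) (S : Family) (X : ℕ → ℚ) : Set where
    constructor realizes
    field
      lower : ∀ {i j} → i < j → j ≤ n → qℕ (3 ^ (j ∸ i)) ℚ.≤ Riseℚ X i j
      upper : ∀ {i j} → i < j → j ≤ n → S i j ≡ true → Riseℚ X i j ℚ.≤ qℕ (3 ^ (j ∸ i))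
  open Realizes public

  member : ℕ → ℕ → List (ℕ × ℕ) → Bool
  member a b []            = false
  member a b ((c , d) ∷ l) = ((a ≡ᵇ c) ∧ (b ≡ᵇ d)) ∨ member a b l

  member⇒∈ : ∀ a b l → member a b l ≡ true → (a , b) ∈ l
  member⇒∈ a b ((c , d) ∷ l) e with (a ≡ᵇ c) ∧ (b ≡ᵇ d) in eq
  ... | true  = let (p , q) = ∧-true eq in here (cong₂ _,_ (≡ᵇ-sound a c p) (≡ᵇ-sound b d q))
  ... | false = there (member⇒∈ a b l e)

  ∈⇒member : ∀ a b l → (a , b) ∈ l → member a b l ≡ true
  ∈⇒member a b (_ ∷ l) (here refl) rewrite ≡ᵇ-refl a | ≡ᵇ-refl b = refl
  ∈⇒member a b ((c , d) ∷ l) (there p) with (a ≡ᵇ c) ∧ (b ≡ᵇ d)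
  ... | true  = refl
  ... | false = ∈⇒member a b l p

  -- The first two inequalities of `assoc n` express the equation for the sum of all coordinates.
  -- Their flags are therefore dropped, and the tube (0 , n) always belongs to the family. A pair (a
  -- , b) is the interval between the leaves a - 1 and b.
  flagged : ℕ → List Bool → Family
  flagged n T i j = ((i ≡ᵇ 0) ∧ (j ≡ᵇ n)) ∨ member (suc i) j (select (pairs n) (drop 2 T))

  private
    <⇒≤ᵇ : ∀ {m n} → m ≤ n → (m ≤ᵇ n) ≡ true
    <⇒≤ᵇ {zero}  z≤n = refl
    <⇒≤ᵇ {suc m} h   = <⇒<ᵇ≡true h

    ≤ᵇ⇒≤′ : ∀ m n → (m ≤ᵇ n) ≡ true → m ≤ n
    ≤ᵇ⇒≤′ m n e = ℕₚ.≤ᵇ⇒≤ m n (subst Data.Bool.T (sym e) _)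

  ∈-pairs⁺ : ∀ {n i j} → i < j → j ≤ n → ((i ≡ᵇ 0) ∧ (j ≡ᵇ n)) ≡ false → (suc i , j) ∈ pairs n
  ∈-pairs⁺ {n} {i} {suc j} ij jn e =
    ∈-concatMap⁺ _ (lose (∈-upTo⁺ (ℕₚ.<-≤-trans ij jn))
        (∈-concatMap⁺ _ (lose (∈-upTo⁺ jn) (if-true (cong₂ (λ p q → p ∧ not q) (<⇒≤ᵇ ij) e)))))
    where
    if-true : ∀ {c} → c ≡ true → (suc i , suc j) ∈ (if c then (suc i , suc j) ∷ [] else [])
    if-true refl = here refl

  ∈-pairs⁻ : ∀ {n a b} → (a , b) ∈ pairs n →
             ∃ λ i → a ≡ suc i × i < b × b ≤ n × ((i ≡ᵇ 0) ∧ (b ≡ᵇ n)) ≡ false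
  ∈-pairs⁻ {n} p with find (∈-concatMap⁻ _ {upTo n} p)
  ... | a , a∈ , q with find (∈-concatMap⁻ _ {upTo n} q)
  ...   | b , b∈ , r with (suc a ≤ᵇ suc b) in eq | (suc a ≡ᵇ 1) ∧ (suc b ≡ᵇ n) in eq′
  ...     | true | false with r
  ...       | here refl = a , refl , ≤ᵇ⇒≤′ (suc a) (suc b) eq , ∈-upTo⁻ b∈ , eq′

  module _ (n : ℕ) (n>0 : 0 < n) where

    private
      facetIneq : ℕ × ℕ → Ineq n
      facetIneq ab = interval n (proj₁ ab) (proj₂ ab) , qℕ (3 ^ (suc (proj₂ ab) ∸ proj₁ ab))
      whole-ineq : Ineq n
      whole-ineq = interval n 1 n , qℕ (3 ^ n)

      flags⇒ : ∀ {Q : Ineq n → Set} T → All Q (select (ineqs (assoc n)) T) → All Q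
          (List.map facetIneq (select (pairs n) (drop 2 T)))
      flags⇒ {Q} []                  p = subst (All Q ∘ List.map facetIneq) (sym (select-[] (pairs n))) []
      flags⇒ {Q} (t ∷ [])            p = subst (All Q ∘ List.map facetIneq) (sym (select-[] (pairs n))) []
      flags⇒ {Q} (true ∷ true ∷ T)   (_ ∷ _ ∷ p) = subst (All Q) (select-map facetIneq (pairs n) T) p
      flags⇒ {Q} (true ∷ false ∷ T)  (_ ∷ p)     = subst (All Q) (select-map facetIneq (pairs n) T) p
      flags⇒ {Q} (false ∷ true ∷ T)  (_ ∷ p)     = subst (All Q) (select-map facetIneq (pairs n) T) p
      flags⇒ {Q} (false ∷ false ∷ T) p           = subst (All Q) (select-map facetIneq (pairs n) T) p

      flags⇐ : ∀ {Q : Ineq n → Set} T → Q whole-ineq → Q (negIneq whole-ineq) →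
               All Q (List.map facetIneq (select (pairs n) (drop 2 T))) → All Q (select (ineqs (assoc n)) T)
      flags⇐ {Q} []                  a b p = []
      flags⇐ {Q} (true ∷ [])         a b p = a ∷ []
      flags⇐ {Q} (false ∷ [])        a b p = []
      flags⇐ {Q} (true ∷ true ∷ T)   a b p = a ∷ b ∷ subst (All Q) (sym (select-map facetIneq (pairs n) T)) p
      flags⇐ {Q} (true ∷ false ∷ T)  a b p = a ∷ subst (All Q) (sym (select-map facetIneq (pairs n) T)) p
      flags⇐ {Q} (false ∷ true ∷ T)  a b p = b ∷ subst (All Q) (sym (select-map facetIneq (pairs n) T)) p
      flags⇐ {Q} (false ∷ false ∷ T) a b p = subst (All Q) (sym (select-map facetIneq (pairs n) T)) p

      select-⊆ : ∀ {A : Set} {a : A} I T → a ∈ select I T → a ∈ I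
      select-⊆ (i ∷ I) (true ∷ T)  (here e)  = here e
      select-⊆ (i ∷ I) (true ∷ T)  (there p) = there (select-⊆ I T p)
      select-⊆ (i ∷ I) (false ∷ T) p         = there (select-⊆ I T p)

    private
      root? : ∀ i j → (i ≡ 0 × j ≡ n) ⊎ ((i ≡ᵇ 0) ∧ (j ≡ᵇ n)) ≡ false
      root? i j with (i ≡ᵇ 0) ∧ (j ≡ᵇ n) in eq
      ... | true  = inj₁ (≡ᵇ-sound i 0 (proj₁ (∧-true eq)) , ≡ᵇ-sound j n (proj₂ (∧-true {i ≡ᵇ 0} eq)))
      ... | false = inj₂ refl

      unroot : ∀ {c d} → c ≡ false → c ∨ d ≡ true → d ≡ true
      unroot refl e = e

      reroot : ∀ {c d} → c ≡ false → d ≡ true → c ∨ d ≡ true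
      reroot refl e = e

    Mem⇒Realizes : ∀ T x → Mem (faceOf (assoc n) T) x → Realizes n (flagged n T) (prefix x)
    Mem⇒Realizes T x mem = realizes lower′ upper′
      where
      s : All (Sat x) (whole-ineq ∷ negIneq whole-ineq ∷ List.map facetIneq (pairs n))
      s = proj₁ (Mem⇒InFace (assoc n) T x mem)
      r : All (Rev x) (List.map facetIneq (select (pairs n) (drop 2 T)))
      r = flags⇒ T (proj₂ (Mem⇒InFace (assoc n) T x mem))
      lower′ : ∀ {i j} → i < j → j ≤ n → qℕ (3 ^ (j ∸ i)) ℚ.≤ Riseℚ (prefix x) i j
      lower′ {i} {j} ij jn = subst (qℕ (3 ^ (j ∸ i)) ℚ.≤_) (dot-interval i j x (ℕₚ.<⇒≤ ij)) (go (root? i j))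
        where
        go : (i ≡ 0 × j ≡ n) ⊎ ((i ≡ᵇ 0) ∧ (j ≡ᵇ n)) ≡ false → Sat x (facetIneq (suc i , j))
        go (inj₁ (refl , refl)) = All.head s
        go (inj₂ eq)            = All.lookup (Allₚ.map⁻ (All.tail (All.tail s))) (∈-pairs⁺ ij jn eq)
      upper′ : ∀ {i j} → i < j → j ≤ n → flagged n T i j ≡ true → Riseℚ (prefix x) i j ℚ.≤ qℕ (3 ^ (j ∸ i))
      upper′ {i} {j} ij jn e = subst (ℚ._≤ qℕ (3 ^ (j ∸ i))) (dot-interval i j x (ℕₚ.<⇒≤ ij)) (go (root? i j))
        where
        go : (i ≡ 0 × j ≡ n) ⊎ ((i ≡ᵇ 0) ∧ (j ≡ᵇ n)) ≡ false → Rev x (facetIneq (suc i , j))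
        go (inj₁ (refl , refl)) = Sat-neg⇒ x whole-ineq (All.head (All.tail s))
        go (inj₂ eq)            = All.lookup (Allₚ.map⁻ r) (member⇒∈ (suc i) j _ (unroot eq e))

    flagged-root : ∀ T → flagged n T 0 n ≡ true
    flagged-root T rewrite ≡ᵇ-refl n = refl

    Realizes⇒Mem : ∀ T x → Realizes n (flagged n T) (prefix x) → Mem (faceOf (assoc n) T) x
    Realizes⇒Mem T x (realizes lo up) = InFace⇒Mem (assoc n) T x
      ( sat₁ ∷ Sat-neg⇐ x whole-ineq rev₁ ∷ Allₚ.map⁺ (All.tabulate λ {ab} p → sat (proj₁ ab) (proj₂ ab) p)
      , flags⇐ T rev₁ (Rev-neg⇐ x whole-ineq sat₁)
          (Allₚ.map⁺ (All.tabulate λ {ab} p → rev (proj₁ ab) (proj₂ ab) p)))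
      where
      sat₁ : Sat x whole-ineq
      sat₁ = subst (_ ℚ.≤_) (sym (dot-interval 0 n x z≤n)) (lo n>0 ℕₚ.≤-refl)
      rev₁ : Rev x whole-ineq
      rev₁ = subst (ℚ._≤ _) (sym (dot-interval 0 n x z≤n)) (up n>0 ℕₚ.≤-refl (flagged-root T))
      sat : ∀ a b → (a , b) ∈ pairs n → Sat x (facetIneq (a , b))
      sat a b p with ∈-pairs⁻ {n} p
      ... | i , refl , ib , bn , _ = subst (_ ℚ.≤_) (sym (dot-interval i b x (ℕₚ.<⇒≤ ib))) (lo ib bn)
      rev : ∀ a b → (a , b) ∈ select (pairs n) (drop 2 T) → Rev x (facetIneq (a , b))
      rev a b p with ∈-pairs⁻ {n} (select-⊆ (pairs n) (drop 2 T) p)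
      ... | i , refl , ib , bn , e = subst (ℚ._≤ _) (sym (dot-interval i b x (ℕₚ.<⇒≤ ib)))
              (up ib bn (reroot e (∈⇒member (suc i) b _ p)))

    flags : Family → List Bool
    flags S = false ∷ false ∷ List.map (λ ab → S (pred (proj₁ ab)) (proj₂ ab)) (pairs n)

    flagged-flags : ∀ S {i j} → S 0 n ≡ true → i < j → j ≤ n → flagged n (flags S) i j ≡ S i j
    flagged-flags S {i} {j} rooted ij jn with (i ≡ᵇ 0) ∧ (j ≡ᵇ n) in eq
    ... | true with ≡ᵇ-sound i 0 (proj₁ (∧-true eq)) | ≡ᵇ-sound j n (proj₂ (∧-true {i ≡ᵇ 0} eq))
    ...   | refl | refl = sym rooted
    flagged-flags S {i} {j} rooted ij jn | false with S i j in eq′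
    ... | true  = ∈⇒member (suc i) j _ (go (pairs n) (∈-pairs⁺ ij jn eq))
      where
      go : ∀ l → (suc i , j) ∈ l → (suc i , j) ∈ select l (List.map (λ ab → S (pred (proj₁ ab)) (proj₂ ab)) l)
      go (_ ∷ l) (here refl) rewrite eq′ = here refl
      go ((a , b) ∷ l) (there p) with S (pred a) b
      ... | true  = there (go l p)
      ... | false = go l p
    ... | false with member (suc i) j (select (pairs n) (drop 2 (flags S))) in eq″
    ...   | false = refl
    ...   | true  = ⊥-elim (go (pairs n) (member⇒∈ (suc i) j _ eq″))
      where
      go : ∀ l → (suc i , j) ∈ select l (List.map (λ ab → S (pred (proj₁ ab)) (proj₂ ab)) l) → ⊥
      go ((a , b) ∷ l) p with S (pred a) b in eq‴
      ... | false = go l p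
      go ((a , b) ∷ l) (here refl) | true = case trans (sym eq′) eq‴ of λ ()
      go ((a , b) ∷ l) (there p)   | true = go l p

    private
      span< : ∀ d e m → d < m → e < m → qℕ (3 ^ d) ℚ.+ qℕ (3 ^ e) ℚ.< qℕ (3 ^ m)
      span< d e (suc m) (s≤s dm) (s≤s em) = subst (ℚ._< qℕ (3 ^ suc m)) (ι-+ (+ (3 ^ d)) (+ (3 ^ e)))
        (ι-mono-< (ℤ.+<+ (ℕₚ.≤-<-trans (ℕₚ.+-mono-≤ (ℕₚ.^-monoʳ-≤ 3 dm) (ℕₚ.^-monoʳ-≤ 3 em))
          (ℕₚ.+-monoʳ-< (3 ^ m) (ℕₚ.m<m+n (3 ^ m) (ℕₚ.≤-trans (ℕₚ.m^n>0 3 m) (ℕₚ.m≤m+n _ 0)))))))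

    -- For i < k ≤ j < l the rises from i to l and from k to j add up to those from i to j and from
    -- k to l, and the rise from k to j is nonnegative. If (i , j) and (k , l) were tight, 3^(l-i)
    -- would be at most 3^(j-i) + 3^(l-k), against `span<`.
    realizes⇒laminar : ∀ {S X} → Realizes n S X → Laminar (suc n) S
    realizes⇒laminar {S} {X} (realizes lo up) = lam λ {i} {j} {k} {l} ik kj jl l≤n e e′ →
      let ln = ℕₚ.≤-pred l≤n
          ij = ℕₚ.<-≤-trans ik kj
          kl = ℕₚ.≤-<-trans kj jl
          il = ℕₚ.<-trans ij jl
      in ℚₚ.<-irrefl refl (ℚₚ.<-≤-trans (span< (j ∸ i) (l ∸ k) (l ∸ i) (ℕₚ.∸-monoˡ-< jl (ℕₚ.<⇒≤ ij)) (ℕₚ.∸-monoʳ-< ik (ℕₚ.<⇒≤ kl)))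
           (ℚₚ.≤-trans (lo il ln)
             (ℚₚ.≤-trans (subst₂ ℚ._≤_ (ℚₚ.+-identityʳ _) (lem (X i) (X j) (X k) (X l))
                 (ℚₚ.+-monoʳ-≤ (Riseℚ X i l) (nonneg k j kj (ℕₚ.≤-trans (ℕₚ.<⇒≤ jl) ln))))
               (ℚₚ.+-mono-≤ (up ij (ℕₚ.≤-trans (ℕₚ.<⇒≤ jl) ln) e) (up kl ln e′)))))
      where
      nonneg : ∀ k j → k ≤ j → j ≤ n → 0ℚ ℚ.≤ Riseℚ X k j
      nonneg k j kj jn with ℕₚ.m≤n⇒m<n∨m≡n kj
      ... | inj₂ refl = ℚₚ.≤-reflexive (sym (ℚₚ.+-inverseʳ (X k)))
      ... | inj₁ lt   = ℚₚ.≤-trans (ι-mono-≤ {0ℤ} {+ (3 ^ (j ∸ k))} (ℤ.+≤+ z≤n)) (lo lt jn)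
      lem : ∀ a b c d → d ℚ.- a ℚ.+ (b ℚ.- c) ≡ b ℚ.- a ℚ.+ (d ℚ.- c)
      lem = solve 4 (λ a b c d → d :- a :+ (b :- c) := b :- a :+ (d :- c)) refl

    -- The entries of Z are doubled partial sums; this produces the interior point as well as its
    -- perturbations.
    integral-point : ∀ {S} Z → (∀ {i j} → i < j → j ≤ n → + (2 ℕ.* 3 ^ (j ∸ i)) ℤ.≤ Rise Z i j) →
                     (∀ {i j} → i < j → j ≤ n → S i j ≡ true → Rise Z i j ≡ + (2 ℕ.* 3 ^ (j ∸ i))) →
                     Realizes n S (prefix (differences n (halved Z)))
    integral-point Z lo up = realizes
      (λ {i} {j} ij jn → subst (_ ℚ.≤_) (sym (Rise-differences n (halved Z) (ℕₚ.≤-trans (ℕₚ.<⇒≤ ij) jn) jn))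
         (halved-lower Z i j (3 ^ (j ∸ i)) (lo ij jn)))
      (λ {i} {j} ij jn e → subst (ℚ._≤ _) (sym (Rise-differences n (halved Z) (ℕₚ.≤-trans (ℕₚ.<⇒≤ ij) jn) jn))
         (halved-upper Z i j (3 ^ (j ∸ i)) (ℤₚ.≤-reflexive (up ij jn e))))

    interiorPoint : Tree → ℚ^ n
    interiorPoint t = differences n (halved (height t))

    module _ {t : Tree} {S : Family} (tb : Tubes t (suc n) S) where

      private
        below : ∀ {j} → j ≤ n → j < leaves t
        below h = ℕₚ.≤-trans (s≤s h) (ℕₚ.≤-reflexive (sym (size tb)))

      interior-realizes : Realizes n S (prefix (interiorPoint t))
      interior-realizes = integral-point (height t) (λ ij jn → height-rise t ij (below jn))
        (λ ij jn e → height-tube (complete tb ij (s≤s jn) e))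

      interior-tight : ∀ {i j} → i < j → j ≤ n → Riseℚ (prefix (interiorPoint t)) i j ℚ.≤ qℕ (3 ^ (j ∸ i)) → S i j ≡
          true
      interior-tight {i} {j} ij jn h with classify t ij (below jn)
      ... | inj₁ tube  = sound tb tube
      ... | inj₂ slack = ⊥-elim (ℤₚ.≤⇒≯ (ℤₚ.≤-trans slack (halved-upper⁻ (height t) i j (3 ^ (j ∸ i))
              (subst (ℚ._≤ _) (Rise-differences n (halved (height t)) (ℕₚ.≤-trans (ℕₚ.<⇒≤ ij) jn) jn) h)))
              (ℤ.+<+ (ℕₚ.m<m+n _ (s≤s z≤n))))

    faceTubing : Face (assoc n) → Tubing (suc n)
    faceTubing F = tubing (flagged n (tightSet F))
        (realizes⇒laminar (Mem⇒Realizes (tightSet F) (proj₁ (nonempty F)) (proj₂ (nonempty F))))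
      λ where _ refl → flagged-root (tightSet F)

    private
      realizes-cong : ∀ {S S′ X} → (∀ {i j} → i < j → j ≤ n → S′ i j ≡ true → S i j ≡ true) → Realizes n S X →
          Realizes n S′ X
      realizes-cong h (realizes lo up) = realizes lo λ ij jn e → up ij jn (h ij jn e)

    tubingFace : Tubing (suc n) → Face (assoc n)
    tubingFace S = face (flags (family S))
        (interiorPoint t , Realizes⇒Mem (flags (family S)) (interiorPoint t) (realizes-cong
        (λ ij jn e → trans (sym (flagged-flags (family S) (whole S n>0 refl) ij jn)) e) (interior-realizes tb)))
      where
      t = proj₁ (treeOfTubing (s≤s z≤n) S)
      tb = proj₂ (treeOfTubing (s≤s z≤n) S)

    -- For `mono` the inclusion of F in G is tested at a single point, the interior point of the
    -- tree of F. As it lies in G, it is tight at the tubes of G, and these are therefore tubes of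
    -- F.
    assoc-faces : Faces (assoc n) ≃ Tubings (suc n)
    assoc-faces = record
      { to = faceTubing ; from = tubingFace
      ; mono = λ {F} {G} le {i} {j} ij jn e →
          let (t , tb) = treeOfTubing (s≤s z≤n) (faceTubing F)
              member-G = le (interiorPoint t) (Realizes⇒Mem (tightSet F) (interiorPoint t) (interior-realizes tb))
          in interior-tight tb ij (ℕₚ.≤-pred jn) (upper (Mem⇒Realizes (tightSet G) (interiorPoint t) member-G) ij (ℕₚ.≤-pred jn) e)
      ; reflects = λ {F} {G} r x m → Realizes⇒Mem (tightSet G) x
          (realizes-cong (λ ij jn → r ij (s≤s jn)) (Mem⇒Realizes (tightSet F) x m))
      ; to-from≤ = λ S ij jn e → trans (flagged-flags (family S) (whole S n>0 refl) ij (ℕₚ.≤-pred jn)) e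
      ; to-from≥ = λ S ij jn e → trans (sym (flagged-flags (family S) (whole S n>0 refl) ij (ℕₚ.≤-pred jn))) e }

-- Free leaves as coordinates for the directions of a face.

module FreeLeaves where

  open Trees
  open import Data.Bool using (if_then_else_)
  open import Data.Nat
  open import Data.Nat.Properties
  open import Data.Nat.Tactic.RingSolver using (solve-∀)
  open import Data.Product using (∃; _×_; _,_; proj₁; proj₂)

  nodes : Tree → ℕ
  nodesF : ∀ {k} → Forest k → ℕ
  nodes leaf     = 0
  nodes (node f) = suc (nodesF f)
  nodesF []      = 0
  nodesF (t ∷ f) = nodes t + nodesF f

  -- The directions of the face of a tree are the functions on the leaves which agree at the two ends of every
  -- tube and vanish at leaf 0. Such a function is free at the first leaf of every child other than the
  -- first and the last one; rank counts these free leaves and free enumerates them.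
  rank : Tree → ℕ
  rankF : ∀ {k} → Forest (suc k) → ℕ
  rank leaf           = 0
  rank (node (t ∷ f)) = rank t + rankF f
  rankF {zero}  (t ∷ []) = rank t
  rankF {suc k} (t ∷ f)  = suc (rank t + rankF f)

  -- Replacing a leaf by a node with k + 2 children adds k + 1 leaves, of which k count as free.
  -- Once `rank` is known to be the dimension, this is the formula for the codimension.
  rank-nodes : ∀ t → suc (rank t + nodes t) ≡ leaves t
  rankF-nodes : ∀ {k} (f : Forest (suc k)) → suc (rankF f + nodesF f) ≡ leavesF f
  rank-nodes leaf = refl
  rank-nodes (node (t ∷ f)) = trans (lem (rank t) (rankF f) (nodes t) (nodesF f))
      (cong₂ _+_ (rank-nodes t) (rankF-nodes f))
    where
    lem : ∀ a b c d → suc (a + b + suc (c + d)) ≡ suc (a + c) + suc (b + d)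
    lem = solve-∀
  rankF-nodes {zero}  (t ∷ []) = trans (cong (λ n → suc (rank t + n)) (+-identityʳ _))
      (trans (rank-nodes t) (sym (+-identityʳ _)))
  rankF-nodes {suc k} (t ∷ f)  = trans (lem (rank t) (rankF f) (nodes t) (nodesF f))
      (cong₂ _+_ (rank-nodes t) (rankF-nodes f))
    where
    lem : ∀ a b c d → suc (suc (a + b) + (c + d)) ≡ suc (a + c) + suc (b + d)
    lem = solve-∀

  free : Tree → ℕ → ℕ
  freeF : ∀ {k} → Forest (suc k) → ℕ → ℕ
  free leaf           i = 0
  free (node (t ∷ f)) i = if i <ᵇ rank t then free t i else leaves t + freeF f (i ∸ rank t)
  freeF {zero}  (t ∷ []) i       = free t i
  freeF {suc k} (t ∷ f)  zero    = 0
  freeF {suc k} (t ∷ f)  (suc i) = if i <ᵇ rank t then free t i else leaves t + freeF f (i ∸ rank t)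

  module _ {A : Set} where

    -- The direction with value b at leaf 0 and values c at the free leaves. The last leaf of a node
    -- has the value of its first one, so `extendF` hands b on to the last tree, and every other
    -- tree takes a new value from c.
    extend : Tree → A → (ℕ → A) → ℕ → A
    extendF : ∀ {k} → Forest (suc k) → A → (ℕ → A) → ℕ → A
    extend leaf           b c p = b
    extend (node (t ∷ f)) b c p = if p <ᵇ leaves t then extend t b c p
                                  else extendF f b (λ i → c (rank t + i)) (p ∸ leaves t)
    extendF {zero}  (t ∷ []) b c p = extend t b c p
    extendF {suc k} (t ∷ f)  b c p = if p <ᵇ leaves t then extend t (c 0) (c ∘ suc) p
                                     else extendF f b (λ i → c (suc (rank t + i))) (p ∸ leaves t)

  if-< : ∀ {B : Set} {m p} {x y : B} → p < m → (if p <ᵇ m then x else y) ≡ x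
  if-< lt rewrite <⇒<ᵇ≡true lt = refl

  if-≥ : ∀ {B : Set} m p {x : B} (y : ℕ → B) → (if m + p <ᵇ m then x else y (m + p ∸ m)) ≡ y p
  if-≥ m p y rewrite m+n<ᵇm m p | m+n∸m≡n m p = refl

  module _ {A : Set} where

    extend-there : ∀ t {k} (f : Forest (suc k)) {b : A} {c} p →
                   extend (node (t ∷ f)) b c (leaves t + p) ≡ extendF f b (λ i → c (rank t + i)) p
    extend-there t f {b} {c} p = if-≥ (leaves t) p (extendF f b (λ i → c (rank t + i)))

    extendF-there : ∀ t {k} (f : Forest (suc k)) {b : A} c p →
                    extendF (t ∷ f) b c (leaves t + p) ≡ extendF f b (λ i → c (suc (rank t + i))) p
    extendF-there t f {b} c p = if-≥ (leaves t) p (extendF f b (λ i → c (suc (rank t + i))))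

    extend-first : ∀ t {b : A} {c} → extend t b c 0 ≡ b
    extend-first leaf           = refl
    extend-first (node (t ∷ f)) = trans (if-< (leaves>0 t)) (extend-first t)

    extend-last : ∀ t {b : A} {c j} → suc j ≡ leaves t → extend t b c j ≡ b
    extendF-last : ∀ {k} (f : Forest (suc k)) {b : A} {c j} → suc j ≡ leavesF f → extendF f b c j ≡ b

    private
      in-rest : ∀ t {k} (f : Forest (suc k)) {j} → suc j ≡ leaves t + leavesF f →
                ∃ λ j′ → j ≡ leaves t + j′ × suc j′ ≡ leavesF f
      in-rest t f {j} e with split (leaves t) j
      ... | inj₂ (j′ , refl) = j′ , refl , +-cancelˡ-≡ (leaves t) _ _ (trans (+-suc (leaves t) j′) e)
      ... | inj₁ lt = ⊥-elim (<-irrefl e (≤-<-trans lt (m<m+n (leaves t) (≤-trans (s≤s z≤n) (leavesF≥ f)))))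

    extend-last leaf e = refl
    extend-last (node (t ∷ f)) e with in-rest t f e
    ... | j , refl , e′ = trans (extend-there t f j) (extendF-last f e′)
    extendF-last {zero}  (t ∷ []) e = extend-last t (trans e (+-identityʳ _))
    extendF-last {suc k} (t ∷ f) {c = c} e with in-rest t f e
    ... | j , refl , e′ = trans (extendF-there t f c j) (extendF-last f e′)

    extend-tube : ∀ {t} {b : A} {c i j} → Tube t i j → extend t b c i ≡ extend t b c j
    extendF-tube : ∀ {k} {f : Forest (suc k)} {b : A} {c i j} → TubeF f i j → extendF f b c i ≡ extendF f b c j
    extend-tube {node f} (root e) = trans (extend-first (node f)) (sym (extend-last (node f) e))
    extend-tube {node (t ∷ f)} (inner (here p)) = trans
        (if-< (<-trans (proj₁ (tube-bounds p)) (proj₂ (tube-bounds p))))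
      (trans (extend-tube p) (sym (if-< (proj₂ (tube-bounds p)))))
    extend-tube {node (t ∷ f)} (inner (there {i = i} {j} p refl refl)) =
      trans (extend-there t f i) (trans (extendF-tube p) (sym (extend-there t f j)))
    extendF-tube {zero}  {t ∷ []} (here p) = extend-tube p
    extendF-tube {suc k} {t ∷ f}  (here p) = trans (if-< (<-trans (proj₁ (tube-bounds p)) (proj₂ (tube-bounds p))))
      (trans (extend-tube p) (sym (if-< (proj₂ (tube-bounds p)))))
    extendF-tube {zero}  {t ∷ []} (there () _ _)
    extendF-tube {suc k} {t ∷ f} {c = c} (there {i = i} {j} p refl refl) =
      trans (extendF-there t f c i) (trans (extendF-tube p) (sym (extendF-there t f c j)))

    extend-all : ∀ (Q : A → Set) t {b c} → Q b → (∀ i → Q (c i)) → ∀ p → Q (extend t b c p)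
    extendF-all : ∀ (Q : A → Set) {k} (f : Forest (suc k)) {b c} → Q b → (∀ i → Q (c i)) → ∀ p → Q (extendF f b c p)
    extend-all Q leaf qb qc p = qb
    extend-all Q (node (t ∷ f)) qb qc p with p <ᵇ leaves t
    ... | Data.Bool.true  = extend-all Q t qb qc p
    ... | Data.Bool.false = extendF-all Q f qb (λ i → qc (rank t + i)) _
    extendF-all Q {k = zero}  (t ∷ []) qb qc p = extend-all Q t qb qc p
    extendF-all Q {k = suc k} (t ∷ f)  qb qc p with p <ᵇ leaves t
    ... | Data.Bool.true  = extend-all Q t (qc 0) (qc ∘ suc) p
    ... | Data.Bool.false = extendF-all Q f qb (λ i → qc (suc (rank t + i))) _

  free< : ∀ t {i} → i < rank t → free t i < leaves t
  freeF< : ∀ {k} (f : Forest (suc k)) {i} → i < rankF f → freeF f i < leavesF f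
  free< (node (t ∷ f)) {i} lt with split (rank t) i
  ... | inj₁ lt′ = subst (_< leaves t + leavesF f) (sym (if-< lt′)) (≤-trans (free< t lt′) (m≤m+n _ _))
  ... | inj₂ (i , refl) = subst (_< leaves t + leavesF f) (sym (if-≥ (rank t) i (λ i → leaves t + freeF f i)))
        (+-monoʳ-< (leaves t) (freeF< f (+-cancelˡ-< (rank t) _ _ lt)))
  freeF< {zero}  (t ∷ []) lt = ≤-trans (free< t lt) (m≤m+n _ _)
  freeF< {suc k} (t ∷ f) {zero}  lt = ≤-trans (leaves>0 t) (m≤m+n _ _)
  freeF< {suc k} (t ∷ f) {suc i} (s≤s lt) with split (rank t) i
  ... | inj₁ lt′ = subst (_< leaves t + leavesF f) (sym (if-< lt′)) (≤-trans (free< t lt′) (m≤m+n _ _))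
  ... | inj₂ (i , refl) = subst (_< leaves t + leavesF f) (sym (if-≥ (rank t) i (λ i → leaves t + freeF f i)))
        (+-monoʳ-< (leaves t) (freeF< f (+-cancelˡ-< (rank t) _ _ lt)))

  module _ {A : Set} where

    extend-free : ∀ t {b : A} {c i} → i < rank t → extend t b c (free t i) ≡ c i
    extendF-free : ∀ {k} (f : Forest (suc k)) {b : A} {c i} → i < rankF f → extendF f b c (freeF f i) ≡ c i
    extend-free (node (t ∷ f)) {b} {c} {i} lt with split (rank t) i
    ... | inj₁ lt′ = trans (cong (extend (node (t ∷ f)) b c) (if-< lt′))
        (trans (if-< (free< t lt′)) (extend-free t lt′))
    ... | inj₂ (i , refl) = trans (cong (extend (node (t ∷ f)) b c) (if-≥ (rank t) i (λ i → leaves t + freeF f i)))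
          (trans (extend-there t f (freeF f i)) (extendF-free f (+-cancelˡ-< (rank t) _ _ lt)))
    extendF-free {zero}  (t ∷ []) lt = extend-free t lt
    extendF-free {suc k} (t ∷ f) {b} {c} {zero}  lt = trans (if-< (leaves>0 t)) (extend-first t)
    extendF-free {suc k} (t ∷ f) {b} {c} {suc i} (s≤s lt) with split (rank t) i
    ... | inj₁ lt′ = trans (cong (extendF (t ∷ f) b c) (if-< lt′)) (trans (if-< (free< t lt′)) (extend-free t lt′))
    ... | inj₂ (i , refl) = trans (cong (extendF (t ∷ f) b c) (if-≥ (rank t) i (λ i → leaves t + freeF f i)))
          (trans (extendF-there t f c (freeF f i)) (extendF-free f (+-cancelˡ-< (rank t) _ _ lt)))

  module _ {A : Set} (z : A) where

    -- By this and `extend-free` the values at the free leaves are coordinates on the space of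
    -- directions. The uniqueness proved here gives the upper bound for the dimension, `extend` the
    -- lower one.
    vanishing : ∀ t (D : ℕ → A) → (∀ {i j} → Tube t i j → D i ≡ D j) → D 0 ≡ z →
                (∀ {i} → i < rank t → D (free t i) ≡ z) → ∀ {p} → p < leaves t → D p ≡ z
    vanishingF : ∀ {k} (f : Forest (suc k)) (D : ℕ → A) → (∀ {i j} → TubeF f i j → D i ≡ D j) →
                 (∀ {j} → suc j ≡ leavesF f → D j ≡ z) →
                 (∀ {i} → i < rankF f → D (freeF f i) ≡ z) → ∀ {p} → p < leavesF f → D p ≡ z

    private
      below-rest : ∀ t {k} (f : Forest (suc k)) (D : ℕ → A) → (∀ {i j} → TubeF (t ∷ f) i j → D i ≡ D j) → D 0 ≡ z →
        (∀ {j} → suc j ≡ leaves t + leavesF f → D j ≡ z) →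
        (∀ {i} → i < rank t + rankF f → D (if i <ᵇ rank t then free t i else leaves t + freeF f (i ∸ rank t)) ≡ z) →
        ∀ {p} → p < leaves t + leavesF f → D p ≡ z
    vanishing leaf D tb d0 fr (s≤s z≤n) = d0
    vanishing (node (t ∷ f)) D tb d0 fr = below-rest t f D (tb ∘ inner) d0 (λ e → trans (sym (tb (root e))) d0) fr
    vanishingF {zero} (t ∷ []) D tb last fr {p} lt =
      vanishing t D (tb ∘ here) (first t refl) fr (≤-trans lt (≤-reflexive (+-identityʳ _)))
      where
      -- For the last tree, D is known at its end. The root tube carries the value to its first
      -- leaf; a single leaf is both.
      first : ∀ s → s ≡ t → D 0 ≡ z
      first leaf     refl = last refl
      first (node g) refl = trans (tb (here (root (suc-pred-leaves (node g)))))
        (last (trans (suc-pred-leaves (node g)) (sym (+-identityʳ _))))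
    vanishingF {suc k} (t ∷ f) D tb last fr = below-rest t f D tb (fr (s≤s z≤n)) last (λ lt → fr (s≤s lt))
    below-rest t f D tb d0 last fr {p} lt with split (leaves t) p
    ... | inj₁ lt′ = vanishing t D (tb ∘ here) d0
          (λ {i} l → trans (cong D (sym (if-< l))) (fr (≤-trans l (m≤m+n _ _)))) lt′
    ... | inj₂ (p , refl) = vanishingF f (D ∘ (leaves t +_)) (λ x → tb (there x refl refl))
          (λ {j} e → last (trans (sym (+-suc (leaves t) j)) (cong (leaves t +_) e)))
          (λ {i} l → trans (cong D (sym (if-≥ (rank t) i (λ i → leaves t + freeF f i))))
              (fr (+-monoʳ-< (rank t) l)))
          (+-cancelˡ-< (leaves t) _ _ lt)

-- The dimension of a face is the rank of its tree.

module Dimension where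

  open Trees
  open TreeOfTubing
  open InteriorPoint
  open AssocGeometry
  open LinearAlgebra
  open FreeLeaves
  open import Data.Bool using (true; false; if_then_else_)
  open import Data.Nat as ℕ using (ℕ; zero; suc; _<_; _≤_; _∸_; _^_; _≡ᵇ_; z≤n; s≤s)
  import Data.Nat.Properties as ℕₚ
  open import Data.Integer as ℤ using (ℤ; +_; 0ℤ; 1ℤ)
  import Data.Integer.Properties as ℤₚ
  import Data.Integer.Tactic.RingSolver as ℤ-Solver
  open import Data.Rational as ℚ using (ℚ; 0ℚ; 1ℚ; ½)
  import Data.Rational.Properties as ℚₚ
  open import Data.Rational.Solver using (module +-*-Solver)
  open import Data.Fin using (Fin; zero; suc; toℕ; fromℕ<)
  import Data.Fin.Properties as Finₚ
  open import Data.Vec as Vec using (Vec; []; _∷_; tabulate; lookup)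
  import Data.Vec.Properties as Vecₚ
  import Data.Vec.Relation.Unary.All as VAll
  import Data.Vec.Relation.Unary.All.Properties as VAllₚ
  open import Data.List using (List)
  open import Data.Product using (Σ; _×_; _,_; proj₁; proj₂)

  open +-*-Solver

  prefix-+ᵥ : ∀ {n} (u v : ℚ^ n) p → prefix (u +ᵥ v) p ≡ prefix u p ℚ.+ prefix v p
  prefix-+ᵥ []      []      p       = refl
  prefix-+ᵥ (a ∷ u) (b ∷ v) zero    = refl
  prefix-+ᵥ (a ∷ u) (b ∷ v) (suc p) = trans (cong (a ℚ.+ b ℚ.+_) (prefix-+ᵥ u v p)) (lem a b _ _)
    where
    lem : ∀ a b x y → a ℚ.+ b ℚ.+ (x ℚ.+ y) ≡ a ℚ.+ x ℚ.+ (b ℚ.+ y)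
    lem = solve 4 (λ a b x y → a :+ b :+ (x :+ y) := a :+ x :+ (b :+ y)) refl

  prefix-minus : ∀ {n} (u v : ℚ^ n) p → prefix (u -ᵥ v) p ≡ prefix u p ℚ.- prefix v p
  prefix-minus []      []      p       = refl
  prefix-minus (a ∷ u) (b ∷ v) zero    = refl
  prefix-minus (a ∷ u) (b ∷ v) (suc p) = trans (cong (a ℚ.- b ℚ.+_) (prefix-minus u v p)) (lem a b _ _)
    where
    lem : ∀ a b x y → a ℚ.- b ℚ.+ (x ℚ.- y) ≡ a ℚ.+ x ℚ.- (b ℚ.+ y)
    lem = solve 4 (λ a b x y → a :- b :+ (x :- y) := a :+ x :- (b :+ y)) refl

  prefix-scale : ∀ {n} c (v : ℚ^ n) p → prefix (Vec.map (c ℚ.*_) v) p ≡ c ℚ.* prefix v p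
  prefix-scale c []      p       = sym (ℚₚ.*-zeroʳ c)
  prefix-scale c (a ∷ v) zero    = sym (ℚₚ.*-zeroʳ c)
  prefix-scale c (a ∷ v) (suc p) = trans (cong (c ℚ.* a ℚ.+_) (prefix-scale c v p)) (sym (ℚₚ.*-distribˡ-+ c a _))

  prefix-zeros : ∀ n p → prefix (zeros n) p ≡ 0ℚ
  prefix-zeros zero    p       = refl
  prefix-zeros (suc n) zero    = refl
  prefix-zeros (suc n) (suc p) = trans (ℚₚ.+-identityˡ _) (prefix-zeros n p)

  prefix-linComb : ∀ {n k} (cs : Vec ℚ k) (vs : Vec (ℚ^ n) k) p →
                   prefix (linComb cs vs) p ≡ Σᶠ (λ i → lookup cs i ℚ.* prefix (lookup vs i) p)
  prefix-linComb {n} []       []       p = prefix-zeros n p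
  prefix-linComb     (c ∷ cs) (v ∷ vs) p = trans (prefix-+ᵥ (Vec.map (c ℚ.*_) v) (linComb cs vs) p)
    (cong₂ ℚ._+_ (prefix-scale c v p) (prefix-linComb cs vs p))

  prefix-injective : ∀ {n} (v : ℚ^ n) → (∀ p → p ≤ n → prefix v p ≡ 0ℚ) → v ≡ zeros n
  prefix-injective []      e = refl
  prefix-injective (a ∷ v) e = cong₂ _∷_ a≡0 (prefix-injective v tail)
    where
    a≡0 : a ≡ 0ℚ
    a≡0 = trans (sym (trans (cong (a ℚ.+_) (prefix-0 v)) (ℚₚ.+-identityʳ a))) (e 1 (s≤s z≤n))
    tail : ∀ p → p ≤ _ → prefix v p ≡ 0ℚ
    tail p le = trans (sym (trans (cong (ℚ._+ prefix v p) a≡0) (ℚₚ.+-identityˡ _))) (e (suc p) (s≤s le))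

  lookup-zeros : ∀ {n} (i : Fin n) → lookup (zeros n) i ≡ 0ℚ
  lookup-zeros i = Vecₚ.lookup-replicate i 0ℚ

  zeros-ext : ∀ {n} (v : ℚ^ n) → (∀ i → lookup v i ≡ 0ℚ) → v ≡ zeros n
  zeros-ext []      e = refl
  zeros-ext (a ∷ v) e = cong₂ _∷_ (e zero) (zeros-ext v (e ∘ suc))

  bump : ℕ → ℕ → ℤ
  bump k i = if k ≡ᵇ i then 1ℤ else 0ℤ

  -- The list J may be any description of the points realizing S, because both the associahedron
  -- itself and its faces are measured in this way.
  module _ {n : ℕ} (n>0 : 0 < n) {t : Tree} {S : Family} (tb : Tubes t (suc n) S) (J : List (Ineq n))
           (inside : ∀ x → Mem (pres n J) x → Realizes n S (prefix x))
           (outside : ∀ x → Realizes n S (prefix x) → Mem (pres n J) x) where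

    private
      Q = pres n J

      below : ∀ {j} → j ≤ n → j < leaves t
      below h = ℕₚ.≤-trans (s≤s h) (ℕₚ.≤-reflexive (sym (size tb)))

      within : ∀ {j} → j < leaves t → j ≤ n
      within h = ℕₚ.≤-pred (ℕₚ.≤-trans h (ℕₚ.≤-reflexive (size tb)))

      tube-Rise : ∀ x → Mem Q x → ∀ {i j} → Tube t i j → Riseℚ (prefix x) i j ≡ qℕ (3 ^ (j ∸ i))
      tube-Rise x m tube = let (ij , jl) = tube-bounds tube in
        ℚₚ.≤-antisym (upper (inside x m) ij (within jl) (sound tb tube)) (lower (inside x m) ij (within jl))

      difference-tube : ∀ x y → Mem Q x → Mem Q y → ∀ {i j} → Tube t i j → prefix (x -ᵥ y) i ≡ prefix (x -ᵥ y) j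
      difference-tube x y mx my {i} {j} tube = trans (prefix-minus x y i)
        (trans (lem (prefix x i) (prefix x j) (prefix y i) (prefix y j)
                  (trans (tube-Rise x mx tube) (sym (tube-Rise y my tube))))
          (sym (prefix-minus x y j)))
        where
        regroup : ∀ a b c d → a ℚ.- c ≡ b ℚ.- d ℚ.+ ((d ℚ.- c) ℚ.- (b ℚ.- a))
        regroup = solve 4 (λ a b c d → a :- c := b :- d :+ ((d :- c) :- (b :- a))) refl
        lem : ∀ a b c d → b ℚ.- a ≡ d ℚ.- c → a ℚ.- c ≡ b ℚ.- d
        lem a b c d e = trans (regroup a b c d) (trans (cong (λ z → b ℚ.- d ℚ.+ (z ℚ.- (b ℚ.- a))) (sym e))
          (trans (cong (b ℚ.- d ℚ.+_) (ℚₚ.+-inverseʳ (b ℚ.- a))) (ℚₚ.+-identityʳ _)))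

    -- More than `rank t` difference vectors have a nontrivial combination whose partial sums vanish
    -- at all free leaves. Partial sums of differences of points of the face agree at the ends of
    -- every tube, so the combination is zero by `vanishing`.
    dimension≤rank : ∀ {d} (ps : Vec (ℚ^ n) (suc d)) → VAll.All (Mem Q) ps → AffIndep ps → d ≤ rank t
    dimension≤rank {d} (p₀ ∷ qs) (m₀ VAll.∷ ms) indep with d ℕ.≤? rank t
    ... | yes h = h
    ... | no ¬h = ⊥-elim (ck≢0 (trans (sym (Vecₚ.lookup∘tabulate c k))
                    (trans (cong (λ v → lookup v k) (indep (tabulate c) combination≡0)) (lookup-zeros k))))
      where
      vs = Vec.map (λ q → q -ᵥ p₀) qs
      kernel = nullspace (ℕₚ.≰⇒> ¬h) (λ r k → prefix (lookup vs k) (free t (toℕ r)))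
      c = proj₁ kernel
      k = proj₁ (proj₁ (proj₂ kernel))
      ck≢0 = proj₂ (proj₁ (proj₂ kernel))
      D : ℕ → ℚ
      D p = Σᶠ (λ i → c i ℚ.* prefix (lookup vs i) p)
      D-tube : ∀ {i j} → Tube t i j → D i ≡ D j
      D-tube {i} {j} tube = Σᶠ-cong λ l → cong (c l ℚ.*_)
        (subst (λ v → prefix v i ≡ prefix v j) (sym (Vecₚ.lookup-map l (_-ᵥ p₀) qs))
          (difference-tube (lookup qs l) p₀ (VAllₚ.lookup⁺ ms l) m₀ tube))
      D-first : D 0 ≡ 0ℚ
      D-first = Σᶠ-zero λ l → trans (cong (c l ℚ.*_) (prefix-0 (lookup vs l))) (ℚₚ.*-zeroʳ (c l))
      D-free : ∀ {i} → i < rank t → D (free t i) ≡ 0ℚ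
      D-free lt = trans (cong (D ∘ free t) (sym (Finₚ.toℕ-fromℕ< lt))) (proj₂ (proj₂ kernel) (fromℕ< lt))
      combination≡0 : linComb (tabulate c) vs ≡ zeros n
      combination≡0 = prefix-injective _ λ p le → trans (prefix-linComb (tabulate c) vs p)
        (trans (Σᶠ-cong λ l → cong (ℚ._* prefix (lookup vs l) p) (Vecₚ.lookup∘tabulate c l))
          (vanishing 0ℚ t D D-tube D-first D-free (below le)))

    private
      -- The perturbation with value 1 at the free leaf number k and 0 at the other free leaves. It
      -- does not change rises along tubes, and it lowers any other rise by at most 1, which the
      -- slack absorbs.
      D : ℕ → ℕ → ℤ
      D k = extend t 0ℤ (bump k)

      D-bounds : ∀ k p → 0ℤ ℤ.≤ D k p × D k p ℤ.≤ 1ℤ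
      D-bounds k = extend-all (λ z → 0ℤ ℤ.≤ z × z ℤ.≤ 1ℤ) t (ℤ.+≤+ z≤n , ℤ.+≤+ z≤n) bounds
        where
        bounds : ∀ i → 0ℤ ℤ.≤ bump k i × bump k i ℤ.≤ 1ℤ
        bounds i with k ≡ᵇ i
        ... | true  = ℤ.+≤+ z≤n , ℤ.+≤+ (s≤s z≤n)
        ... | false = ℤ.+≤+ z≤n , ℤ.+≤+ z≤n

      Z : ℕ → ℕ → ℤ
      Z k p = height t p ℤ.+ D k p

      regroup : ∀ a b c d → (a ℤ.+ b) ℤ.- (c ℤ.+ d) ≡ (a ℤ.- c) ℤ.+ (b ℤ.- d)
      regroup = ℤ-Solver.solve-∀

      Z-tube : ∀ k {i j} → Tube t i j → Rise (Z k) i j ≡ + (2 ℕ.* 3 ^ (j ∸ i))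
      Z-tube k {i} {j} tube = trans (regroup (height t j) (D k j) (height t i) (D k i))
        (trans (cong₂ ℤ._+_ (height-tube tube)
            (trans (cong (ℤ._-_ (D k j)) (extend-tube tube)) (ℤₚ.+-inverseʳ (D k j))))
          (ℤₚ.+-identityʳ _))

      Z-lower : ∀ k {i j} → i < j → j ≤ n → + (2 ℕ.* 3 ^ (j ∸ i)) ℤ.≤ Rise (Z k) i j
      Z-lower k {i} {j} ij jn with classify t ij (below jn)
      ... | inj₁ tube  = ℤₚ.≤-reflexive (sym (Z-tube k tube))
      ... | inj₂ slack = subst₂ ℤ._≤_ cancel (sym (regroup (height t j) (D k j) (height t i) (D k i)))
            (ℤₚ.+-mono-≤ slack (ℤₚ.+-mono-≤ (proj₁ (D-bounds k j)) (ℤₚ.neg-mono-≤ (proj₂ (D-bounds k i)))))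
        where
        lem : ∀ a → (a ℤ.+ 1ℤ) ℤ.+ (0ℤ ℤ.- 1ℤ) ≡ a
        lem = ℤ-Solver.solve-∀
        cancel : + (2 ℕ.* 3 ^ (j ∸ i) ℕ.+ 1) ℤ.+ (0ℤ ℤ.- 1ℤ) ≡ + (2 ℕ.* 3 ^ (j ∸ i))
        cancel = lem (+ (2 ℕ.* 3 ^ (j ∸ i)))

      point : ℕ → ℚ^ n
      point k = differences n (halved (Z k))

      centre : ℚ^ n
      centre = interiorPoint n n>0 t

      point∈ : ∀ k → Mem Q (point k)
      point∈ k = outside _ (integral-point n n>0 (Z k) (Z-lower k)
          (λ ij jn e → Z-tube k (complete tb ij (s≤s jn) e)))

      centre∈ : Mem Q centre
      centre∈ = outside _ (interior-realizes n n>0 tb)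

      point-difference : ∀ k p → p ≤ n → prefix (point k -ᵥ centre) p ≡ ½ ℚ.* ι (D k p)
      point-difference k p le = trans (prefix-minus (point k) centre p)
        (trans (cong₂ ℚ._-_ (prefix-differences n (halved (Z k)) p le)
            (prefix-differences n (halved (height t)) p le))
        (trans (cong₂ (λ a b → a ℚ.- b ℚ.- (halved (height t) p ℚ.- halved (height t) 0)) (halved-+ p) (halved-+ 0))
        (trans (lem (halved (height t) p) (½ ℚ.* ι (D k p)) (halved (height t) 0) (½ ℚ.* ι (D k 0)))
        (trans (cong (λ z → ½ ℚ.* ι (D k p) ℚ.- ½ ℚ.* ι z) (extend-first t)) (ℚₚ.+-identityʳ _)))))
        where
        halved-+ : ∀ p → halved (Z k) p ≡ halved (height t) p ℚ.+ ½ ℚ.* ι (D k p)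
        halved-+ p = trans (cong (½ ℚ.*_) (ι-+ (height t p) (D k p)))
            (ℚₚ.*-distribˡ-+ ½ (ι (height t p)) (ι (D k p)))
        lem : ∀ a b c d → a ℚ.+ b ℚ.- (c ℚ.+ d) ℚ.- (a ℚ.- c) ≡ b ℚ.- d
        lem = solve 4 (λ a b c d → a :+ b :- (c :+ d) :- (a :- c) := b :- d) refl

      bump-self : ∀ k → bump k k ≡ 1ℤ
      bump-self k rewrite ≡ᵇ-refl k = refl

      bump-other : ∀ k i → k ≢ i → bump k i ≡ 0ℤ
      bump-other k i ne with k ≡ᵇ i in eq
      ... | true  = ⊥-elim (ne (≡ᵇ-sound k i eq))
      ... | false = refl

    -- Relative to the centre, the partial sums of the perturbed points at the free leaves form ½
    -- times the identity matrix, so each coefficient can be read off at its own free leaf.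
    independent-points : ∀ e → e ≤ rank t → Σ (Vec (ℚ^ n) (suc e)) λ ps → VAll.All (Mem Q) ps × AffIndep ps
    independent-points e e≤r = centre ∷ qs , centre∈ VAll.∷ VAllₚ.tabulate⁺ (point∈ ∘ toℕ) , indep
      where
      qs = tabulate {n = e} (point ∘ toℕ)
      vs = Vec.map (_-ᵥ centre) qs
      lookup-vs : ∀ l → lookup vs l ≡ point (toℕ l) -ᵥ centre
      lookup-vs l = trans (Vecₚ.lookup-map l (_-ᵥ centre) qs)
          (cong (_-ᵥ centre) (Vecₚ.lookup∘tabulate (point ∘ toℕ) l))
      indep : LinIndep vs
      indep cs comb≡0 = zeros-ext cs λ l → half-cancel
          (trans (sym (coefficient l)) (trans (sym (prefix-linComb cs vs _))
                (trans (cong (λ v → prefix v (free t (toℕ l))) comb≡0) (prefix-zeros n _))))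
        where
        half-cancel : ∀ {c} → c ℚ.* ½ ≡ 0ℚ → c ≡ 0ℚ
        -- The sum ½ + ½ + 1 is 2, the inverse of ½.
        half-cancel {c} h = trans (sym (trans (ℚₚ.*-assoc c ½ (½ ℚ.+ ½ ℚ.+ 1ℚ)) (ℚₚ.*-identityʳ c)))
          (trans (cong (ℚ._* (½ ℚ.+ ½ ℚ.+ 1ℚ)) h) refl)
        l<r : ∀ (l : Fin e) → toℕ l < rank t
        l<r l = ℕₚ.<-≤-trans (Finₚ.toℕ<n l) e≤r
        entry : ∀ i l → prefix (lookup vs i) (free t (toℕ l)) ≡ ½ ℚ.* ι (bump (toℕ i) (toℕ l))
        entry i l = trans (cong (λ v → prefix v (free t (toℕ l))) (lookup-vs i))
          (trans (point-difference (toℕ i) _ (within (free< t (l<r l))))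
            (cong (λ z → ½ ℚ.* ι z) (extend-free t (l<r l))))
        coefficient : ∀ l → Σᶠ (λ i → lookup cs i ℚ.* prefix (lookup vs i) (free t (toℕ l))) ≡ lookup cs l ℚ.* ½
        coefficient l = trans (Σᶠ-single l (λ i ne → trans (cong (lookup cs i ℚ.*_)
            (trans (entry i l) (cong (λ z → ½ ℚ.* ι z) (bump-other (toℕ i) (toℕ l) (ne ∘ Finₚ.toℕ-injective)))))
            (ℚₚ.*-zeroʳ (lookup cs i))))
          (cong (lookup cs l ℚ.*_) (trans (entry l l) (cong (λ z → ½ ℚ.* ι z) (bump-self (toℕ l)))))

    dimension≡rank : ∀ {d} → HasAffDim Q d → d ≡ rank t
    dimension≡rank {d} ((ps , ms , indep) , maximal) = ℕₚ.≤-antisym (dimension≤rank ps ms indep) (ℕₚ.≮⇒≥ λ lt →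
      let (qs , mq , indep′) = independent-points (suc d) lt in maximal qs mq indep′)

-- Faces as products of associahedra, and their codimension.

module FacePolytopes where

  open FaceOrder
  open Trees
  open TreeOfTubing
  open InteriorPoint
  open AssocGeometry
  open FreeLeaves
  open Dimension
  open import Data.Bool using (Bool; true; false)
  open import Data.Nat as ℕ using (ℕ; zero; suc; _<_; z≤n; s≤s; _<?_)
  import Data.Nat.Properties as ℕₚ
  open import Data.Integer as ℤ using (+_)
  import Data.Integer.Properties as ℤₚ
  open import Data.List using (List; []; _∷_)
  open import Data.List.Relation.Unary.All using (All; []; _∷_)
  import Data.List.Relation.Unary.All.Properties as Allₚ
  open import Data.Product using (Σ; _×_; _,_; proj₁; proj₂)
  open import Data.Unit using (tt)

  -- A node with k + 2 children contributes the associahedron of index k + 1, whose faces are the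
  -- tubings of k + 2 leaves.
  poly : Tree → Pres
  polyF : ∀ {k} → Forest k → Pres
  poly leaf         = pointₚ
  poly (node {k} f) = assoc (suc k) ×ₚ polyF f
  polyF []      = pointₚ
  polyF (t ∷ f) = poly t ×ₚ polyF f

  poly-faces : ∀ t → Faces (poly t) ≃ Refinements t
  polyF-faces : ∀ {k} (f : Forest k) → Faces (polyF f) ≃ RefinementsF f
  poly-faces leaf         = ≃-trans point-faces (≃-sym refinements-leaf)
  poly-faces (node {k} f) = ≃-trans (product-faces (assoc (suc k)) (polyF f))
    (≃-trans (×ₒ-cong (assoc-faces (suc k) (s≤s z≤n)) (polyF-faces f)) (≃-sym (refinements-node f)))
  polyF-faces []      = point-faces
  polyF-faces (t ∷ f) = ≃-trans (product-faces (poly t) (polyF f)) (×ₒ-cong (poly-faces t) (polyF-faces f))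

  -- Two leaves span a single interval, which is always a tube. This makes the powers of -𝔞₁ in the
  -- interior mere signs.
  assoc1≅point : assoc 1 ≅ pointₚ
  assoc1≅point = ≃⇒≅ (≃-trans (assoc-faces 1 (s≤s z≤n)) (≃-trans trivial (≃-sym point-faces)))
    where
    trivial : Tubings 2 ≃ ⊤ₒ
    trivial = record
      { to = λ _ → tt
      ; from = λ _ → tubing (λ _ _ → true)
          (lam λ ik kj jl l<2 _ _ → ℕₚ.<⇒≱ l<2 (ℕₚ.≤-trans (s≤s (ℕₚ.≤-trans (ℕₚ.≤-trans (s≤s z≤n) ik) kj)) jl))
              (λ _ _ → refl)
      ; mono = λ _ → tt
      ; reflects = λ {S} _ ij j<2 _ → only S ij j<2
      ; to-from≤ = λ _ → tt ; to-from≥ = λ _ → tt }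
      where
      only : ∀ S {i j} → i < j → j < 2 → family S i j ≡ true
      only S {zero} {suc zero} _ _ = whole S (s≤s z≤n) refl
      only S {_} {suc (suc j)} _ (s≤s (s≤s ()))
      only S {suc i} {suc zero} (s≤s ()) _

  -- Being a tube is decidable because every pair of leaves is a tube or has slack, but not both.
  tubeFamily : Tree → Family
  tubeFamily t i j with i <? j | j <? leaves t
  ... | yes ij | yes jt with classify t ij jt
  ...   | inj₁ _ = true
  ...   | inj₂ _ = false
  tubeFamily t i j | _ | _ = false

  tubeFamily-tubes : ∀ t → Tubes t (leaves t) (tubeFamily t)
  tubeFamily-tubes t = tubes refl sound′ complete′
    where
    sound′ : ∀ {i j} → Tube t i j → tubeFamily t i j ≡ true
    sound′ {i} {j} p with i <? j | j <? leaves t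
    ... | no ¬ij | _      = ⊥-elim (¬ij (proj₁ (tube-bounds p)))
    ... | yes _  | no ¬jt = ⊥-elim (¬jt (proj₂ (tube-bounds p)))
    ... | yes ij | yes jt with classify t ij jt
    ...   | inj₁ _     = refl
    ...   | inj₂ slack = ⊥-elim (ℤₚ.≤⇒≯ (ℤₚ.≤-trans slack (ℤₚ.≤-reflexive (height-tube p)))
        (ℤ.+<+ (ℕₚ.m<m+n _ (s≤s z≤n))))
    complete′ : ∀ {i j} → i < j → j < leaves t → tubeFamily t i j ≡ true → Tube t i j
    complete′ {i} {j} _ _ e with i <? j | j <? leaves t
    ... | yes ij | yes jt with classify t ij jt
    ...   | inj₁ tube = tube

  module _ (n : ℕ) (n>0 : 0 < n) where

    -- Laminarity is obtained geometrically: the interior point of t realizes the tubes of t, and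
    -- realized families are laminar.
    tubingOf : ∀ t → leaves t ≡ suc n → Σ (Tubing (suc n)) λ S → Tubes t (suc n) (family S)
    tubingOf t e = tubing (tubeFamily t) (realizes⇒laminar n n>0 (interior-realizes n n>0 tb))
      (λ {j} pos e′ → sound tb (root-tube t (ℕₚ.≤-trans (s≤s n>0) (ℕₚ.≤-reflexive (sym e))) (trans e′ (sym e)))) ,
          tb
      where
      tb : Tubes t (suc n) (tubeFamily t)
      tb = subst (λ L → Tubes t L (tubeFamily t)) e (tubeFamily-tubes t)

    abstract
      faceTree : Face (assoc n) → Tree
      faceTree F = proj₁ (treeOfTubing (s≤s z≤n) (faceTubing n n>0 F))

      faceTree-tubes : ∀ F → Tubes (faceTree F) (suc n) (family (faceTubing n n>0 F))
      faceTree-tubes F = proj₂ (treeOfTubing (s≤s z≤n) (faceTubing n n>0 F))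

    module _ {t : Tree} {S : Tubing (suc n)} (tb : Tubes t (suc n) (family S)) where

      private
        up : ∀ {j} → j < suc n → j < leaves t
        up h = ℕₚ.≤-trans h (ℕₚ.≤-reflexive (sym (size tb)))
        down : ∀ {j} → j < leaves t → j < suc n
        down h = ℕₚ.≤-trans h (ℕₚ.≤-reflexive (size tb))

      below-tubing : Below (Tubings (suc n)) S ≃ Refinements t
      below-tubing = record
        { to = λ (R , le) → refinement (family R) (laminar-restrict (ℕₚ.≤-reflexive (size tb)) (laminar R))
            (λ p → le (proj₁ (tube-bounds p)) (down (proj₂ (tube-bounds p))) (sound tb p))
        ; from = λ R → tubing (fam R) (laminar-restrict (ℕₚ.≤-reflexive (sym (size tb))) (lami R))
            (λ { {j} pos e → contains R (root-tube t (up (ℕₚ.≤-trans (s≤s pos) (ℕₚ.≤-reflexive e)))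
                (trans e (sym (size tb)))) }) ,
            (λ ij jn e → contains R (complete tb ij jn e))
        ; mono = λ r ij jt → r ij (down jt)
        ; reflects = λ r ij jn → r ij (up jn)
        ; to-from≤ = λ _ _ _ e → e
        ; to-from≥ = λ _ _ _ e → e }

    Below-cong : ∀ {A B} (e : A ≃ B) a → Below A a ≃ Below B (_≃_.to e a)
    Below-cong {A} {B} e a = record
      { to = λ (x , le) → to x , mono le
      ; from = λ (y , le) → from y , reflects (Ord.trans≤ B (to-from≤ y) le)
      ; mono = mono ; reflects = reflects
      ; to-from≤ = λ (y , _) → to-from≤ y ; to-from≥ = λ (y , _) → to-from≥ y }
      where open _≃_ e

    abstract
      face≅poly : ∀ F → faceP F ≅ poly (faceTree F)
      face≅poly F = ≃⇒≅ (≃-trans (faces-of-face F) (≃-trans (Below-cong (assoc-faces n n>0) F)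
        (≃-trans (below-tubing {S = faceTubing n n>0 F} (faceTree-tubes F)) (≃-sym (poly-faces (faceTree F))))))

      faceTree-injective : ∀ F G → faceTree F ≡ faceTree G → F ≡ₛ G
      faceTree-injective F G e = half F G (faceTree-tubes F) (subst (λ t → Tubes t _ _) (sym e) (faceTree-tubes G))
          ,
                                 half G F (faceTree-tubes G) (subst (λ t → Tubes t _ _) e (faceTree-tubes F))
        where
        half : ∀ F G {t} → Tubes t (suc n) (family (faceTubing n n>0 F)) → Tubes t (suc n)
            (family (faceTubing n n>0 G)) → F ⊑ G
        half F G tbF tbG = _≃_.reflects (assoc-faces n n>0) {F} {G} λ ij jn e → sound tbF (complete tbG ij jn e)

      treeFace : ∀ t → leaves t ≡ suc n → Face (assoc n)
      treeFace t e = tubingFace n n>0 (proj₁ (tubingOf t e))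

      -- An enumeration contains the face of t only up to equality of point sets, so the tree is
      -- recovered from any such G. Families with the same tubes have the same tree by
      -- `tree-unique`.
      faceTree-treeFace : ∀ t e G → treeFace t e ≡ₛ G → t ≡ faceTree G
      faceTree-treeFace t e G (F⊑G , G⊑F) = tree-unique t (faceTree G) (trans e (sym (size tbG)))
        (λ p → let (ij , jt) = tube-bounds p ; jn = ℕₚ.≤-trans jt (ℕₚ.≤-reflexive e) in
           complete tbG ij jn (mono {G} {F} G⊑F ij jn (to-from≤ S ij jn (sound tbS p))))
        (λ p → let (ij , jt) = tube-bounds p ; jn = ℕₚ.≤-trans jt (ℕₚ.≤-reflexive (size tbG)) in
           complete tbS ij jn (to-from≥ S ij jn (mono {F} {G} F⊑G ij jn (sound tbG p))))
        where
        open _≃_ (assoc-faces n n>0)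
        S : Tubing (suc n)
        S = proj₁ (tubingOf t e)
        tbS : Tubes t (suc n) (family S)
        tbS = proj₂ (tubingOf t e)
        tbG : Tubes (faceTree G) (suc n) (family (faceTubing n n>0 G))
        tbG = faceTree-tubes G
        F : Face (assoc n)
        F = treeFace t e

    private
      childless : ∀ {k} (f : Forest k) → (∀ {i j} → ¬ TubeF f i j) → nodesF f ≡ 0
      childless []            h = refl
      childless (leaf ∷ f)    h = childless f (λ p → h (there p refl refl))
      childless (node g ∷ f)  h = ⊥-elim (h (here (root (suc-pred-leaves (node g)))))

      one-node : ∀ t → leaves t ≡ suc n → (∀ {i j} → Tube t i j → i ≡ 0 × j ≡ n) → nodes t ≡ 1
      one-node leaf     e h = ⊥-elim (ℕₚ.<⇒≢ n>0 (ℕₚ.suc-injective e))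
      one-node (node f) e h = cong suc (childless f λ p →
        case h (inner p) of λ { (refl , refl) → no-root (sym e) p })

    abstract
      -- For every face, rank and number of nodes add up to n. The tree of the whole polytope has
      -- just one node, as its only tube is the root tube; comparing the ranks, which are the
      -- dimensions, gives the codimension.
      nodes-codim : ∀ F {c} → HasCodim (assoc n) F c → nodes (faceTree F) ≡ suc c
      nodes-codim F {c} (dP , dF , hP , hF , dP≡dF+c) = ℕₚ.+-cancelˡ-≡ (rank t) _ _ (ℕₚ.suc-injective (begin
        suc (rank t ℕ.+ nodes t)   ≡⟨ trans (rank-nodes t) (size (faceTree-tubes F)) ⟩
        suc n                      ≡⟨ trans (rank-nodes t₀) (size (faceTree-tubes F₀)) ⟨
        suc (rank t₀ ℕ.+ nodes t₀) ≡⟨ cong₂ (λ a b → suc (a ℕ.+ b)) rank-t₀ nodes-t₀ ⟩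
        suc (rank t ℕ.+ c ℕ.+ 1)   ≡⟨ cong suc
            (trans (ℕₚ.+-assoc (rank t) c 1) (cong (rank t ℕ.+_) (ℕₚ.+-comm c 1))) ⟩
        suc (rank t ℕ.+ suc c)     ∎))
        where
        open ≡-Reasoning
        I : List (Ineq n)
        I = ineqs (assoc n)
        F₀ : Face (assoc n)
        -- The polytope itself, as the face without flags; a point of F witnesses that it is
        -- nonempty.
        F₀ = face [] (proj₁ (nonempty F) , Allₚ.++⁺ (Allₚ.++⁻ˡ I (proj₂ (nonempty F))) [])
        t t₀ : Tree
        t = faceTree F
        t₀ = faceTree F₀
        rank-t₀ : rank t₀ ≡ rank t ℕ.+ c
        rank-t₀ = trans (sym (dimension≡rank n>0 (faceTree-tubes F₀) I
              (λ x m → Mem⇒Realizes n n>0 [] x (Allₚ.++⁺ m []))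
              (λ x r → Allₚ.++⁻ˡ I (Realizes⇒Mem n n>0 [] x r)) hP))
          (trans dP≡dF+c (cong (ℕ._+ c) (dimension≡rank n>0 (faceTree-tubes F) (ineqs (faceP F))
              (Mem⇒Realizes n n>0 (tightSet F)) (Realizes⇒Mem n n>0 (tightSet F)) hF)))
        nodes-t₀ : nodes t₀ ≡ 1
        nodes-t₀ = one-node t₀ (size (faceTree-tubes F₀)) λ {i} {j} p → only-root i j (sound (faceTree-tubes F₀) p)
          where
          only-root : ∀ i j → flagged n [] i j ≡ true → i ≡ 0 × j ≡ n
          only-root i j e rewrite select-[] (pairs n) with (i ℕ.≡ᵇ 0) Data.Bool.∧ (j ℕ.≡ᵇ n) in eq
          ... | true = ≡ᵇ-sound i 0 (proj₁ (∧-true eq)) , ≡ᵇ-sound j n (proj₂ (∧-true {i ℕ.≡ᵇ 0} eq))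

-- Coefficients of β and of its powers as signed sums over trees and forests.

open FaceOrder
open PolytopeRing
open Trees
open TreeOfTubing using (size)
open FreeLeaves using (nodes; nodesF)
open FacePolytopes
open import Data.Nat as ℕ using (ℕ; zero; suc; _<_; _∸_; z≤n; s≤s)
import Data.Nat.Properties as ℕₚ
open import Data.Integer as ℤ using (ℤ; +_; 1ℤ; -1ℤ)
import Data.Integer.Properties as ℤₚ
open import Data.List as List using (List; []; _∷_; _++_; map; concatMap; upTo; applyUpTo)
import Data.List.Properties as Listₚ
open import Data.List.Membership.Propositional using (_∈_; lose; find)
open import Data.List.Membership.Propositional.Properties
open import Data.List.Membership.Propositional.Properties.WithK using (unique∧set⇒bag)
open import Data.List.Relation.Binary.BagAndSetEquality using (∼bag⇒↭)
open import Data.List.Relation.Binary.Permutation.Propositional as Perm using (_↭_)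
import Data.List.Relation.Binary.Permutation.Propositional.Properties as Permₚ
open import Data.List.Relation.Unary.Any using (here; there)
open import Data.List.Relation.Unary.All as All using (All; []; _∷_)
open import Data.List.Relation.Unary.AllPairs as AllPairs using ([]; _∷_)
import Data.List.Relation.Unary.AllPairs.Properties as AllPairsₚ
open import Data.List.Relation.Unary.Unique.Propositional using (Unique)
import Data.List.Relation.Unary.Unique.Propositional.Properties as Uniqueₚ
open import Data.Product using (_×_; _,_; proj₁; proj₂)
open import Relation.Binary.Construct.Closure.Equivalence using (return)
module SA = SeriesAlgebra 𝔓-ring
open SA using (_^ˢ_; _∘ˢ_)
open import Relation.Binary.Reasoning.Setoid (CommutativeRing.setoid 𝔓-ring)

sign : ℕ → ℤ
sign zero    = 1ℤ
sign (suc n) = ℤ.- sign n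

sign-+ : ∀ m n → sign (m ℕ.+ n) ≡ sign m ℤ.* sign n
sign-+ zero    n = ≡.sym (ℤₚ.*-identityˡ (sign n))
sign-+ (suc m) n = ≡.trans (cong ℤ.-_ (sign-+ m n)) (ℤₚ.neg-distribˡ-* (sign m) (sign n))

term : Tree → ℤ × Pres
term t = sign (nodes t) , poly t

termF : ∀ {k} → Forest k → ℤ × Pres
termF f = sign (nodesF f) , polyF f

concatMap-cong≈ : ∀ {A : Set} {f g : A → 𝔓} xs → (∀ x → x ∈ xs → f x ≈ g x) → concatMap f xs ≈ concatMap g xs
concatMap-cong≈ []       e = ≈-refl
concatMap-cong≈ (x ∷ xs) e = ++-cong (e x (here refl)) (concatMap-cong≈ xs (λ y p → e y (there p)))

↭⇒≈ : ∀ {u v : 𝔓} → u ↭ v → u ≈ v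
↭⇒≈ Perm.refl         = ≈-refl
↭⇒≈ (Perm.prep x p)   = ∷-cong x (↭⇒≈ p)
↭⇒≈ (Perm.swap x y p) = ≈-trans (return (Step.swap x y _)) (∷-cong y (∷-cong x (↭⇒≈ p)))
↭⇒≈ (Perm.trans p q)  = ≈-trans (↭⇒≈ p) (↭⇒≈ q)

-- The function `label` recovers the block from which an element comes, so different blocks are
-- disjoint.
unique-concatMap : ∀ {A B : Set} {f : A → List B} (label : B → A) {xs} →
  (∀ {x y} → x ∈ xs → y ∈ f x → label y ≡ x) → Unique xs → (∀ x → Unique (f x)) → Unique (concatMap f xs)
unique-concatMap label {[]} lab [] uf = []
unique-concatMap {f = f} label {x ∷ xs} lab (x∉ ∷ u) uf = Uniqueₚ.++⁺ (uf x)
  (unique-concatMap label (λ p → lab (there p)) u uf)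
  λ (p , q) → let (x′ , x′∈ , q′) = find (∈-concatMap⁻ f q)
              in All.lookup x∉ x′∈ (≡.trans (≡.sym (lab (here refl) p)) (lab (there x′∈) q′))

unique⇒↭ : ∀ {A : Set} {xs ys : List A} → Unique xs → Unique ys →
           (∀ {x} → x ∈ xs → x ∈ ys) → (∀ {x} → x ∈ ys → x ∈ xs) → xs ↭ ys
unique⇒↭ u v p q = ∼bag⇒↭ (unique∧set⇒bag u v (mk⇔ p q))

negative-power : ∀ c → (-𝔓 [ assoc 1 ]) ^𝔓 c ≈ (sign c , pointₚ) ∷ []
negative-power zero    = ≈-refl
negative-power (suc c) = begin
  (-𝔓 [ assoc 1 ]) *𝔓 ((-𝔓 [ assoc 1 ]) ^𝔓 c)
    ≈⟨ *-congˡ (-𝔓 [ assoc 1 ]) (negative-power c) ⟩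
  (-1ℤ ℤ.* sign c , assoc 1 ×ₚ pointₚ) ∷ []
    ≈⟨ return (relabel _ _ _ [] (≃⇒≅ (≃-trans (≅⇒≃ (×ₚ-cong assoc1≅point ≅-refl)) (≅⇒≃ (×ₚ-identityˡ pointₚ))))) ⟩
  (-1ℤ ℤ.* sign c , pointₚ) ∷ []
    ≡⟨ cong (λ s → (s , pointₚ) ∷ []) (ℤₚ.-1*i≡-i (sign c)) ⟩
  (sign (suc c) , pointₚ) ∷ [] ∎

-- By `nodes-codim` a tree has one node more than the codimension of its face, so the outer minus
-- sign in β turns (-1)^codim into (-1)^nodes.
interior≈trees : ∀ n (n>0 : 0 < n) (l : List (Face (assoc n) × ℕ)) →
  All (λ Fc → HasCodim (assoc n) (proj₁ Fc) (proj₂ Fc)) l →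
  -𝔓 (concatMap (λ Fc → ((-𝔓 [ assoc 1 ]) ^𝔓 proj₂ Fc) *𝔓 [ faceP (proj₁ Fc) ]) l) ≈
  map (term ∘ faceTree n n>0 ∘ proj₁) l
interior≈trees n n>0 []             []       = ≈-refl
interior≈trees n n>0 ((F , c) ∷ l) (h ∷ hs) = begin
  -𝔓 (summand ++ rest)
    ≡⟨ Listₚ.map-++ _ summand rest ⟩
  -𝔓 summand ++ -𝔓 rest
    ≈⟨ ++-cong (-𝔓-cong first) (interior≈trees n n>0 l hs) ⟩
  (ℤ.- sign c , poly (faceTree n n>0 F)) ∷ map (term ∘ faceTree n n>0 ∘ proj₁) l
    ≡⟨ cong (λ k → (sign k , poly (faceTree n n>0 F)) ∷ map (term ∘ faceTree n n>0 ∘ proj₁) l)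
        (nodes-codim n n>0 F h) ⟨
  map (term ∘ faceTree n n>0 ∘ proj₁) ((F , c) ∷ l) ∎
  where
  summand = ((-𝔓 [ assoc 1 ]) ^𝔓 c) *𝔓 [ faceP F ]
  rest = concatMap (λ Fc → ((-𝔓 [ assoc 1 ]) ^𝔓 proj₂ Fc) *𝔓 [ faceP (proj₁ Fc) ]) l
  first : summand ≈ (sign c , poly (faceTree n n>0 F)) ∷ []
  first = begin
    summand
      ≈⟨ *-congʳ [ faceP F ] (negative-power c) ⟩
    (sign c ℤ.* 1ℤ , pointₚ ×ₚ faceP F) ∷ []
      ≈⟨ return (relabel _ _ _ [] (≃⇒≅ (≃-trans (≅⇒≃ (×ₚ-identityˡ (faceP F))) (≅⇒≃ (face≅poly n n>0 F))))) ⟩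
    (sign c ℤ.* 1ℤ , poly (faceTree n n>0 F)) ∷ []
      ≡⟨ cong (λ s → (s , poly (faceTree n n>0 F)) ∷ []) (ℤₚ.*-identityʳ (sign c)) ⟩
    (sign c , poly (faceTree n n>0 F)) ∷ [] ∎

^S≈^ˢ : ∀ f k m → (f ^S k) m ≈ (f ^ˢ k) m
^S≈^ˢ f zero    zero    = ≈-refl
^S≈^ˢ f zero    (suc m) = ≈-refl
^S≈^ˢ f (suc k) m = ≈-trans (≈-reflexive (≡.sym (SA.⊛-unfold f (f ^S k) m)))
    (SA.⊛-cong (λ _ → ≈-refl) (^S≈^ˢ f k) m)

∘S≈∘ˢ : ∀ f g m → (f ∘S g) m ≈ (f ∘ˢ g) m
∘S≈∘ˢ f g m = ≈-trans (concatMap-cong≈ (upTo (suc m)) λ k _ → *-congˡ (f k) (^S≈^ˢ g k m))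
                      (≈-reflexive (≡.sym (SA.∘ˢ-unfold f g m)))

xS≈x̂ : ∀ m → xS m ≈ SA.x̂ m
xS≈x̂ zero          = ≈-refl
xS≈x̂ (suc zero)    = ≈-refl
xS≈x̂ (suc (suc m)) = ≈-refl

prepend : ∀ {k} → List Tree → List (Forest k) → List (Forest (suc k))
prepend ts fs = concatMap (λ t → map (t ∷_) fs) ts

module _ (E : (n : ℕ) → FaceEnum (assoc (suc n))) where

  -- Taken from the enumerations E, so that β is a sum over this very list. Completeness and
  -- distinctness of E show that it contains every tree with m leaves exactly once.
  treesWith : ℕ → List Tree
  treesWith zero          = []
  treesWith (suc zero)    = leaf ∷ []
  treesWith (suc (suc n)) = map (faceTree (suc n) (s≤s z≤n) ∘ proj₁) (faces (E n))

  forestsWith : ∀ k → ℕ → List (Forest k)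
  forestsWith zero    zero    = [] ∷ []
  forestsWith zero    (suc m) = []
  forestsWith (suc k) m       =
    concatMap (λ i → prepend (treesWith i) (forestsWith k (m ∸ i))) (upTo (suc m))

  ∈-treesWith⁻ : ∀ m {t} → t ∈ treesWith m → leaves t ≡ m
  ∈-treesWith⁻ (suc zero)    (here refl) = refl
  ∈-treesWith⁻ (suc (suc n)) p =
    let (Fc , _ , e) = ∈-map⁻ (faceTree (suc n) (s≤s z≤n) ∘ proj₁) p
    in ≡.trans (cong leaves e) (size (faceTree-tubes (suc n) (s≤s z≤n) (proj₁ Fc)))

  ∈-treesWith⁺ : ∀ m {t} → leaves t ≡ m → t ∈ treesWith m
  ∈-treesWith⁺ zero    {t} e = ⊥-elim (ℕₚ.<⇒≢ (leaves>0 t) (≡.sym e))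
  ∈-treesWith⁺ (suc zero) {leaf} e = here refl
  ∈-treesWith⁺ (suc zero) {node f} e = ⊥-elim (ℕₚ.<⇒≱ (s≤s (s≤s z≤n)) (ℕₚ.≤-trans (leavesF≥ f) (ℕₚ.≤-reflexive e)))
  ∈-treesWith⁺ (suc (suc n)) {t} e =
    let (Gc , G∈ , F≡G) = find (complete (E n) (treeFace (suc n) (s≤s z≤n) t e))
    in subst (_∈ treesWith (suc (suc n))) (≡.sym (faceTree-treeFace (suc n) (s≤s z≤n) t e (proj₁ Gc) F≡G))
         (∈-map⁺ (faceTree (suc n) (s≤s z≤n) ∘ proj₁) G∈)

  treesWith-unique : ∀ m → Unique (treesWith m)
  treesWith-unique zero          = []
  treesWith-unique (suc zero)    = [] ∷ []
  treesWith-unique (suc (suc n)) = AllPairsₚ.map⁺ (AllPairs.map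
    (λ {Fc} {Gc} F≢G eq → F≢G (faceTree-injective (suc n) (s≤s z≤n) (proj₁ Fc) (proj₁ Gc) eq)) (distinct (E n)))

  ∈-forestsWith⁻ : ∀ k m {f} → f ∈ forestsWith k m → leavesF f ≡ m
  ∈-forestsWith⁻ zero    zero    (here refl) = refl
  ∈-forestsWith⁻ (suc k) m p =
    let (i , i∈ , q)   = find (∈-concatMap⁻ (λ i → prepend (treesWith i) (forestsWith k (m ∸ i))) p)
        (t , t∈ , r)   = find (∈-concatMap⁻ (λ t → map (t ∷_) (forestsWith k (m ∸ i))) q)
        (f , f∈ , eq)  = ∈-map⁻ (t ∷_) r
    in ≡.trans (cong leavesF eq) (≡.trans (cong₂ ℕ._+_ (∈-treesWith⁻ i t∈) (∈-forestsWith⁻ k (m ∸ i) f∈))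
         (ℕₚ.m+[n∸m]≡n (ℕₚ.≤-pred (∈-upTo⁻ i∈))))

  ∈-forestsWith⁺ : ∀ k m {f : Forest k} → leavesF f ≡ m → f ∈ forestsWith k m
  ∈-forestsWith⁺ zero    zero {[]} e = here refl
  ∈-forestsWith⁺ (suc k) m {t ∷ f} refl =
    let m = leaves t ℕ.+ leavesF f in
    ∈-concatMap⁺ (λ i → prepend (treesWith i) (forestsWith k (m ∸ i)))
        (lose (∈-upTo⁺ (s≤s (ℕₚ.m≤m+n (leaves t) (leavesF f))))
      (∈-concatMap⁺ (λ s → map (s ∷_) (forestsWith k (m ∸ leaves t))) (lose (∈-treesWith⁺ (leaves t) refl)
        (∈-map⁺ (t ∷_) (∈-forestsWith⁺ k _ (≡.sym (ℕₚ.m+n∸m≡n (leaves t) (leavesF f))))))))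

  private
    head : ∀ {k} → Forest (suc k) → Tree
    head (t ∷ f) = t

    ∷-injectiveʳ : ∀ {k t} {f g : Forest k} → _≡_ {A = Forest (suc k)} (t ∷ f) (t ∷ g) → f ≡ g
    ∷-injectiveʳ refl = refl

    head-of-map : ∀ {k t} {fs : List (Forest k)} {g} → g ∈ map (t ∷_) fs → head g ≡ t
    head-of-map {t = t} p = let (_ , _ , e) = ∈-map⁻ (t ∷_) p in cong head e

  forestsWith-unique : ∀ k m → Unique (forestsWith k m)
  forestsWith-unique zero    zero    = [] ∷ []
  forestsWith-unique zero    (suc m) = []
  forestsWith-unique (suc k) m = unique-concatMap (leaves ∘ head)
    (λ {i} _ p → let (t , t∈ , q) = find (∈-concatMap⁻ (λ t → map (t ∷_) (forestsWith k (m ∸ i))) {treesWith i} p)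
                 in ≡.trans (cong leaves (head-of-map q)) (∈-treesWith⁻ i t∈))
    (Uniqueₚ.upTo⁺ (suc m))
    λ i → unique-concatMap head (λ _ → head-of-map) (treesWith-unique i)
      λ t → Uniqueₚ.map⁺ ∷-injectiveʳ (forestsWith-unique k (m ∸ i))

  β≈trees : ∀ m → β E m ≈ map term (treesWith m)
  β≈trees zero          = ≈-refl
  β≈trees (suc zero)    = ≈-refl
  β≈trees (suc (suc n)) = ≈-trans (interior≈trees (suc n) (s≤s z≤n) (faces (E n)) (codims (E n)))
    (≈-reflexive (Listₚ.map-∘ (faces (E n))))

  private
    graft : ∀ {k} t (fs : List (Forest k)) → scale (term t) (map termF fs) ≡ map termF (map (t ∷_) fs)
    graft t []       = refl
    graft t (f ∷ fs) = cong₂ _∷_ (cong (_, polyF (t ∷ f)) (≡.sym (sign-+ (nodes t) (nodesF f)))) (graft t fs)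

    grafts : ∀ {k} ts (fs : List (Forest k)) →
             map term ts *𝔓 map termF fs ≡ map termF (prepend ts fs)
    grafts []       fs = refl
    grafts (t ∷ ts) fs = ≡.trans (cong₂ _++_ (graft t fs) (grafts ts fs))
      (≡.sym (Listₚ.map-++ termF (map (t ∷_) fs) _))

  -- Expanding the power chooses one tree for every factor, that is, a forest with k trees; signs
  -- and polytopes multiply along it.
  power≈forests : ∀ k m → (β E ^S k) m ≈ map termF (forestsWith k m)
  power≈forests zero    zero    = ≈-refl
  power≈forests zero    (suc m) = ≈-refl
  power≈forests (suc k) m = begin
    concatMap (λ i → β E i *𝔓 (β E ^S k) (m ∸ i)) (upTo (suc m))
      ≈⟨ concatMap-cong≈ (upTo (suc m)) (λ i _ → ≈-trans (*-cong (β≈trees i) (power≈forests k (m ∸ i)))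
           (≈-reflexive (grafts (treesWith i) (forestsWith k (m ∸ i))))) ⟩
    concatMap (λ i → map termF (prepend (treesWith i) (forestsWith k (m ∸ i)))) (upTo (suc m))
      ≡⟨ Listₚ.map-concatMap termF (λ i → prepend (treesWith i) (forestsWith k (m ∸ i))) (upTo (suc m)) ⟨
    map termF (forestsWith (suc k) m) ∎

  nodesWith : ℕ → List Tree
  nodesWith n = concatMap (λ k → map node (forestsWith (2 ℕ.+ k) (2 ℕ.+ n))) (upTo (suc n))

  -- Both lists contain exactly the trees with n + 2 leaves, without repetition; the second one
  -- sorts them by the arity k + 2 of the root, which cannot exceed the number of leaves, so that k
  -- ≤ n.
  treesWith↭nodesWith : ∀ n → treesWith (2 ℕ.+ n) ↭ nodesWith n
  treesWith↭nodesWith n = unique⇒↭ (treesWith-unique (2 ℕ.+ n)) nodes-unique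
    (λ p → nodes⁺ (∈-treesWith⁻ (2 ℕ.+ n) p)) (λ p → ∈-treesWith⁺ (2 ℕ.+ n) (nodes⁻ p))
    where
    nodesOfArity : ℕ → List Tree
    nodesOfArity k = map node (forestsWith (2 ℕ.+ k) (2 ℕ.+ n))
    arity : Tree → ℕ
    arity leaf         = 0
    arity (node {k} f) = k
    arity-node : ∀ {k t} {fs : List (Forest (2 ℕ.+ k))} → t ∈ map node fs → arity t ≡ k
    arity-node p = let (_ , _ , e) = ∈-map⁻ node p in cong arity e
    node-injective : ∀ {k} {f g : Forest (2 ℕ.+ k)} → node f ≡ node g → f ≡ g
    node-injective refl = refl
    nodes-unique : Unique (nodesWith n)
    nodes-unique = unique-concatMap {f = nodesOfArity} arity
        (λ {k} _ → arity-node {k} {fs = forestsWith (2 ℕ.+ k) (2 ℕ.+ n)}) (Uniqueₚ.upTo⁺ (suc n))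
      λ k → Uniqueₚ.map⁺ node-injective (forestsWith-unique (2 ℕ.+ k) (2 ℕ.+ n))
    nodes⁺ : ∀ {t} → leaves t ≡ 2 ℕ.+ n → t ∈ nodesWith n
    nodes⁺ {leaf} ()
    nodes⁺ {node {k} f} e = ∈-concatMap⁺ nodesOfArity
        (lose {P = λ l → node f ∈ nodesOfArity l} (∈-upTo⁺ (ℕₚ.≤-pred (ℕₚ.≤-trans (leavesF≥ f) (ℕₚ.≤-reflexive e))))
      (∈-map⁺ node (∈-forestsWith⁺ (2 ℕ.+ k) (2 ℕ.+ n) e)))
    nodes⁻ : ∀ {t} → t ∈ nodesWith n → leaves t ≡ 2 ℕ.+ n
    nodes⁻ p =
      let (k , _ , q)   = find (∈-concatMap⁻ nodesOfArity {upTo (suc n)} p)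
          (f , f∈ , e) = ∈-map⁻ node {xs = forestsWith (2 ℕ.+ k) (2 ℕ.+ n)} q
      in ≡.trans (cong leaves e) (∈-forestsWith⁻ (2 ℕ.+ k) (2 ℕ.+ n) f∈)

  private
    -- A new root multiplies the polytope by its associahedron and increases the number of nodes by
    -- one, which accounts for the minus sign.
    corolla : ∀ {k} (fs : List (Forest (2 ℕ.+ k))) →
              [ assoc (suc k) ] *𝔓 map termF fs ≡ -𝔓 (map term (map node fs))
    corolla fs = ≡.trans (Listₚ.++-identityʳ _) (go fs)
      where
      go : ∀ {k} (fs : List (Forest (2 ℕ.+ k))) →
           scale (1ℤ , assoc (suc k)) (map termF fs) ≡ -𝔓 (map term (map node fs))
      go []       = refl
      go (f ∷ fs) = cong₂ _∷_ (cong (_, poly (node f))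
        (≡.trans (ℤₚ.*-identityˡ _) (≡.sym (ℤₚ.neg-involutive (sign (nodesF f)))))) (go fs)

    first-power : ∀ m → (β E ^S 1) m ≈ β E m
    first-power m = ≈-trans (^S≈^ˢ (β E) 1 m) (SA.⊛-identityʳ (β E) m)

    higher : ∀ n → concatMap (λ k → α k *𝔓 (β E ^S k) (2 ℕ.+ n)) (applyUpTo (2 ℕ.+_) (suc n)) ≈ -𝔓 (β E (2 ℕ.+ n))
    higher n = begin
      concatMap summand (applyUpTo (2 ℕ.+_) (suc n))
        ≡⟨ cong List.concat (≡.trans (Listₚ.map-applyUpTo (2 ℕ.+_) summand (suc n))
             (≡.sym (Listₚ.map-applyUpTo id (summand ∘ (2 ℕ.+_)) (suc n)))) ⟩
      concatMap (summand ∘ (2 ℕ.+_)) (upTo (suc n))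
        ≈⟨ concatMap-cong≈ (upTo (suc n))
            (λ k _ → ≈-trans (*-congˡ [ assoc (suc k) ] (power≈forests (2 ℕ.+ k) (2 ℕ.+ n)))
             (≈-reflexive (corolla (forestsWith (2 ℕ.+ k) (2 ℕ.+ n))))) ⟩
      concatMap (λ k → -𝔓 (map term (map node (forestsWith (2 ℕ.+ k) (2 ℕ.+ n))))) (upTo (suc n))
        ≡⟨ Listₚ.map-concatMap _ (λ k → map term (map node (forestsWith (2 ℕ.+ k) (2 ℕ.+ n)))) (upTo (suc n)) ⟨
      -𝔓 (concatMap (λ k → map term (map node (forestsWith (2 ℕ.+ k) (2 ℕ.+ n)))) (upTo (suc n)))
        ≡⟨ cong -𝔓_ (Listₚ.map-concatMap term (λ k → map node (forestsWith (2 ℕ.+ k) (2 ℕ.+ n))) (upTo (suc n))) ⟨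
      -𝔓 (map term (nodesWith n))
        ≈⟨ -𝔓-cong (↭⇒≈ (Permₚ.map⁺ term (treesWith↭nodesWith n))) ⟨
      -𝔓 (map term (treesWith (2 ℕ.+ n)))
        ≈⟨ -𝔓-cong (β≈trees (2 ℕ.+ n)) ⟨
      -𝔓 (β E (2 ℕ.+ n)) ∎
      where
      summand : ℕ → 𝔓
      summand k = α k *𝔓 (β E ^S k) (2 ℕ.+ n)

  α∘β≈x : ∀ m → (α ∘S β E) m ≈ xS m
  α∘β≈x zero       = ≈-refl
  α∘β≈x (suc zero) = begin
    1𝔓 *𝔓 (β E ^S 1) 1 ++ [] ≡⟨ Listₚ.++-identityʳ _ ⟩
    1𝔓 *𝔓 (β E ^S 1) 1       ≈⟨ *-identityˡ _ ⟩
    (β E ^S 1) 1             ≈⟨ first-power 1 ⟩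
    1𝔓                       ∎
  α∘β≈x (suc (suc n)) = begin
    -- The term k = 0 has already reduced to the empty sum, as α has no constant term; the term
    -- shown is k = 1.
    1𝔓 *𝔓 (β E ^S 1) (2 ℕ.+ n) ++ rest ≈⟨ ++-cong (≈-trans (*-identityˡ _) (first-power (2 ℕ.+ n))) (higher n) ⟩
    β E (2 ℕ.+ n) ++ -𝔓 (β E (2 ℕ.+ n)) ≈⟨ -𝔓-inverseʳ (β E (2 ℕ.+ n)) ⟩
    []                                  ∎
    where
    rest = concatMap (λ k → α k *𝔓 (β E ^S k) (2 ℕ.+ n)) (applyUpTo (2 ℕ.+_) (suc n))

  β∘α≈x : ∀ m → (β E ∘S α) m ≈ xS m
  β∘α≈x m = begin
    (β E ∘S α) m ≈⟨ ∘S≈∘ˢ (β E) α m ⟩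
    (β E ∘ˢ α) m ≈⟨ SA.right-inverse⇒left-inverse (SA.noConstant ≈-refl) ≈-refl (SA.noConstant ≈-refl) α∘ˢβ m ⟩
    SA.x̂ m       ≈⟨ xS≈x̂ m ⟨
    xS m         ∎
    where
    α∘ˢβ : ∀ m → (α ∘ˢ β E) m ≈ SA.x̂ m
    α∘ˢβ m = ≈-trans (≈-sym (∘S≈∘ˢ α (β E) m)) (≈-trans (α∘β≈x m) (xS≈x̂ m))

theorem3p4 : (E : (n : ℕ) → FaceEnum (assoc (suc n)))
    → ((m : ℕ) → (α ∘S β E) m ≈ xS m) × ((m : ℕ) → (β E ∘S α) m ≈ xS m)
theorem3p4 E = α∘β≈x E , β∘α≈x E
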